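{- Let $\psi(\vec X,x)$ be a formula whose free variables are among the individual variable $x$ and the predicate variables $\vec X = X_1,\dots,X_q$. If $\mathsf{MSO}\vdash \mathcal B^x_{\vec X}(\psi(\vec X,x))$, where \[\mathcal B^x_{\vec X}(\psi) := \forall z\forall\vec Z\forall\vec Z'\Big(\bigwedge_{1\leq i\leq q}\forall y\leq z\,(Z_i y\leftrightarrow Z'_i y)\ \to\ \big(\psi[\vec Z/\vec X,z/x]\leftrightarrow\psi[\vec Z'/\vec X,z/x]\big)\Big),\] then there is a uniformly bounded formula $\hat\varphi(\vec X,x)$, effectively computable from $\psi$, such that $\mathsf{MSO}\vdash\forall\vec X\forall x\big(\psi(\vec X,x)\leftrightarrow\hat\varphi(\vec X,x)\big)$.
   Context: \emph{Language.} Two-sorted: individual variables $x,y,z,\dots$, predicate variables $X,Y,Z,\dots$. Atomic formulae: $x\doteq y$, $x\leq y$, $\mathsf S(x,y)$, $\mathsf{Zero}(x)$, $x\in X$ (also written $Xx$), $\top$, $\bot$. Formulae: $\varphi ::= \alpha\mid\varphi\wedge\psi\mid\lnot\varphi\mid\exists x\varphi\mid\exists X\varphi$. Abbreviations: $\varphi\to\psi:=\lnot(\varphi\wedge\lnot\psi)$, $\varphi\leftrightarrow\psi:=(\varphi\to\psi)\wedge(\psi\to\varphi)$, $\forall x\varphi:=\lnot\exists x\lnot\varphi$, $\forall X\varphi:=\lnot\exists X\lnot\varphi$, $\forall y\leq z\,\varphi := \forall y(y\leq z\to\varphi)$. Relativization: $\alpha|\theta[y]:=\alpha$, commuting with $\wedge,\lnot,\exists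 X$, and $(\exists x\varphi)|\theta[y]:=\exists x(\theta[x/y]\wedge\varphi|\theta[y])$. A formula is \emph{uniformly bounded} (by $x$) if it has the form $\chi|(y\leq x)[y]$ and $x$ is its only free individual variable. \emph{$\mathsf{MSO}$} is the classical deduction system on sequents $\vec\varphi\vdash\varphi$ with: axiom, cut, $\lnot$-introduction ($\vec\varphi,\varphi\vdash\bot$ gives $\vec\varphi\vdash\lnot\varphi$) and elimination ($\vec\varphi\vdash\varphi$ and $\vec\varphi\vdash\lnot\varphi$ give $\vec\varphi\vdash\bot$), $\wedge$-rules, $\exists$-introduction and elimination (with eigenvariable conditions) for both sorts, double negation elimination; arithmetic rules: $\doteq$ reflexive with substitution of equals; $\leq$ reflexive, transitive, antisymmetric (yielding $\doteq$); $\vdash\exists y\mathsf{Zero}(y)$; $\mathsf{Zero}(x),\mathsf{Zero}(y)$ give $x\doteq y$; $\vdash\exists y\mathsf S(x,y)$; $\mathsf S(y,x),\mathsf S(z,x)$ give $y\doteq z$; $\mathsf S(x,y),\mathsf S(x,z)$ give $y\doteq z$; $\mathsf S(x,y),\mathsf{Zero}(y)$ give $\bot$; $\mathsf S(x,y)$ gives $x\leq y$; $\mathsf S(y,y'),x\leq y',\lnot(x\doteq y')$ give $x\leq y$; comprehension (from $\vec\varphi\vdash\varphi[\chi[y]/X]$ infer $\vec\varphi\vdash\exists X\varphi$, where $\varphi[\chi[y]/X]$ replaces each atom $t\in X$ by $\chi[t/y]$); induction (from $\vec\varphi,\mathsf{Zero}(z)\vdash\varphi[z/x]$ and $\vec\varphi,\mathsf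 S(y,z),\varphi[y/x]\vdash\varphi[z/x]$ infer $\vec\varphi\vdash\varphi$, $y,z$ not free in $\vec\varphi,\varphi$). -}

module Defs where

-- Syntax and the deduction system MSO, using (unscoped) de Bruijn indices
-- for both sorts of variables, so that all substitutions are capture-free
-- and eigenvariable conditions become shifts.

open import Data.Nat using (ℕ; zero; suc; _+_; _<_; _≡ᵇ_)
open import Data.Bool using (if_then_else_)
open import Data.List using (List; []; _∷_; map)
open import Data.List.Membership.Propositional using (_∈_)
open import Data.Product using (Σ; _×_)
open import Relation.Binary.PropositionalEquality using (_≡_)

-- Formulae.  Individual variables and predicate variables are natural
-- numbers (de Bruijn indices; index 0 = innermost binder of that sort,
-- indices beyond the binders are free variables).

infixr 6 _∧'_

data Fm : Set where
  _≐_   : ℕ → ℕ → Fm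
  _≤'_  : ℕ → ℕ → Fm
  S     : ℕ → ℕ → Fm
  Zero  : ℕ → Fm
  _∈'_  : ℕ → ℕ → Fm          -- x ∈ X  (individual, predicate)
  ⊤' ⊥' : Fm
  _∧'_  : Fm → Fm → Fm
  ¬'_   : Fm → Fm
  ∃¹    : Fm → Fm
  ∃²    : Fm → Fm

_⇒'_ : Fm → Fm → Fm
φ ⇒' ψ = ¬' (φ ∧' ¬' ψ)

_⇔'_ : Fm → Fm → Fm
φ ⇔' ψ = (φ ⇒' ψ) ∧' (ψ ⇒' φ)

∀¹ : Fm → Fm
∀¹ φ = ¬' ∃¹ (¬' φ)

∀² : Fm → Fm
∀² φ = ¬' ∃² (¬' φ)

∀²^ : ℕ → Fm → Fm
∀²^ zero    φ = φ
∀²^ (suc k) φ = ∀² (∀²^ k φ)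

⋀ : ℕ → (ℕ → Fm) → Fm
⋀ zero    f = ⊤'
⋀ (suc q) f = ⋀ q f ∧' f q

lift : (ℕ → ℕ) → ℕ → ℕ
lift ρ zero    = zero
lift ρ (suc k) = suc (ρ k)

ren1 : (ℕ → ℕ) → Fm → Fm
ren1 ρ (x ≐ y)  = ρ x ≐ ρ y
ren1 ρ (x ≤' y) = ρ x ≤' ρ y
ren1 ρ (S x y)  = S (ρ x) (ρ y)
ren1 ρ (Zero x) = Zero (ρ x)
ren1 ρ (x ∈' X) = ρ x ∈' X
ren1 ρ ⊤'       = ⊤'
ren1 ρ ⊥'       = ⊥'
ren1 ρ (φ ∧' ψ) = ren1 ρ φ ∧' ren1 ρ ψ
ren1 ρ (¬' φ)   = ¬' ren1 ρ φ
ren1 ρ (∃¹ φ)   = ∃¹ (ren1 (lift ρ) φ)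
ren1 ρ (∃² φ)   = ∃² (ren1 ρ φ)

ren2 : (ℕ → ℕ) → Fm → Fm
ren2 ρ (x ∈' X) = x ∈' ρ X
ren2 ρ (φ ∧' ψ) = ren2 ρ φ ∧' ren2 ρ ψ
ren2 ρ (¬' φ)   = ¬' ren2 ρ φ
ren2 ρ (∃¹ φ)   = ∃¹ (ren2 ρ φ)
ren2 ρ (∃² φ)   = ∃² (ren2 (lift ρ) φ)
ren2 ρ φ        = φ

shift1 : Fm → Fm
shift1 = ren1 suc

shift2 : Fm → Fm
shift2 = ren2 suc

_◂id : ℕ → ℕ → ℕ
(t ◂id) zero    = t
(t ◂id) (suc k) = k

inst1 : Fm → ℕ → Fm
inst1 φ t = ren1 (t ◂id) φ

repl : ℕ → ℕ → ℕ → ℕ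
repl x t k = if k ≡ᵇ x then t else k

-- Substitution of formulae for predicate variables.  An "abstraction"
-- χ[y] is a formula whose individual index 0 plays the role of y (its
-- other free individual indices k+1 denote the outer variables k).
-- sub2 σ φ replaces every atom t ∈ X (X free) by χ[t/y] where χ = σ X.

sub2 : (ℕ → Fm) → Fm → Fm
sub2 σ (x ∈' X) = inst1 (σ X) x
sub2 σ (φ ∧' ψ) = sub2 σ φ ∧' sub2 σ ψ
sub2 σ (¬' φ)   = ¬' sub2 σ φ
sub2 σ (∃¹ φ)   = ∃¹ (sub2 (λ X → ren1 (lift suc) (σ X)) φ)
sub2 σ (∃² φ)   = ∃² (sub2 σ' φ)
  where
  σ' : ℕ → Fm
  σ' zero    = zero ∈' zero
  σ' (suc X) = shift2 (σ X)
sub2 σ φ        = φ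

instComp : Fm → Fm → Fm
instComp φ χ = sub2 σ φ
  where
  σ : ℕ → Fm
  σ zero    = χ
  σ (suc k) = zero ∈' k

infix 3 _⊢_

data _⊢_ : List Fm → Fm → Set where
  ax      : ∀ {Γ φ} → φ ∈ Γ → Γ ⊢ φ
  cut     : ∀ {Γ φ ψ} → Γ ⊢ φ → φ ∷ Γ ⊢ ψ → Γ ⊢ ψ
  ⊤-intro : ∀ {Γ} → Γ ⊢ ⊤'
  ¬-intro : ∀ {Γ φ} → φ ∷ Γ ⊢ ⊥' → Γ ⊢ ¬' φ
  ¬-elim  : ∀ {Γ φ} → Γ ⊢ φ → Γ ⊢ ¬' φ → Γ ⊢ ⊥'
  ∧-intro : ∀ {Γ φ ψ} → Γ ⊢ φ → Γ ⊢ ψ → Γ ⊢ φ ∧' ψ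
  ∧-elimˡ : ∀ {Γ φ ψ} → Γ ⊢ φ ∧' ψ → Γ ⊢ φ
  ∧-elimʳ : ∀ {Γ φ ψ} → Γ ⊢ φ ∧' ψ → Γ ⊢ ψ
  ∃¹-intro : ∀ {Γ φ} t → Γ ⊢ inst1 φ t → Γ ⊢ ∃¹ φ
  ∃¹-elim  : ∀ {Γ φ ψ} → Γ ⊢ ∃¹ φ → φ ∷ map shift1 Γ ⊢ shift1 ψ → Γ ⊢ ψ
  ∃²-intro : ∀ {Γ φ} Y → Γ ⊢ ren2 (Y ◂id) φ → Γ ⊢ ∃² φ
  ∃²-elim  : ∀ {Γ φ ψ} → Γ ⊢ ∃² φ → φ ∷ map shift2 Γ ⊢ shift2 ψ → Γ ⊢ ψ
  ¬¬-elim  : ∀ {Γ φ} → Γ ⊢ ¬' ¬' φ → Γ ⊢ φ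
  ≐-refl   : ∀ {Γ} x → Γ ⊢ x ≐ x
  ≐-subst  : ∀ {Γ} φ {x y} → Γ ⊢ x ≐ y → Γ ⊢ inst1 φ x → Γ ⊢ inst1 φ y
  ≤-refl   : ∀ {Γ} x → Γ ⊢ x ≤' x
  ≤-trans  : ∀ {Γ x y z} → Γ ⊢ x ≤' y → Γ ⊢ y ≤' z → Γ ⊢ x ≤' z
  ≤-antisym : ∀ {Γ x y} → Γ ⊢ x ≤' y → Γ ⊢ y ≤' x → Γ ⊢ x ≐ y
  Zero-ex  : ∀ {Γ} → Γ ⊢ ∃¹ (Zero zero)
  Zero-uniq : ∀ {Γ x y} → Γ ⊢ Zero x → Γ ⊢ Zero y → Γ ⊢ x ≐ y
  S-ex     : ∀ {Γ} x → Γ ⊢ ∃¹ (S (suc x) zero)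
  S-inj    : ∀ {Γ x y z} → Γ ⊢ S y x → Γ ⊢ S z x → Γ ⊢ y ≐ z
  S-fun    : ∀ {Γ x y z} → Γ ⊢ S x y → Γ ⊢ S x z → Γ ⊢ y ≐ z
  S-Zero   : ∀ {Γ x y} → Γ ⊢ S x y → Γ ⊢ Zero y → Γ ⊢ ⊥'
  S-≤      : ∀ {Γ x y} → Γ ⊢ S x y → Γ ⊢ x ≤' y
  S-≤-pred : ∀ {Γ x y y'} → Γ ⊢ S y y' → Γ ⊢ x ≤' y' → Γ ⊢ ¬' (x ≐ y') → Γ ⊢ x ≤' y
  comp     : ∀ {Γ φ} χ → Γ ⊢ instComp φ χ → Γ ⊢ ∃² φ
  -- induction on the free individual variable x of φ;
  -- fresh z = index 0 and y = index 1 after shifting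
  ind      : ∀ {Γ} φ x
           → Zero zero ∷ map shift1 Γ ⊢ ren1 (repl (suc x) zero) (shift1 φ)
           → S 1 0 ∷ ren1 (repl (suc (suc x)) 1) (shift1 (shift1 φ))
               ∷ map (λ θ → shift1 (shift1 θ)) Γ
             ⊢ ren1 (repl (suc (suc x)) 0) (shift1 (shift1 φ))
           → Γ ⊢ φ

MSO⊢ : Fm → Set
MSO⊢ φ = [] ⊢ φ

IndAmong : ℕ → Fm → Set
IndAmong n (x ≐ y)  = x < n × y < n
IndAmong n (x ≤' y) = x < n × y < n
IndAmong n (S x y)  = x < n × y < n
IndAmong n (Zero x) = x < n
IndAmong n (x ∈' X) = x < n
IndAmong n ⊤'       = ⊤ where open import Data.Unit using (⊤)
IndAmong n ⊥'       = ⊤ where open import Data.Unit using (⊤)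
IndAmong n (φ ∧' ψ) = IndAmong n φ × IndAmong n ψ
IndAmong n (¬' φ)   = IndAmong n φ
IndAmong n (∃¹ φ)   = IndAmong (suc n) φ
IndAmong n (∃² φ)   = IndAmong n φ

PredAmong : ℕ → Fm → Set
PredAmong m (x ∈' X) = X < m
PredAmong m (φ ∧' ψ) = PredAmong m φ × PredAmong m ψ
PredAmong m (¬' φ)   = PredAmong m φ
PredAmong m (∃¹ φ)   = PredAmong m φ
PredAmong m (∃² φ)   = PredAmong (suc m) φ
PredAmong m _        = ⊤ where open import Data.Unit using (⊤)

-- ψ(X₁,…,X_q, x): x = individual index 0, X_i = predicate index i-1
FreeAmong : ℕ → Fm → Set
FreeAmong q φ = IndAmong 1 φ × PredAmong q φ

-- Relativization to θ[y] = (y ≤ x), where x is the free individual index b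
-- (b counted at the current depth):  (∃x' φ)|θ = ∃x'(x' ≤ x ∧ φ|θ)

rel : ℕ → Fm → Fm
rel b (φ ∧' ψ) = rel b φ ∧' rel b ψ
rel b (¬' φ)   = ¬' rel b φ
rel b (∃¹ φ)   = ∃¹ (zero ≤' suc b ∧' rel (suc b) φ)
rel b (∃² φ)   = ∃² (rel b φ)
rel b α        = α

UniformlyBounded : Fm → Set
UniformlyBounded φ = Σ Fm (λ χ → φ ≡ rel zero χ) × IndAmong 1 φ

-- B^x_X(ψ), q = length of X⃗.  Under ∀z ∀^{2q}:  z = individual 0,
-- Z'_i = predicate i, Z_i = predicate q+i (i < q).  Inside ∀y: y = 0, z = 1.

B : ℕ → Fm → Fm
B q ψ =
  ∀¹ (∀²^ (q + q)
       (⋀ q (λ i → ∀¹ ((zero ≤' 1) ⇒' ((zero ∈' (q + i)) ⇔' (zero ∈' i))))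
        ⇒' (ren2 (q +_) ψ ⇔' ψ)))

{-# OPTIONS --safe #-}

-- The statement contains the decidability and the completeness of MSO over the
-- natural numbers (take ψ closed), so it is proved by the composition method,
-- inside models.  Completeness with respect to structures in which falsity is an
-- arbitrary set R is constructive (Krivine), and every statement about such a
-- model is stable under double negation relative to R; the classical combinatorics
-- is carried out in the corresponding continuation monad K.
--
-- To a formula φ we attach a finite set of types of intervals.  Types of adjacent
-- intervals multiply, and a tail cut by an infinite set whose intervals all have
-- type e has type e^ω, which is computed from e: for a quantifier ∃Y, one inclusion
-- is the additive Ramsey theorem, the other one chooses Y on all intervals at once.
-- Under the hypothesis, ψ(X,x) does not change when X is emptied beyond x; the tail
-- then has a computable type, independent of x, so that the type of [0,x], which is
-- described by a bounded formula, decides ψ.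

module Submission where

open import Defs
open import Data.Bool using (true; false)
open import Data.Empty using (⊥-elim)
open import Data.Fin as Fin using (Fin; zero; suc; combine; quotient; remainder; finToFun; funToFin; toℕ; fromℕ<)
open import Data.Fin.Properties using (_≟_; any?; finToFun-funToFin; funToFin-finToFin; remQuot-combine; combine-remQuot; pigeonhole; toℕ-fromℕ<; toℕ<n)
open import Data.List using (List; []; _∷_; map; _++_)
open import Data.List.Membership.Propositional using (_∈_)
open import Data.List.Membership.Propositional.Properties using (∈-map⁺; ∈-map⁻; ∈-++⁺ˡ; ∈-++⁺ʳ)
open import Data.List.Relation.Unary.All as All using (All; []; _∷_)
open import Data.List.Relation.Unary.All.Properties as Allₚ using ()
open import Data.List.Relation.Unary.Any using (here; there)
open import Data.Nat using (ℕ; zero; suc; _+_; _*_; _^_; _≤_; _<_; _⊔_; s≤s; z≤n; _≡ᵇ_)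
open import Data.Nat.Properties as ℕₚ using ()
open import Data.Product using (Σ; _×_; _,_; proj₁; proj₂; map₂)
open import Data.Sum using (_⊎_; inj₁; inj₂)
open import Data.Unit using (⊤; tt)
open import Function using (_∘_; id; case_of_)
open import Relation.Binary.PropositionalEquality using (_≡_; _≢_; refl; sym; trans; cong; cong₂; subst; subst₂; _≗_)
open import Relation.Nullary using (Dec; yes; no; ¬?)
open import Relation.Nullary.Decidable using (_×-dec_; _⊎-dec_)

-- Renaming

-- The sets of a model need not be all subsets of its numbers, and its numbers may be nonstandard.
-- Every set used by the combinatorics must therefore come from comprehension, and every argument
-- along the numbers of a model must be an instance of `mem-ind`. Hence recursion is itself derived
-- from comprehension, homogeneous sets are defined by recursion, and the simultaneous choice of Y
-- on all intervals is a definable one. Types, by contrast, are elements of `Fin` computed outside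
-- every model, so that pigeonhole arguments and case distinctions on types are ordinary Agda.
-- Individual variables become singletons so that a word consists of set tracks only; x itself is
-- one more track.

lift-∘ : ∀ {ρ ρ' ρ''} → ρ ∘ ρ' ≗ ρ'' → lift ρ ∘ lift ρ' ≗ lift ρ''
lift-∘ h zero    = refl
lift-∘ h (suc k) = cong suc (h k)

lift-id : ∀ {ρ} → ρ ≗ id → lift ρ ≗ id
lift-id h zero    = refl
lift-id h (suc k) = cong suc (h k)

ren1-∘ : ∀ φ {ρ ρ' ρ''} → ρ ∘ ρ' ≗ ρ'' → ren1 ρ (ren1 ρ' φ) ≡ ren1 ρ'' φ
ren1-∘ (x ≐ y)  h = cong₂ _≐_ (h x) (h y)
ren1-∘ (x ≤' y) h = cong₂ _≤'_ (h x) (h y)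
ren1-∘ (S x y)  h = cong₂ S (h x) (h y)
ren1-∘ (Zero x) h = cong Zero (h x)
ren1-∘ (x ∈' X) h = cong (_∈' X) (h x)
ren1-∘ ⊤'       h = refl
ren1-∘ ⊥'       h = refl
ren1-∘ (φ ∧' ψ) h = cong₂ _∧'_ (ren1-∘ φ h) (ren1-∘ ψ h)
ren1-∘ (¬' φ)   h = cong ¬'_ (ren1-∘ φ h)
ren1-∘ (∃¹ φ)   h = cong ∃¹ (ren1-∘ φ (lift-∘ h))
ren1-∘ (∃² φ)   h = cong ∃² (ren1-∘ φ h)

ren1-id : ∀ φ {ρ} → ρ ≗ id → ren1 ρ φ ≡ φ
ren1-id (x ≐ y)  h = cong₂ _≐_ (h x) (h y)
ren1-id (x ≤' y) h = cong₂ _≤'_ (h x) (h y)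
ren1-id (S x y)  h = cong₂ S (h x) (h y)
ren1-id (Zero x) h = cong Zero (h x)
ren1-id (x ∈' X) h = cong (_∈' X) (h x)
ren1-id ⊤'       h = refl
ren1-id ⊥'       h = refl
ren1-id (φ ∧' ψ) h = cong₂ _∧'_ (ren1-id φ h) (ren1-id ψ h)
ren1-id (¬' φ)   h = cong ¬'_ (ren1-id φ h)
ren1-id (∃¹ φ)   h = cong ∃¹ (ren1-id φ (lift-id h))
ren1-id (∃² φ)   h = cong ∃² (ren1-id φ h)

ren2-∘ : ∀ φ {π π' π''} → π ∘ π' ≗ π'' → ren2 π (ren2 π' φ) ≡ ren2 π'' φ
ren2-∘ (x ≐ y)  h = refl
ren2-∘ (x ≤' y) h = refl
ren2-∘ (S x y)  h = refl
ren2-∘ (Zero x) h = refl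
ren2-∘ (x ∈' X) h = cong (x ∈'_) (h X)
ren2-∘ ⊤'       h = refl
ren2-∘ ⊥'       h = refl
ren2-∘ (φ ∧' ψ) h = cong₂ _∧'_ (ren2-∘ φ h) (ren2-∘ ψ h)
ren2-∘ (¬' φ)   h = cong ¬'_ (ren2-∘ φ h)
ren2-∘ (∃¹ φ)   h = cong ∃¹ (ren2-∘ φ h)
ren2-∘ (∃² φ)   h = cong ∃² (ren2-∘ φ (lift-∘ h))

ren2-id : ∀ φ {π} → π ≗ id → ren2 π φ ≡ φ
ren2-id (x ≐ y)  h = refl
ren2-id (x ≤' y) h = refl
ren2-id (S x y)  h = refl
ren2-id (Zero x) h = refl
ren2-id (x ∈' X) h = cong (x ∈'_) (h X)
ren2-id ⊤'       h = refl
ren2-id ⊥'       h = refl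
ren2-id (φ ∧' ψ) h = cong₂ _∧'_ (ren2-id φ h) (ren2-id ψ h)
ren2-id (¬' φ)   h = cong ¬'_ (ren2-id φ h)
ren2-id (∃¹ φ)   h = cong ∃¹ (ren2-id φ h)
ren2-id (∃² φ)   h = cong ∃² (ren2-id φ (lift-id h))

ren-comm : ∀ φ {ρ π} → ren1 ρ (ren2 π φ) ≡ ren2 π (ren1 ρ φ)
ren-comm (x ≐ y)  = refl
ren-comm (x ≤' y) = refl
ren-comm (S x y)  = refl
ren-comm (Zero x) = refl
ren-comm (x ∈' X) = refl
ren-comm ⊤'       = refl
ren-comm ⊥'       = refl
ren-comm (φ ∧' ψ) = cong₂ _∧'_ (ren-comm φ) (ren-comm ψ)
ren-comm (¬' φ)   = cong ¬'_ (ren-comm φ)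
ren-comm (∃¹ φ)   = cong ∃¹ (ren-comm φ)
ren-comm (∃² φ)   = cong ∃² (ren-comm φ)

ren : (ℕ → ℕ) → (ℕ → ℕ) → Fm → Fm
ren ρ π φ = ren1 ρ (ren2 π φ)

ren-id : ∀ φ → ren id id φ ≡ φ
ren-id φ = trans (ren1-id _ λ _ → refl) (ren2-id φ λ _ → refl)

ren-ren1 : ∀ φ {ρ ρ' ρ'' π} → ρ ∘ ρ' ≗ ρ'' → ren ρ π (ren1 ρ' φ) ≡ ren ρ'' π φ
ren-ren1 φ {ρ} h = trans (cong (ren1 ρ) (sym (ren-comm φ))) (ren1-∘ _ h)

ren-ren2 : ∀ φ {ρ π π' π''} → π ∘ π' ≗ π'' → ren ρ π (ren2 π' φ) ≡ ren ρ π'' φ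
ren-ren2 φ {ρ} h = cong (ren1 ρ) (ren2-∘ φ h)

ren1-ren : ∀ φ {ρ ρ' ρ'' π} → ρ ∘ ρ' ≗ ρ'' → ren1 ρ (ren ρ' π φ) ≡ ren ρ'' π φ
ren1-ren φ h = ren1-∘ _ h

ren2-ren : ∀ φ {ρ π π' π''} → π ∘ π' ≗ π'' → ren2 π (ren ρ π' φ) ≡ ren ρ π'' φ
ren2-ren φ {ρ} h = trans (sym (ren-comm (ren2 _ φ))) (cong (ren1 ρ) (ren2-∘ φ h))

-- Substitution of formulae for predicate variables

-- `π'` is kept apart from `π` because a substitution may consume a predicate variable: for
-- `instComp` it is `lift π`, while the result is renamed by `π`.
ren-sub2 : ∀ φ {ρ π π' σ σ'} → (∀ X → ren (lift ρ) π (σ X) ≡ σ' (π' X)) →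
           ren ρ π (sub2 σ φ) ≡ sub2 σ' (ren ρ π' φ)
ren-sub2 (x ≐ y)  h = refl
ren-sub2 (x ≤' y) h = refl
ren-sub2 (S x y)  h = refl
ren-sub2 (Zero x) h = refl
ren-sub2 (x ∈' X) {ρ} {π} {π'} {σ} {σ'} h =
  trans (ren-ren1 (σ X) λ _ → refl)
        (trans (sym (ren1-∘ (ren2 π (σ X)) λ { zero → refl ; (suc _) → refl }))
               (cong (λ χ → inst1 χ (ρ x)) (h X)))
ren-sub2 ⊤'       h = refl
ren-sub2 ⊥'       h = refl
ren-sub2 (φ ∧' ψ) h = cong₂ _∧'_ (ren-sub2 φ h) (ren-sub2 ψ h)
ren-sub2 (¬' φ)   h = cong ¬'_ (ren-sub2 φ h)
ren-sub2 (∃¹ φ) {ρ} {σ = σ} h = cong ∃¹ (ren-sub2 φ λ X →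
  trans (ren-ren1 (σ X) {ρ'' = lift (λ k → suc (ρ k))} λ { zero → refl ; (suc _) → refl })
        (trans (sym (ren1-ren (σ X) λ { zero → refl ; (suc _) → refl }))
               (cong (ren1 (lift suc)) (h X))))
ren-sub2 (∃² φ) {σ = σ} h = cong ∃² (ren-sub2 φ λ
  { zero → refl
  ; (suc X) → trans (ren-ren2 (σ X) λ _ → refl)
                (trans (sym (ren2-ren (σ X) λ _ → refl)) (cong shift2 (h X))) })

sub2-ren2 : ∀ φ {σ π π'} → (∀ X → σ (π X) ≡ zero ∈' π' X) → sub2 σ (ren2 π φ) ≡ ren2 π' φ
sub2-ren2 (x ≐ y)  h = refl
sub2-ren2 (x ≤' y) h = refl
sub2-ren2 (S x y)  h = refl
sub2-ren2 (Zero x) h = refl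
sub2-ren2 (x ∈' X) h = cong (λ χ → inst1 χ x) (h X)
sub2-ren2 ⊤'       h = refl
sub2-ren2 ⊥'       h = refl
sub2-ren2 (φ ∧' ψ) h = cong₂ _∧'_ (sub2-ren2 φ h) (sub2-ren2 ψ h)
sub2-ren2 (¬' φ)   h = cong ¬'_ (sub2-ren2 φ h)
sub2-ren2 (∃¹ φ)   h = cong ∃¹ (sub2-ren2 φ λ X → cong (ren1 (lift suc)) (h X))
sub2-ren2 (∃² φ)   h = cong ∃² (sub2-ren2 φ λ { zero → refl ; (suc X) → cong shift2 (h X) })

-- Renaming of derivations

-- Required for the rule `ind`, which replaces a named free variable: a renaming that merged another
-- variable with it would cause that one to be replaced as well.
Inj : (ℕ → ℕ) → Set
Inj ρ = ∀ {x y} → ρ x ≡ ρ y → x ≡ y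

lift-inj : ∀ {ρ} → Inj ρ → Inj (lift ρ)
lift-inj i {zero}  {zero}  e = refl
lift-inj i {suc x} {suc y} e = cong suc (i (ℕₚ.suc-injective e))

repl-≡ : ∀ x t → repl x t x ≡ t
repl-≡ x t with x ≡ᵇ x | ℕₚ.≡⇒≡ᵇ x x refl
... | true | _ = refl

repl-≢ : ∀ x t {k} → k ≢ x → repl x t k ≡ k
repl-≢ x t {k} ne with k ≡ᵇ x | ℕₚ.≡ᵇ⇒≡ k x
... | true  | e = ⊥-elim (ne (e tt))
... | false | _ = refl

repl-natural : ∀ {ρ} → Inj ρ → ∀ x t k → ρ (repl x t k) ≡ repl (ρ x) (ρ t) (ρ k)
repl-natural {ρ} i x t k with k ℕₚ.≟ x
... | yes refl = trans (cong ρ (repl-≡ x t)) (sym (repl-≡ (ρ x) (ρ t)))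
... | no ne = trans (cong ρ (repl-≢ x t ne)) (sym (repl-≢ (ρ x) (ρ t) λ e → ne (i e)))

_⟨_,_⟩⊆_ : List Fm → (ℕ → ℕ) → (ℕ → ℕ) → List Fm → Set
Γ ⟨ ρ , π ⟩⊆ Δ = ∀ {ψ} → ψ ∈ Γ → ren ρ π ψ ∈ Δ

ext⊆ : ∀ {Γ ρ π Δ φ φ'} → φ' ≡ ren ρ π φ → Γ ⟨ ρ , π ⟩⊆ Δ → (φ ∷ Γ) ⟨ ρ , π ⟩⊆ (φ' ∷ Δ)
ext⊆ e s (here refl) = here (sym e)
ext⊆ e s (there p)   = there (s p)

map⊆ : ∀ {f f' : Fm → Fm} {Γ ρ π ρ' π' Δ} → (∀ ψ → ren ρ' π' (f ψ) ≡ f' (ren ρ π ψ)) →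
       Γ ⟨ ρ , π ⟩⊆ Δ → map f Γ ⟨ ρ' , π' ⟩⊆ map f' Δ
map⊆ {f' = f'} {Δ = Δ} e s p with ∈-map⁻ _ p
... | ψ , q , refl = subst (_∈ map f' Δ) (sym (e ψ)) (∈-map⁺ f' (s q))

ren-shift1 : ∀ ρ π ψ → ren (lift ρ) π (shift1 ψ) ≡ shift1 (ren ρ π ψ)
ren-shift1 ρ π ψ = trans (ren-ren1 ψ λ _ → refl) (sym (ren1-ren ψ λ _ → refl))

ren-shift2 : ∀ ρ π ψ → ren ρ (lift π) (shift2 ψ) ≡ shift2 (ren ρ π ψ)
ren-shift2 ρ π ψ = trans (ren-ren2 ψ λ _ → refl) (sym (ren2-ren ψ λ _ → refl))

ren-inst1 : ∀ ρ π φ t → ren ρ π (inst1 φ t) ≡ inst1 (ren (lift ρ) π φ) (ρ t)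
ren-inst1 ρ π φ t = trans (ren-ren1 φ {ρ'' = λ k → ρ ((t ◂id) k)} λ _ → refl)
  (sym (ren1-ren φ λ { zero → refl ; (suc _) → refl }))

ren-inst2 : ∀ ρ π φ Y → ren ρ π (ren2 (Y ◂id) φ) ≡ ren2 (π Y ◂id) (ren ρ (lift π) φ)
ren-inst2 ρ π φ Y = trans (ren-ren2 φ {π'' = λ k → π ((Y ◂id) k)} λ _ → refl)
  (sym (ren2-ren φ λ { zero → refl ; (suc _) → refl }))

ren-instComp : ∀ ρ π φ χ → ren ρ π (instComp φ χ) ≡ instComp (ren ρ (lift π) φ) (ren (lift ρ) π χ)
ren-instComp ρ π φ χ = ren-sub2 φ λ { zero → refl ; (suc _) → refl }

cast⊢ : ∀ {Γ φ ψ} → φ ≡ ψ → Γ ⊢ φ → Γ ⊢ ψ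
cast⊢ refl d = d

ren⊢ : ∀ {Γ Δ φ ρ π} → Inj ρ → Γ ⟨ ρ , π ⟩⊆ Δ → Γ ⊢ φ → Δ ⊢ ren ρ π φ
ren⊢ i s (ax p)        = ax (s p)
ren⊢ i s (cut d d')    = cut (ren⊢ i s d) (ren⊢ i (ext⊆ refl s) d')
ren⊢ i s ⊤-intro       = ⊤-intro
ren⊢ i s (¬-intro d)   = ¬-intro (ren⊢ i (ext⊆ refl s) d)
ren⊢ i s (¬-elim d d') = ¬-elim (ren⊢ i s d) (ren⊢ i s d')
ren⊢ i s (∧-intro d d') = ∧-intro (ren⊢ i s d) (ren⊢ i s d')
ren⊢ i s (∧-elimˡ d)   = ∧-elimˡ (ren⊢ i s d)
ren⊢ i s (∧-elimʳ d)   = ∧-elimʳ (ren⊢ i s d)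
ren⊢ {ρ = ρ} {π} i s (∃¹-intro {φ = φ} t d) =
  ∃¹-intro (ρ t) (cast⊢ (ren-inst1 ρ π φ t) (ren⊢ i s d))
ren⊢ {ρ = ρ} {π} i s (∃¹-elim {ψ = ψ} d d') =
  ∃¹-elim (ren⊢ i s d)
    (cast⊢ (ren-shift1 ρ π ψ) (ren⊢ (lift-inj i) (ext⊆ refl (map⊆ (ren-shift1 ρ π) s)) d'))
ren⊢ {ρ = ρ} {π} i s (∃²-intro {φ = φ} Y d) =
  ∃²-intro (π Y) (cast⊢ (ren-inst2 ρ π φ Y) (ren⊢ i s d))
ren⊢ {ρ = ρ} {π} i s (∃²-elim {ψ = ψ} d d') =
  ∃²-elim (ren⊢ i s d)
    (cast⊢ (ren-shift2 ρ π ψ) (ren⊢ i (ext⊆ refl (map⊆ (ren-shift2 ρ π) s)) d'))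
ren⊢ i s (¬¬-elim d)   = ¬¬-elim (ren⊢ i s d)
ren⊢ {ρ = ρ} i s (≐-refl x) = ≐-refl (ρ x)
ren⊢ {ρ = ρ} {π} i s (≐-subst φ {x} {y} d d') =
  cast⊢ (sym (ren-inst1 ρ π φ y))
    (≐-subst (ren (lift ρ) π φ) (ren⊢ i s d) (cast⊢ (ren-inst1 ρ π φ x) (ren⊢ i s d')))
ren⊢ {ρ = ρ} i s (≤-refl x)     = ≤-refl (ρ x)
ren⊢ i s (≤-trans d d')         = ≤-trans (ren⊢ i s d) (ren⊢ i s d')
ren⊢ i s (≤-antisym d d')       = ≤-antisym (ren⊢ i s d) (ren⊢ i s d')
ren⊢ i s Zero-ex                = Zero-ex
ren⊢ i s (Zero-uniq d d')       = Zero-uniq (ren⊢ i s d) (ren⊢ i s d')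
ren⊢ {ρ = ρ} i s (S-ex x)       = S-ex (ρ x)
ren⊢ i s (S-inj d d')           = S-inj (ren⊢ i s d) (ren⊢ i s d')
ren⊢ i s (S-fun d d')           = S-fun (ren⊢ i s d) (ren⊢ i s d')
ren⊢ i s (S-Zero d d')          = S-Zero (ren⊢ i s d) (ren⊢ i s d')
ren⊢ i s (S-≤ d)                = S-≤ (ren⊢ i s d)
ren⊢ i s (S-≤-pred d d' d'')    = S-≤-pred (ren⊢ i s d) (ren⊢ i s d') (ren⊢ i s d'')
ren⊢ {ρ = ρ} {π} i s (comp {φ = φ} χ d) =
  comp (ren (lift ρ) π χ) (cast⊢ (ren-instComp ρ π φ χ) (ren⊢ i s d))
ren⊢ {ρ = ρ} {π} i s (ind φ x d d') = ind (ren ρ π φ) (ρ x)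
  (cast⊢ (one zero)
    (ren⊢ (lift-inj i) (ext⊆ refl (map⊆ (ren-shift1 ρ π) s)) d))
  (cast⊢ (two 0)
    (ren⊢ (lift-inj (lift-inj i)) (ext⊆ refl (ext⊆ (sym (two 1)) (map⊆ shift-shift s))) d'))
  where
  shift-shift : ∀ ψ → ren (lift (lift ρ)) π (shift1 (shift1 ψ)) ≡ shift1 (shift1 (ren ρ π ψ))
  shift-shift ψ = trans (ren-shift1 (lift ρ) π (shift1 ψ)) (cong shift1 (ren-shift1 ρ π ψ))
  replaced : ∀ {ρ'} → Inj ρ' → ∀ y t φ → ren ρ' π (ren1 (repl y t) φ) ≡ ren1 (repl (ρ' y) (ρ' t)) (ren ρ' π φ)
  replaced i' y t φ = trans (ren-ren1 φ {ρ'' = λ k → _} λ _ → refl)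
    (sym (ren1-ren φ λ k → sym (repl-natural i' y t k)))
  one : ∀ t → ren (lift ρ) π (ren1 (repl (suc x) t) (shift1 φ))
            ≡ ren1 (repl (suc (ρ x)) (lift ρ t)) (shift1 (ren ρ π φ))
  one t = trans (replaced (lift-inj i) (suc x) t (shift1 φ))
                (cong (ren1 (repl (suc (ρ x)) (lift ρ t))) (ren-shift1 ρ π φ))
  two : ∀ t → ren (lift (lift ρ)) π (ren1 (repl (suc (suc x)) t) (shift1 (shift1 φ)))
            ≡ ren1 (repl (suc (suc (ρ x))) (lift (lift ρ) t)) (shift1 (shift1 (ren ρ π φ)))
  two t = trans (replaced (lift-inj (lift-inj i)) (suc (suc x)) t (shift1 (shift1 φ)))
                (cong (ren1 (repl (suc (suc (ρ x))) (lift (lift ρ) t))) (shift-shift φ))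

weaken : ∀ {Γ Δ φ} → (∀ {ψ} → ψ ∈ Γ → ψ ∈ Δ) → Γ ⊢ φ → Δ ⊢ φ
weaken {Δ = Δ} {φ} s d = cast⊢ (ren-id φ)
  (ren⊢ id (λ {ψ} p → subst (_∈ Δ) (sym (ren-id ψ)) (s p)) d)

-- Free variables

lift-< : ∀ {ρ n m} → (∀ {k} → k < n → ρ k < m) → ∀ {k} → k < suc n → lift ρ k < suc m
lift-< h {zero}  _       = s≤s z≤n
lift-< h {suc k} (s≤s p) = s≤s (h p)

lift-agree : ∀ {ρ ρ' n} → (∀ {k} → k < n → ρ k ≡ ρ' k) → ∀ {k} → k < suc n → lift ρ k ≡ lift ρ' k
lift-agree h {zero}  _       = refl
lift-agree h {suc k} (s≤s p) = cong suc (h p)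

IndAmong-ren1 : ∀ φ {ρ n m} → (∀ {k} → k < n → ρ k < m) → IndAmong n φ → IndAmong m (ren1 ρ φ)
IndAmong-ren1 (x ≐ y)  h (p , q) = h p , h q
IndAmong-ren1 (x ≤' y) h (p , q) = h p , h q
IndAmong-ren1 (S x y)  h (p , q) = h p , h q
IndAmong-ren1 (Zero x) h p = h p
IndAmong-ren1 (x ∈' X) h p = h p
IndAmong-ren1 ⊤'       h p = tt
IndAmong-ren1 ⊥'       h p = tt
IndAmong-ren1 (φ ∧' ψ) h (p , q) = IndAmong-ren1 φ h p , IndAmong-ren1 ψ h q
IndAmong-ren1 (¬' φ)   h p = IndAmong-ren1 φ h p
IndAmong-ren1 (∃¹ φ)   h p = IndAmong-ren1 φ (lift-< h) p
IndAmong-ren1 (∃² φ)   h p = IndAmong-ren1 φ h p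

PredAmong-ren2 : ∀ φ {π n m} → (∀ {k} → k < n → π k < m) → PredAmong n φ → PredAmong m (ren2 π φ)
PredAmong-ren2 (x ≐ y)  h p = tt
PredAmong-ren2 (x ≤' y) h p = tt
PredAmong-ren2 (S x y)  h p = tt
PredAmong-ren2 (Zero x) h p = tt
PredAmong-ren2 (x ∈' X) h p = h p
PredAmong-ren2 ⊤'       h p = tt
PredAmong-ren2 ⊥'       h p = tt
PredAmong-ren2 (φ ∧' ψ) h (p , q) = PredAmong-ren2 φ h p , PredAmong-ren2 ψ h q
PredAmong-ren2 (¬' φ)   h p = PredAmong-ren2 φ h p
PredAmong-ren2 (∃¹ φ)   h p = PredAmong-ren2 φ h p
PredAmong-ren2 (∃² φ)   h p = PredAmong-ren2 φ (lift-< h) p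

IndAmong-ren2 : ∀ φ {π n} → IndAmong n φ → IndAmong n (ren2 π φ)
IndAmong-ren2 (x ≐ y)  p = p
IndAmong-ren2 (x ≤' y) p = p
IndAmong-ren2 (S x y)  p = p
IndAmong-ren2 (Zero x) p = p
IndAmong-ren2 (x ∈' X) p = p
IndAmong-ren2 ⊤'       p = tt
IndAmong-ren2 ⊥'       p = tt
IndAmong-ren2 (φ ∧' ψ) (p , q) = IndAmong-ren2 φ p , IndAmong-ren2 ψ q
IndAmong-ren2 (¬' φ)   p = IndAmong-ren2 φ p
IndAmong-ren2 (∃¹ φ)   p = IndAmong-ren2 φ p
IndAmong-ren2 (∃² φ)   p = IndAmong-ren2 φ p

PredAmong-ren1 : ∀ φ {ρ n} → PredAmong n φ → PredAmong n (ren1 ρ φ)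
PredAmong-ren1 (x ≐ y)  p = tt
PredAmong-ren1 (x ≤' y) p = tt
PredAmong-ren1 (S x y)  p = tt
PredAmong-ren1 (Zero x) p = tt
PredAmong-ren1 (x ∈' X) p = p
PredAmong-ren1 ⊤'       p = tt
PredAmong-ren1 ⊥'       p = tt
PredAmong-ren1 (φ ∧' ψ) (p , q) = PredAmong-ren1 φ p , PredAmong-ren1 ψ q
PredAmong-ren1 (¬' φ)   p = PredAmong-ren1 φ p
PredAmong-ren1 (∃¹ φ)   p = PredAmong-ren1 φ p
PredAmong-ren1 (∃² φ)   p = PredAmong-ren1 φ p

ren1-agree : ∀ φ {ρ ρ' n} → (∀ {k} → k < n → ρ k ≡ ρ' k) → IndAmong n φ → ren1 ρ φ ≡ ren1 ρ' φ
ren1-agree (x ≐ y)  h (p , q) = cong₂ _≐_ (h p) (h q)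
ren1-agree (x ≤' y) h (p , q) = cong₂ _≤'_ (h p) (h q)
ren1-agree (S x y)  h (p , q) = cong₂ S (h p) (h q)
ren1-agree (Zero x) h p = cong Zero (h p)
ren1-agree (x ∈' X) h p = cong (_∈' X) (h p)
ren1-agree ⊤'       h p = refl
ren1-agree ⊥'       h p = refl
ren1-agree (φ ∧' ψ) h (p , q) = cong₂ _∧'_ (ren1-agree φ h p) (ren1-agree ψ h q)
ren1-agree (¬' φ)   h p = cong ¬'_ (ren1-agree φ h p)
ren1-agree (∃¹ φ)   h p = cong ∃¹ (ren1-agree φ (lift-agree h) p)
ren1-agree (∃² φ)   h p = cong ∃² (ren1-agree φ h p)

ren2-agree : ∀ φ {π π' n} → (∀ {k} → k < n → π k ≡ π' k) → PredAmong n φ → ren2 π φ ≡ ren2 π' φ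
ren2-agree (x ≐ y)  h p = refl
ren2-agree (x ≤' y) h p = refl
ren2-agree (S x y)  h p = refl
ren2-agree (Zero x) h p = refl
ren2-agree (x ∈' X) h p = cong (x ∈'_) (h p)
ren2-agree ⊤'       h p = refl
ren2-agree ⊥'       h p = refl
ren2-agree (φ ∧' ψ) h (p , q) = cong₂ _∧'_ (ren2-agree φ h p) (ren2-agree ψ h q)
ren2-agree (¬' φ)   h p = cong ¬'_ (ren2-agree φ h p)
ren2-agree (∃¹ φ)   h p = cong ∃¹ (ren2-agree φ h p)
ren2-agree (∃² φ)   h p = cong ∃² (ren2-agree φ (lift-agree h) p)

Among : ℕ → Fm → Set
Among n φ = IndAmong n φ × PredAmong n φ

Among-mono : ∀ φ {n m} → n ≤ m → Among n φ → Among m φ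
Among-mono φ n≤m (p , q) =
  subst (IndAmong _) (ren1-id φ λ _ → refl) (IndAmong-ren1 φ (λ k<n → ℕₚ.≤-trans k<n n≤m) p) ,
  subst (PredAmong _) (ren2-id φ λ _ → refl) (PredAmong-ren2 φ (λ k<n → ℕₚ.≤-trans k<n n≤m) q)

bound : ∀ φ → Σ ℕ λ n → Among n φ
bound (x ≐ y)  = suc (x ⊔ y) , (s≤s (ℕₚ.m≤m⊔n x y) , s≤s (ℕₚ.m≤n⊔m x y)) , tt
bound (x ≤' y) = suc (x ⊔ y) , (s≤s (ℕₚ.m≤m⊔n x y) , s≤s (ℕₚ.m≤n⊔m x y)) , tt
bound (S x y)  = suc (x ⊔ y) , (s≤s (ℕₚ.m≤m⊔n x y) , s≤s (ℕₚ.m≤n⊔m x y)) , tt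
bound (Zero x) = suc x , ℕₚ.≤-refl , tt
bound (x ∈' X) = suc (x ⊔ X) , s≤s (ℕₚ.m≤m⊔n x X) , s≤s (ℕₚ.m≤n⊔m x X)
bound ⊤'       = zero , tt , tt
bound ⊥'       = zero , tt , tt
bound (φ ∧' ψ) with bound φ | bound ψ
... | n , p | m , q with Among-mono φ (ℕₚ.m≤m⊔n n m) p | Among-mono ψ (ℕₚ.m≤n⊔m n m) q
... | p₁ , p₂ | q₁ , q₂ = n ⊔ m , (p₁ , q₁) , (p₂ , q₂)
bound (¬' φ)   = bound φ
bound (∃¹ φ) with bound φ
... | n , p = n , proj₁ (Among-mono φ (ℕₚ.n≤1+n n) p) , proj₂ p
bound (∃² φ) with bound φ
... | n , p = n , proj₁ p , proj₂ (Among-mono φ (ℕₚ.n≤1+n n) p)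

-- An enumeration of the formulae

-- Cantor's walk along the antidiagonals. The code of a pair is later read off the proof of
-- surjectivity.
step : ℕ × ℕ → ℕ × ℕ
step (zero  , y) = suc y , zero
step (suc x , y) = x , suc y

unpair : ℕ → ℕ × ℕ
unpair zero    = zero , zero
unpair (suc n) = step (unpair n)

unpair-surj : ∀ s x y → x + y ≡ s → Σ ℕ λ n → unpair n ≡ (x , y)
unpair-surj zero    zero zero e = zero , refl
unpair-surj (suc s) x zero e with unpair-surj s zero s refl
... | n , p = suc n , trans (cong step p) (cong (_, zero) (trans (sym e) (ℕₚ.+-identityʳ x)))
unpair-surj s x (suc y) e with unpair-surj s (suc x) y (trans (sym (ℕₚ.+-suc x y)) e)
... | n , p = suc n , cong step p

pair : ℕ → ℕ → ℕ
pair x y = proj₁ (unpair-surj _ x y refl)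

unpair-pair : ∀ x y → unpair (pair x y) ≡ (x , y)
unpair-pair x y = proj₂ (unpair-surj _ x y refl)

-- The first argument is fuel.
decode : ℕ → ℕ → Fm
decodeTagged : ℕ → ℕ → ℕ × ℕ → Fm

decode zero    n = ⊤'
decode (suc k) n = decodeTagged k (proj₁ (unpair n)) (unpair (proj₂ (unpair n)))

decodeTagged k 0 (x , y) = x ≐ y
decodeTagged k 1 (x , y) = x ≤' y
decodeTagged k 2 (x , y) = S x y
decodeTagged k 3 (x , y) = Zero x
decodeTagged k 4 (x , y) = x ∈' y
decodeTagged k 5 (x , y) = ⊤'
decodeTagged k 6 (x , y) = ⊥'
decodeTagged k 7 (x , y) = decode k x ∧' decode k y
decodeTagged k 8 (x , y) = ¬' decode k x
decodeTagged k 9 (x , y) = ∃¹ (decode k x)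
decodeTagged k _ (x , y) = ∃² (decode k x)

decode-pair : ∀ k t x y → decode (suc k) (pair t (pair x y)) ≡ decodeTagged k t (x , y)
decode-pair k t x y rewrite unpair-pair t (pair x y) | unpair-pair x y = refl

-- The code has to work for all sufficiently large fuel, because the two halves of a conjunction are
-- decoded with the same amount.
decode-surj : ∀ φ → Σ ℕ λ d → Σ ℕ λ c → ∀ k → d ≤ k → decode k c ≡ φ
decode-surj (x ≐ y)  = 1 , pair 0 (pair x y) , λ { (suc k) _ → decode-pair k 0 x y }
decode-surj (x ≤' y) = 1 , pair 1 (pair x y) , λ { (suc k) _ → decode-pair k 1 x y }
decode-surj (S x y)  = 1 , pair 2 (pair x y) , λ { (suc k) _ → decode-pair k 2 x y }
decode-surj (Zero x) = 1 , pair 3 (pair x 0) , λ { (suc k) _ → decode-pair k 3 x 0 }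
decode-surj (x ∈' X) = 1 , pair 4 (pair x X) , λ { (suc k) _ → decode-pair k 4 x X }
decode-surj ⊤'       = 1 , pair 5 (pair 0 0) , λ { (suc k) _ → decode-pair k 5 0 0 }
decode-surj ⊥'       = 1 , pair 6 (pair 0 0) , λ { (suc k) _ → decode-pair k 6 0 0 }
decode-surj (φ ∧' ψ) with decode-surj φ | decode-surj ψ
... | d , c , p | d' , c' , p' = suc (d ⊔ d') , pair 7 (pair c c') , λ { (suc k) (s≤s l) →
  trans (decode-pair k 7 c c') (cong₂ _∧'_ (p k (ℕₚ.m⊔n≤o⇒m≤o d d' l)) (p' k (ℕₚ.m⊔n≤o⇒n≤o d d' l))) }
decode-surj (¬' φ) with decode-surj φ
... | d , c , p = suc d , pair 8 (pair c 0) , λ { (suc k) (s≤s l) → trans (decode-pair k 8 c 0) (cong ¬'_ (p k l)) }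
decode-surj (∃¹ φ) with decode-surj φ
... | d , c , p = suc d , pair 9 (pair c 0) , λ { (suc k) (s≤s l) → trans (decode-pair k 9 c 0) (cong ∃¹ (p k l)) }
decode-surj (∃² φ) with decode-surj φ
... | d , c , p = suc d , pair 10 (pair c 0) , λ { (suc k) (s≤s l) → trans (decode-pair k 10 c 0) (cong ∃² (p k l)) }

enum : ℕ → Fm
enum n = decode (proj₁ (unpair n)) (proj₂ (unpair n))

enum-surj : ∀ φ → Σ ℕ λ n → enum n ≡ φ
enum-surj φ with decode-surj φ
... | d , c , p = pair d c , trans (cong (λ u → decode (proj₁ u) (proj₂ u)) (unpair-pair d c)) (p d ℕₚ.≤-refl)

-- Models

infixr 5 _∷ᵉ_
_∷ᵉ_ : {A : Set} → A → (ℕ → A) → ℕ → A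
(a ∷ᵉ ρ) zero    = a
(a ∷ᵉ ρ) (suc k) = ρ k

-- The set R interprets falsity and need not be empty.
record Structure : Set₁ where
  field
    D¹ D² R  : Set
    eq le su : D¹ → D¹ → Set
    ze       : D¹ → Set
    mem      : D¹ → D² → Set

module Semantics (M : Structure) where
  open Structure M

  K : Set → Set
  K P = (P → R) → R

  ⟦_⟧ : Fm → (ℕ → D¹) → (ℕ → D²) → Set
  ⟦ x ≐ y ⟧  ρ σ = eq (ρ x) (ρ y)
  ⟦ x ≤' y ⟧ ρ σ = le (ρ x) (ρ y)
  ⟦ S x y ⟧  ρ σ = su (ρ x) (ρ y)
  ⟦ Zero x ⟧ ρ σ = ze (ρ x)
  ⟦ x ∈' X ⟧ ρ σ = mem (ρ x) (σ X)
  ⟦ ⊤' ⟧     ρ σ = ⊤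
  ⟦ ⊥' ⟧     ρ σ = R
  ⟦ φ ∧' ψ ⟧ ρ σ = ⟦ φ ⟧ ρ σ × ⟦ ψ ⟧ ρ σ
  ⟦ ¬' φ ⟧   ρ σ = ⟦ φ ⟧ ρ σ → R
  ⟦ ∃¹ φ ⟧   ρ σ = K (Σ D¹ λ a → ⟦ φ ⟧ (a ∷ᵉ ρ) σ)
  ⟦ ∃² φ ⟧   ρ σ = K (Σ D² λ A → ⟦ φ ⟧ ρ (A ∷ᵉ σ))

-- A Henkin model: existence is asserted only under `K`, and `D²` need only be closed under
-- comprehension. Stability of the atoms spreads to all formulae (`⟦⟧-stable`), which is what allows
-- `K` to be left when a formula is being proved.
record Model : Set₁ where
  field
    structure : Structure
  open Structure structure public
  open Semantics structure public
  field
    default¹   : D¹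
    default²   : D²
    eq-stable  : ∀ {x y} → K (eq x y) → eq x y
    le-stable  : ∀ {x y} → K (le x y) → le x y
    su-stable  : ∀ {x y} → K (su x y) → su x y
    ze-stable  : ∀ {x} → K (ze x) → ze x
    mem-stable : ∀ {x X} → K (mem x X) → mem x X
    eq-refl    : ∀ {x} → eq x x
    eq-subst   : ∀ φ ρ σ {x y} → eq x y → ⟦ φ ⟧ (x ∷ᵉ ρ) σ → ⟦ φ ⟧ (y ∷ᵉ ρ) σ
    le-refl    : ∀ {x} → le x x
    le-trans   : ∀ {x y z} → le x y → le y z → le x z
    le-antisym : ∀ {x y} → le x y → le y x → eq x y
    ze-ex      : K (Σ D¹ ze)
    ze-uniq    : ∀ {x y} → ze x → ze y → eq x y
    su-ex      : ∀ x → K (Σ D¹ (su x))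
    su-inj     : ∀ {x y z} → su y x → su z x → eq y z
    su-fun     : ∀ {x y z} → su x y → su x z → eq y z
    su-ze      : ∀ {x y} → su x y → ze y → R
    su-le      : ∀ {x y} → su x y → le x y
    su-le-pred : ∀ {x y y'} → su y y' → le x y' → (eq x y' → R) → le x y
    mem-comp   : ∀ χ ρ σ → K (Σ D² λ X → ∀ y → (mem y X → ⟦ χ ⟧ (y ∷ᵉ ρ) σ) × (⟦ χ ⟧ (y ∷ᵉ ρ) σ → mem y X))
    mem-ind    : ∀ X → (∀ {z} → ze z → mem z X) → (∀ {y z} → su y z → mem y X → mem z X) → ∀ x → mem x X

-- Completeness

raa : ∀ {Γ φ} → ¬' φ ∷ Γ ⊢ ⊥' → Γ ⊢ φ
raa d = ¬¬-elim (¬-intro d)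

hyp0 : ∀ {Γ φ} → φ ∷ Γ ⊢ φ
hyp0 = ax (here refl)

hyp1 : ∀ {Γ φ ψ} → ψ ∷ φ ∷ Γ ⊢ φ
hyp1 = ax (there (here refl))

wk : ∀ {Γ φ ψ} → Γ ⊢ φ → ψ ∷ Γ ⊢ φ
wk = weaken there

⇒-elim : ∀ {Γ φ ψ} → Γ ⊢ φ ⇒' ψ → Γ ⊢ φ → Γ ⊢ ψ
⇒-elim d d' = raa (¬-elim (∧-intro (wk d') hyp0) (wk d))

⇒-intro : ∀ {Γ φ ψ} → φ ∷ Γ ⊢ ψ → Γ ⊢ φ ⇒' ψ
⇒-intro d = ¬-intro (cut (∧-elimˡ hyp0) (¬-elim (weaken (λ { (here p) → here p ; (there p) → there (there p) }) d) (∧-elimʳ hyp1)))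

∀¹-intro : ∀ {Γ φ} → map shift1 Γ ⊢ φ → Γ ⊢ ∀¹ φ
∀¹-intro d = ¬-intro (∃¹-elim hyp0 (¬-elim (weaken (λ p → there (there p)) d) hyp0))

∀¹-elim : ∀ {Γ φ} t → Γ ⊢ ∀¹ φ → Γ ⊢ inst1 φ t
∀¹-elim t d = raa (¬-elim (∃¹-intro t hyp0) (wk d))

-- Free variables serve as Henkin constants. This renaming turns the fresh index c into the
-- eigenvariable 0 and acts as a shift on the indices below c.
front : ℕ → ℕ → ℕ
front c k with k ℕₚ.≟ c
... | yes _ = 0
... | no  _ = suc k

front-≡ : ∀ c → front c c ≡ 0
front-≡ c with c ℕₚ.≟ c
... | yes _ = refl
... | no ne = ⊥-elim (ne refl)

front-< : ∀ {c k} → k < c → front c k ≡ suc k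
front-< {c} {k} k<c with k ℕₚ.≟ c
... | yes refl = ⊥-elim (ℕₚ.<-irrefl refl k<c)
... | no _ = refl

front-inj : ∀ c → Inj (front c)
front-inj c {x} {y} e with x ℕₚ.≟ c | y ℕₚ.≟ c
... | yes refl | yes refl = refl
... | no _ | no _ = ℕₚ.suc-injective e

witness : Fm → ℕ → Fm
witness (∃¹ φ) c = ∃¹ φ ⇒' inst1 φ c
witness (∃² φ) c = ∃² φ ⇒' ren2 (c ◂id) φ
witness _      c = ⊤'

Among-witness : ∀ φ c → Among c φ → Among (suc c) (witness φ c)
Among-witness (∃¹ φ) c a@(p , q) with Among-mono (∃¹ φ) (ℕₚ.n≤1+n c) a
... | p' , q' = (p' , IndAmong-ren1 φ (λ { {zero} _ → ℕₚ.≤-refl ; {suc k} (s≤s l) → ℕₚ.m≤n⇒m≤1+n l }) p)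
              , (q' , PredAmong-ren1 φ q')
Among-witness (∃² φ) c a@(p , q) with Among-mono (∃² φ) (ℕₚ.n≤1+n c) a
... | p' , q' = (p' , IndAmong-ren2 φ p')
              , (q' , PredAmong-ren2 φ (λ { {zero} _ → ℕₚ.≤-refl ; {suc k} (s≤s l) → ℕₚ.m≤n⇒m≤1+n l }) q)
Among-witness (x ≐ y)  c a = tt , tt
Among-witness (x ≤' y) c a = tt , tt
Among-witness (S x y)  c a = tt , tt
Among-witness (Zero x) c a = tt , tt
Among-witness (x ∈' X) c a = tt , tt
Among-witness ⊤'       c a = tt , tt
Among-witness ⊥'       c a = tt , tt
Among-witness (φ ∧' ψ) c a = tt , tt
Among-witness (¬' φ)   c a = tt , tt

fresh⊆ : ∀ {Γ c} (f : Fm → Fm) ρ π → (∀ φ → Among c φ → ren ρ π φ ≡ f φ) →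
         All (Among c) Γ → Γ ⟨ ρ , π ⟩⊆ map f Γ
fresh⊆ f ρ π e as {ψ} p = subst (_∈ _) (sym (e ψ (All.lookup as p))) (∈-map⁺ f p)

fresh1 : ∀ {c} φ → Among c φ → ren (front c) id φ ≡ shift1 φ
fresh1 φ (p , q) = trans (cong (ren1 (front _)) (ren2-id φ λ _ → refl)) (ren1-agree φ front-< p)

fresh2 : ∀ {c} φ → Among c φ → ren id (front c) φ ≡ shift2 φ
fresh2 φ (p , q) = trans (ren1-id _ λ _ → refl) (ren2-agree φ front-< q)

◂-front : ∀ c {k} → k < suc c → front c ((c ◂id) k) ≡ k
◂-front c {zero}  _       = front-≡ c
◂-front c {suc k} (s≤s l) = front-< l

-- If the Henkin axiom is inconsistent with Γ, then Γ proves the existential formula together with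
-- the negation of its instance at c. As c is fresh, renaming by `front c` turns this instance into
-- φ at the eigenvariable of the elimination rule, a contradiction.
conservative : ∀ {Γ c} φ → Among c φ → All (Among c) Γ → witness φ c ∷ Γ ⊢ ⊥' → Γ ⊢ ⊥'
conservative {Γ} {c} (∃¹ φ) (p , q) as d = ∃¹-elim (∧-elimˡ both)
    (¬-elim hyp0 (wk (cast⊢ (cong ¬'_ back) (ren⊢ (front-inj c) (fresh⊆ shift1 (front c) id fresh1 as) (∧-elimʳ both)))))
  where
  both : Γ ⊢ ∃¹ φ ∧' ¬' inst1 φ c
  both = raa d
  back : ren (front c) id (inst1 φ c) ≡ φ
  back = trans (cong (ren1 (front c)) (ren2-id (inst1 φ c) λ _ → refl))
    (trans (ren1-∘ φ λ _ → refl) (trans (ren1-agree φ (◂-front c) p) (ren1-id φ λ _ → refl)))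
conservative {Γ} {c} (∃² φ) (p , q) as d = ∃²-elim (∧-elimˡ both)
    (¬-elim hyp0 (wk (cast⊢ (cong ¬'_ back) (ren⊢ id (fresh⊆ shift2 id (front c) fresh2 as) (∧-elimʳ both)))))
  where
  both : Γ ⊢ ∃² φ ∧' ¬' ren2 (c ◂id) φ
  both = raa d
  back : ren id (front c) (ren2 (c ◂id) φ) ≡ φ
  back = trans (ren1-id _ λ _ → refl)
    (trans (ren2-∘ φ λ _ → refl) (trans (ren2-agree φ (◂-front c) q) (ren2-id φ λ _ → refl)))
conservative (x ≐ y)  a as d = cut ⊤-intro d
conservative (x ≤' y) a as d = cut ⊤-intro d
conservative (S x y)  a as d = cut ⊤-intro d
conservative (Zero x) a as d = cut ⊤-intro d
conservative (x ∈' X) a as d = cut ⊤-intro d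
conservative ⊤'       a as d = cut ⊤-intro d
conservative ⊥'       a as d = cut ⊤-intro d
conservative (φ ∧' ψ) a as d = cut ⊤-intro d
conservative (¬' φ)   a as d = cut ⊤-intro d

-- The Henkin theory and its term model

Derives : (Fm → Set) → Fm → Set
Derives G φ = Σ (List Fm) λ Δ → All G Δ × Δ ⊢ φ

module Henkin (φ₀ : Fm) where

  bd : ℕ → ℕ
  const : ℕ → ℕ
  const n = bd n ⊔ proj₁ (bound (enum n))
  bd zero    = proj₁ (bound φ₀)
  bd (suc n) = suc (const n)

  henkin : ℕ → List Fm
  henkin zero    = ¬' φ₀ ∷ []
  henkin (suc n) = witness (enum n) (const n) ∷ henkin n

  Among-enum : ∀ n → Among (const n) (enum n)
  Among-enum n = Among-mono (enum n) (ℕₚ.m≤n⊔m (bd n) _) (proj₂ (bound (enum n)))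

  Among-henkin : ∀ n → All (Among (bd n)) (henkin n)
  Among-henkin zero    = proj₂ (bound φ₀) ∷ []
  Among-henkin (suc n) = Among-witness (enum n) (const n) (Among-enum n)
    ∷ All.map (λ {ψ} → Among-mono ψ (ℕₚ.m≤n⇒m≤1+n (ℕₚ.m≤m⊔n (bd n) _))) (Among-henkin n)

  henkin-conservative : ∀ n → henkin n ⊢ ⊥' → ¬' φ₀ ∷ [] ⊢ ⊥'
  henkin-conservative zero    d = d
  henkin-conservative (suc n) d = henkin-conservative n
    (conservative (enum n) (Among-enum n)
      (All.map (λ {ψ} → Among-mono ψ (ℕₚ.m≤m⊔n (bd n) _)) (Among-henkin n)) d)

  henkin-mono : ∀ {n m ψ} → n ≤ m → ψ ∈ henkin n → ψ ∈ henkin m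
  henkin-mono {n} {m} n≤m p with ℕₚ.m≤n⇒m<n∨m≡n n≤m
  ... | inj₂ refl = p
  henkin-mono {n} {suc m} n≤m p | inj₁ (s≤s l) = there (henkin-mono l p)

  -- A formula is added when this creates no new inconsistency; phrased as an
  -- implication, the condition needs no decision (Krivine).
  G : ℕ → Fm → Set
  G zero    ψ = Σ ℕ λ n → ψ ∈ henkin n
  G (suc n) ψ = G n ψ ⊎ (ψ ≡ enum n × (Derives (λ χ → G n χ ⊎ χ ≡ enum n) ⊥' → Derives (G n) ⊥'))

  G-mono : ∀ {n m ψ} → n ≤ m → G n ψ → G m ψ
  G-mono {n} {m} n≤m p with ℕₚ.m≤n⇒m<n∨m≡n n≤m
  ... | inj₂ refl = p
  G-mono {n} {suc m} n≤m p | inj₁ (s≤s l) = inj₁ (G-mono l p)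

  Gω : Fm → Set
  Gω ψ = Σ ℕ λ n → G n ψ

  T : Fm → Set
  T = Derives Gω

  split : ∀ {A B : Fm → Set} Δ → All (λ χ → A χ ⊎ B χ) Δ → All A Δ ⊎ Σ Fm B
  split []      []             = inj₁ []
  split (χ ∷ Δ) (inj₂ b ∷ as) = inj₂ (χ , b)
  split (χ ∷ Δ) (inj₁ a ∷ as) with split Δ as
  ... | inj₁ as' = inj₁ (a ∷ as')
  ... | inj₂ b   = inj₂ b

  G-conservative : ∀ n → Derives (G n) ⊥' → Derives (G 0) ⊥'
  G-conservative zero    d = d
  G-conservative (suc n) (Δ , as , d) with split Δ as
  ... | inj₁ as' = G-conservative n (Δ , as' , d)
  ... | inj₂ (χ , e , h) = G-conservative n
    (h (Δ , All.map (λ { (inj₁ g) → inj₁ g ; (inj₂ (e , _)) → inj₂ e }) as , d))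

  common : ∀ {Δ} {H : ℕ → Fm → Set} → (∀ {n m ψ} → n ≤ m → H n ψ → H m ψ) →
           All (λ ψ → Σ ℕ λ n → H n ψ) Δ → Σ ℕ λ n → All (H n) Δ
  common mono [] = 0 , []
  common mono ((n , h) ∷ hs) with common mono hs
  ... | m , hs' = n ⊔ m , mono (ℕₚ.m≤m⊔n n m) h ∷ All.map (mono (ℕₚ.m≤n⊔m n m)) hs'

  T⊥⇒G0 : T ⊥' → Derives (G 0) ⊥'
  T⊥⇒G0 (Δ , as , d) with common G-mono as
  ... | n , as' = G-conservative n (Δ , as' , d)

  T⊥⇒φ₀ : T ⊥' → [] ⊢ φ₀
  T⊥⇒φ₀ t with T⊥⇒G0 t
  ... | Δ , as , d with common {H = λ n ψ → ψ ∈ henkin n} henkin-mono as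
  ... | n , as' = raa (henkin-conservative n (weaken (All.lookup as') d))

  T-[] : ∀ {φ} → [] ⊢ φ → T φ
  T-[] d = [] , [] , d

  T-map : ∀ {φ ψ} → φ ∷ [] ⊢ ψ → T φ → T ψ
  T-map d (Δ , as , d') = Δ , as , cut d' (weaken (λ { (here p) → here p }) d)

  T-∧ : ∀ {φ ψ} → T φ → T ψ → T (φ ∧' ψ)
  T-∧ (Δ , as , d) (Δ' , as' , d') = Δ ++ Δ' , Allₚ.++⁺ as as' ,
    ∧-intro (weaken ∈-++⁺ˡ d) (weaken (∈-++⁺ʳ Δ) d')

  T-map₂ : ∀ {φ ψ χ} → φ ∷ ψ ∷ [] ⊢ χ → T φ → T ψ → T χ
  T-map₂ d t t' = T-map (cut (∧-elimʳ hyp0) (cut (∧-elimˡ hyp1) (weaken (λ { (here p) → here p ; (there (here p)) → there (here p) }) d))) (T-∧ t t')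

  -- Maximality: `¬' φ` meets its own admission condition at the stage that enumerates it. A
  -- contradiction derived with its help yields φ by `raa`, then `T ⊥'` by hypothesis, and `T⊥⇒G0`
  -- brings this down to stage 0.
  T-¬ : ∀ {φ} → (T φ → T ⊥') → T (¬' φ)
  T-¬ {φ} h with enum-surj (¬' φ)
  ... | n , e = ¬' φ ∷ [] , (suc n , inj₂ (sym e , new)) ∷ [] , hyp0
    where
    discharge : ∀ Δ → All (λ χ → G n χ ⊎ χ ≡ enum n) Δ →
                Σ (List Fm) λ Δ' → All (G n) Δ' × (∀ {χ} → χ ∈ Δ → χ ∈ ¬' φ ∷ Δ')
    discharge [] [] = [] , [] , λ ()
    discharge (χ ∷ Δ) (a ∷ as) with discharge Δ as
    discharge (χ ∷ Δ) (inj₁ g ∷ as) | Δ' , as' , s = χ ∷ Δ' , g ∷ as' ,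
      λ { (here p) → there (here p) ; (there p) → case s p of λ { (here q) → here q ; (there q) → there (there q) } }
    discharge (χ ∷ Δ) (inj₂ e' ∷ as) | Δ' , as' , s = Δ' , as' ,
      λ { (here refl) → here (trans e' e) ; (there p) → s p }
    new : Derives (λ χ → G n χ ⊎ χ ≡ enum n) ⊥' → Derives (G n) ⊥'
    new (Δ , as , d) with discharge Δ as
    ... | Δ' , as' , s with T⊥⇒G0 (h (Δ' , All.map (n ,_) as' , raa (weaken s d)))
    ... | Δ'' , gs , d'' = Δ'' , All.map (G-mono z≤n) gs , d''

  T-stable : ∀ {φ} → ((T φ → T ⊥') → T ⊥') → T φ
  T-stable h = T-map (¬¬-elim hyp0) (T-¬ λ t → h λ t' → T-map₂ (¬-elim hyp0 hyp1) t' t)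

  T-¬⁻ : ∀ {φ} → T (¬' φ) → T φ → T ⊥'
  T-¬⁻ t t' = T-map₂ (¬-elim hyp1 hyp0) t t'

  T-henkin : ∀ n → T (witness (enum n) (const n))
  T-henkin n = _ ∷ [] , (0 , suc n , here refl) ∷ [] , hyp0

  abstract
    T-∃¹ : ∀ {φ} → T (∃¹ φ) → Σ ℕ λ t → T (inst1 φ t)
    T-∃¹ {φ} t with enum-surj (∃¹ φ)
    ... | n , e = const n , T-map₂ (⇒-elim hyp0 hyp1) (subst (λ χ → T (witness χ (const n))) e (T-henkin n)) t

    T-∃² : ∀ {φ} → T (∃² φ) → Σ ℕ λ Y → T (ren2 (Y ◂id) φ)
    T-∃² {φ} t with enum-surj (∃² φ)
    ... | n , e = const n , T-map₂ (⇒-elim hyp0 hyp1) (subst (λ χ → T (witness χ (const n))) e (T-henkin n)) t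

  term : Structure
  term = record
    { D¹ = ℕ ; D² = ℕ ; R = T ⊥'
    ; eq = λ x y → T (x ≐ y) ; le = λ x y → T (x ≤' y) ; su = λ x y → T (S x y)
    ; ze = λ x → T (Zero x) ; mem = λ x X → T (x ∈' X) }

  open Semantics term

  inst-ren1 : ∀ φ ρ σ t → inst1 (ren (lift ρ) σ φ) t ≡ ren (t ∷ᵉ ρ) σ φ
  inst-ren1 φ ρ σ t = ren1-ren φ λ { zero → refl ; (suc _) → refl }

  inst-ren2 : ∀ φ ρ σ Y → ren2 (Y ◂id) (ren ρ (lift σ) φ) ≡ ren ρ (Y ∷ᵉ σ) φ
  inst-ren2 φ ρ σ Y = ren2-ren φ λ { zero → refl ; (suc _) → refl }

  -- The truth lemma. The elements of the term model are variables, so that environments are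
  -- renamings. The two directions call each other at `¬'`.
  ⟦⟧⇒T : ∀ φ {ρ σ} → ⟦ φ ⟧ ρ σ → T (ren ρ σ φ)
  T⇒⟦⟧ : ∀ φ {ρ σ} → T (ren ρ σ φ) → ⟦ φ ⟧ ρ σ

  ⟦⟧⇒T (x ≐ y)  h = h
  ⟦⟧⇒T (x ≤' y) h = h
  ⟦⟧⇒T (S x y)  h = h
  ⟦⟧⇒T (Zero x) h = h
  ⟦⟧⇒T (x ∈' X) h = h
  ⟦⟧⇒T ⊤'       h = T-[] ⊤-intro
  ⟦⟧⇒T ⊥'       h = h
  ⟦⟧⇒T (φ ∧' ψ) (h , h') = T-∧ (⟦⟧⇒T φ h) (⟦⟧⇒T ψ h')
  ⟦⟧⇒T (¬' φ)   h = T-¬ λ t → h (T⇒⟦⟧ φ t)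
  ⟦⟧⇒T (∃¹ φ) {ρ} {σ} h = T-stable λ k → h λ { (t , p) →
    k (T-map (∃¹-intro t hyp0) (subst T (sym (inst-ren1 φ ρ σ t)) (⟦⟧⇒T φ p))) }
  ⟦⟧⇒T (∃² φ) {ρ} {σ} h = T-stable λ k → h λ { (Y , p) →
    k (T-map (∃²-intro Y hyp0) (subst T (sym (inst-ren2 φ ρ σ Y)) (⟦⟧⇒T φ p))) }

  T⇒⟦⟧ (x ≐ y)  t = t
  T⇒⟦⟧ (x ≤' y) t = t
  T⇒⟦⟧ (S x y)  t = t
  T⇒⟦⟧ (Zero x) t = t
  T⇒⟦⟧ (x ∈' X) t = t
  T⇒⟦⟧ ⊤'       t = tt
  T⇒⟦⟧ ⊥'       t = t
  T⇒⟦⟧ (φ ∧' ψ) t = T⇒⟦⟧ φ (T-map (∧-elimˡ hyp0) t) , T⇒⟦⟧ ψ (T-map (∧-elimʳ hyp0) t)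
  T⇒⟦⟧ (¬' φ)   t = λ h → T-¬⁻ t (⟦⟧⇒T φ h)
  T⇒⟦⟧ (∃¹ φ) {ρ} {σ} t with T-∃¹ t
  ... | a , p = λ k → k (a , T⇒⟦⟧ φ (subst T (inst-ren1 φ ρ σ a) p))
  T⇒⟦⟧ (∃² φ) {ρ} {σ} t with T-∃² t
  ... | Y , p = λ k → k (Y , T⇒⟦⟧ φ (subst T (inst-ren2 φ ρ σ Y) p))

  -- The rule `comp` with χ itself reduces `body` to a trivial equivalence, and the Henkin witness
  -- of the resulting `∃²` is the set.
  T-comp : ∀ χ ρ σ → Σ ℕ λ X → ∀ y → (T (y ∈' X) → ⟦ χ ⟧ (y ∷ᵉ ρ) σ) × (⟦ χ ⟧ (y ∷ᵉ ρ) σ → T (y ∈' X))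
  T-comp χ ρ σ = map₂ unpack (T-∃² (T-[] (comp {φ = body} χ' (∀¹-intro
      (∧-intro (⇒-intro (cast⊢ (same λ _ → refl) hyp0)) (⇒-intro (cast⊢ (sym (same λ _ → refl)) hyp0)))))))
    where
    χ' body : Fm
    χ' = ren (lift ρ) σ χ
    body = ∀¹ ((0 ∈' 0) ⇔' shift2 χ')
    same : ∀ {τ} → (∀ X → τ (suc X) ≡ 0 ∈' X) → inst1 (ren1 (lift suc) χ') 0 ≡ sub2 τ (shift2 χ')
    same e = trans (trans (ren1-∘ χ' λ { zero → refl ; (suc _) → refl }) (ren1-id χ' λ _ → refl))
                 (sym (trans (sub2-ren2 χ' e) (ren2-id χ' λ _ → refl)))
    χ-eq : ∀ X y → inst1 (ren2 (X ◂id) (shift2 χ')) y ≡ ren (y ∷ᵉ ρ) σ χ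
    χ-eq X y = trans (cong (λ θ → inst1 θ y) (trans (ren2-∘ χ' λ _ → refl) (ren2-id _ λ _ → refl)))
                     (inst-ren1 χ ρ σ y)
    unpack : ∀ {X} → T (ren2 (X ◂id) body) → ∀ y → (T (y ∈' X) → ⟦ χ ⟧ (y ∷ᵉ ρ) σ) × (⟦ χ ⟧ (y ∷ᵉ ρ) σ → T (y ∈' X))
    unpack {X} t y =
      (λ m → T⇒⟦⟧ χ (subst T (χ-eq X y) (T-map₂ (⇒-elim (∧-elimˡ hyp0) hyp1) t' m))) ,
      (λ h → T-map₂ (⇒-elim (∧-elimʳ hyp0) hyp1) t' (subst T (sym (χ-eq X y)) (⟦⟧⇒T χ h)))
      where
      t' : T (((y ∈' X) ⇔' inst1 (ren2 (X ◂id) (shift2 χ')) y))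
      t' = T-map (∀¹-elim y hyp0) t

  -- The premises speak about each element of the model. Henkin counterexamples turn them into the
  -- universally quantified formulae `baseF` and `stepF` of T, from which `ind` derives the
  -- conclusion.
  T-ind : ∀ X → (∀ {z} → T (Zero z) → T (z ∈' X)) → (∀ {y z} → T (S y z) → T (y ∈' X) → T (z ∈' X)) →
          ∀ x → T (x ∈' X)
  T-ind X b s x = T-map₂ derivation base stepped
    where
    baseF stepF : Fm
    baseF = ∀¹ (Zero 0 ⇒' (0 ∈' X))
    stepF = ∀¹ (∀¹ (S 1 0 ⇒' ((1 ∈' X) ⇒' (0 ∈' X))))
    base : T baseF
    base = T-¬ λ t → case T-∃¹ t of λ { (a , p) →
      T-¬⁻ p (T-¬ λ t' → T-¬⁻ (T-map (∧-elimʳ hyp0) t') (b (T-map (∧-elimˡ hyp0) t'))) }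
    stepped : T stepF
    stepped = T-¬ λ t → case T-∃¹ t of λ { (a , p) → T-¬⁻ p (T-¬ λ t' → case T-∃¹ t' of λ { (c , p') →
      T-¬⁻ p' (T-¬ λ t'' → T-¬⁻ (T-map (∧-elimʳ hyp0) t'') (T-¬ λ u →
        T-¬⁻ (T-map (∧-elimʳ hyp0) u) (s (T-map (∧-elimˡ hyp0) t'') (T-map (∧-elimˡ hyp0) u)))) }) }
    derivation : baseF ∷ stepF ∷ [] ⊢ x ∈' X
    derivation = ind (x ∈' X) x
      (cast⊢ (cong (_∈' X) (sym (repl-≡ (suc x) 0))) (⇒-elim (∀¹-elim 0 hyp1) hyp0))
      (cast⊢ (cong (_∈' X) (sym (repl-≡ (suc (suc x)) 0)))
        (⇒-elim (⇒-elim (∀¹-elim 0 (∀¹-elim 1 (ax (there (there (there (here refl))))))) hyp0)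
                (cast⊢ (cong (_∈' X) (repl-≡ (suc (suc x)) 1)) hyp1)))

  T-eq-subst : ∀ φ ρ σ {x y} → T (x ≐ y) → ⟦ φ ⟧ (x ∷ᵉ ρ) σ → ⟦ φ ⟧ (y ∷ᵉ ρ) σ
  T-eq-subst φ ρ σ {x} {y} e h = T⇒⟦⟧ φ (subst T (inst-ren1 φ ρ σ y)
    (T-map₂ (≐-subst (ren (lift ρ) σ φ) hyp0 hyp1) e (subst T (sym (inst-ren1 φ ρ σ x)) (⟦⟧⇒T φ h))))

  termModel : Model
  termModel = record
    { structure = term ; default¹ = 0 ; default² = 0
    ; eq-stable = T-stable ; le-stable = T-stable ; su-stable = T-stable ; ze-stable = T-stable ; mem-stable = T-stable
    ; eq-refl = T-[] (≐-refl _)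
    ; eq-subst = T-eq-subst
    ; le-refl = T-[] (≤-refl _)
    ; le-trans = T-map₂ (≤-trans hyp0 hyp1)
    ; le-antisym = T-map₂ (≤-antisym hyp0 hyp1)
    ; ze-ex = λ k → k (T-∃¹ (T-[] Zero-ex))
    ; ze-uniq = T-map₂ (Zero-uniq hyp0 hyp1)
    ; su-ex = λ x k → k (T-∃¹ (T-[] (S-ex x)))
    ; su-inj = T-map₂ (S-inj hyp0 hyp1)
    ; su-fun = T-map₂ (S-fun hyp0 hyp1)
    ; su-ze = T-map₂ (S-Zero hyp0 hyp1)
    ; su-le = T-map (S-≤ hyp0)
    ; su-le-pred = λ a b n → T-map₂ (S-≤-pred (∧-elimˡ hyp0) (∧-elimʳ hyp0) hyp1) (T-∧ a b) (T-¬ n)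
    ; mem-comp = λ χ ρ σ k → k (T-comp χ ρ σ)
    ; mem-ind = T-ind }

-- The theory starts from `¬' ψ`, and falsity is read as `T ⊥'`. Truth of ψ in the term model then
-- gives `T ⊥'`, from which `T⊥⇒φ₀` extracts a derivation of ψ: the inconsistent case is the useful
-- one.
completeness : ∀ φ ψ → (∀ (M : Model) ρ σ → Model.⟦_⟧ M φ ρ σ → Model.⟦_⟧ M ψ ρ σ) → [] ⊢ φ → [] ⊢ ψ
completeness φ ψ h d = T⊥⇒φ₀ (T-map₂ (¬-elim hyp0 hyp1) T-ψ (¬' ψ ∷ [] , (0 , 0 , here refl) ∷ [] , hyp0))
  where
  open Henkin ψ
  T-ψ : T ψ
  T-ψ = subst T (ren-id ψ) (⟦⟧⇒T ψ (h termModel id id (T⇒⟦⟧ φ (subst T (sym (ren-id φ)) (T-[] d)))))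

-- Reasoning inside a model

∷ᵉ-agree : ∀ {A : Set} {a : A} {ρ ρ' n} → (∀ {k} → k < n → ρ k ≡ ρ' k) → ∀ {k} → k < suc n → (a ∷ᵉ ρ) k ≡ (a ∷ᵉ ρ') k
∷ᵉ-agree h {zero}  _       = refl
∷ᵉ-agree h {suc k} (s≤s p) = h p

∷ᵉ-lift : ∀ {A : Set} {a : A} {ρ ρ' r} → ρ ∘ r ≗ ρ' → (a ∷ᵉ ρ) ∘ lift r ≗ (a ∷ᵉ ρ')
∷ᵉ-lift h zero    = refl
∷ᵉ-lift h (suc k) = h k

infix 2 _⇔_
_⇔_ : Set → Set → Set
A ⇔ B = (A → B) × (B → A)

⇔-sym : ∀ {A B} → A ⇔ B → B ⇔ A
⇔-sym (f , g) = g , f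

⇔-trans : ∀ {A B C} → A ⇔ B → B ⇔ C → A ⇔ C
⇔-trans (f , g) (f' , g') = f' ∘ f , g ∘ g'

⋁' : ∀ n → (Fin n → Fm) → Fm
⋁' zero    f = ⊥'
⋁' (suc n) f = ¬' (¬' f zero ∧' ¬' ⋁' n (λ i → f (suc i)))

module InModel (M : Model) where
  open Model M public

  pure : ∀ {A} → A → K A
  pure a k = k a

  infixl 1 _>>=_
  _>>=_ : ∀ {A B} → K A → (A → K B) → K B
  (m >>= f) k = m λ a → f a k

  Stable : Set → Set
  Stable P = K P → P

  em : ∀ P → K (P ⊎ (P → R))
  em P k = k (inj₂ λ p → k (inj₁ p))

  absurd : ∀ {P} → R → K P
  absurd r _ = r

  K-stable : ∀ {P} → Stable (K P)
  K-stable m k = m λ m' → m' k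

  R-stable : Stable R
  R-stable m = m id

  →-stable : ∀ {P Q : Set} → Stable Q → Stable (P → Q)
  →-stable s m p = s (m >>= λ f → pure (f p))

  ∀-stable : ∀ {A : Set} {Q : A → Set} → (∀ a → Stable (Q a)) → Stable (∀ a → Q a)
  ∀-stable s m a = s a (m >>= λ f → pure (f a))

  ×-stable : ∀ {P Q} → Stable P → Stable Q → Stable (P × Q)
  ×-stable s s' m = s (m >>= λ p → pure (proj₁ p)) , s' (m >>= λ p → pure (proj₂ p))

  -- `K` commutes with finite products, but in general not with infinite ones; choices along `D¹`
  -- have to go through comprehension.
  fin-choice : ∀ n {P : Fin n → Set} → (∀ i → K (P i)) → K (∀ i → P i)
  fin-choice zero    h = pure λ ()
  fin-choice (suc n) h = do
    p ← h zero
    ps ← fin-choice n (h ∘ suc)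
    pure λ { zero → p ; (suc i) → ps i }

  ⟦⟧-stable : ∀ φ {ρ σ} → Stable (⟦ φ ⟧ ρ σ)
  ⟦⟧-stable (x ≐ y)  = eq-stable
  ⟦⟧-stable (x ≤' y) = le-stable
  ⟦⟧-stable (S x y)  = su-stable
  ⟦⟧-stable (Zero x) = ze-stable
  ⟦⟧-stable (x ∈' X) = mem-stable
  ⟦⟧-stable ⊤'       = λ _ → tt
  ⟦⟧-stable ⊥'       = R-stable
  ⟦⟧-stable (φ ∧' ψ) = ×-stable (⟦⟧-stable φ) (⟦⟧-stable ψ)
  ⟦⟧-stable (¬' φ)   = →-stable R-stable
  ⟦⟧-stable (∃¹ φ)   = K-stable
  ⟦⟧-stable (∃² φ)   = K-stable

  ⟦⟧-agree : ∀ φ {n m ρ ρ' σ σ'} → IndAmong n φ → PredAmong m φ →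
             (∀ {k} → k < n → ρ k ≡ ρ' k) → (∀ {k} → k < m → σ k ≡ σ' k) → ⟦ φ ⟧ ρ σ → ⟦ φ ⟧ ρ' σ'
  ⟦⟧-agree (x ≐ y)  (p , p') q e e' = subst₂ eq (e p) (e p')
  ⟦⟧-agree (x ≤' y) (p , p') q e e' = subst₂ le (e p) (e p')
  ⟦⟧-agree (S x y)  (p , p') q e e' = subst₂ su (e p) (e p')
  ⟦⟧-agree (Zero x) p q e e' = subst ze (e p)
  ⟦⟧-agree (x ∈' X) p q e e' = subst₂ mem (e p) (e' q)
  ⟦⟧-agree ⊤'       p q e e' = id
  ⟦⟧-agree ⊥'       p q e e' = id
  ⟦⟧-agree (φ ∧' ψ) (p , p') (q , q') e e' (h , h') = ⟦⟧-agree φ p q e e' h , ⟦⟧-agree ψ p' q' e e' h'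
  ⟦⟧-agree (¬' φ)   p q e e' h h' = h (⟦⟧-agree φ p q (λ l → sym (e l)) (λ l → sym (e' l)) h')
  ⟦⟧-agree (∃¹ φ)   p q e e' h = h >>= λ { (a , h') → pure (a , ⟦⟧-agree φ p q (∷ᵉ-agree e) e' h') }
  ⟦⟧-agree (∃² φ)   p q e e' h = h >>= λ { (a , h') → pure (a , ⟦⟧-agree φ p q e (∷ᵉ-agree e') h') }

  ⟦⟧-ren1 : ∀ φ {r ρ ρ' σ} → ρ ∘ r ≗ ρ' → ⟦ ren1 r φ ⟧ ρ σ ⇔ ⟦ φ ⟧ ρ' σ
  ⟦⟧-ren1 (x ≐ y)  e = subst₂ eq (e x) (e y) , subst₂ eq (sym (e x)) (sym (e y))
  ⟦⟧-ren1 (x ≤' y) e = subst₂ le (e x) (e y) , subst₂ le (sym (e x)) (sym (e y))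
  ⟦⟧-ren1 (S x y)  e = subst₂ su (e x) (e y) , subst₂ su (sym (e x)) (sym (e y))
  ⟦⟧-ren1 (Zero x) e = subst ze (e x) , subst ze (sym (e x))
  ⟦⟧-ren1 (x ∈' X) {σ = σ} e = subst (λ a → mem a (σ X)) (e x) , subst (λ a → mem a (σ X)) (sym (e x))
  ⟦⟧-ren1 ⊤'       e = id , id
  ⟦⟧-ren1 ⊥'       e = id , id
  ⟦⟧-ren1 (φ ∧' ψ) e with ⟦⟧-ren1 φ e | ⟦⟧-ren1 ψ e
  ... | f , g | f' , g' = (λ { (p , q) → f p , f' q }) , (λ { (p , q) → g p , g' q })
  ⟦⟧-ren1 (¬' φ)   e = (λ h → h ∘ proj₂ (⟦⟧-ren1 φ e)) , (λ h → h ∘ proj₁ (⟦⟧-ren1 φ e))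
  ⟦⟧-ren1 (∃¹ φ)   e = (λ h → h >>= λ { (a , p) → pure (a , proj₁ (⟦⟧-ren1 φ (∷ᵉ-lift e)) p) })
                     , (λ h → h >>= λ { (a , p) → pure (a , proj₂ (⟦⟧-ren1 φ (∷ᵉ-lift e)) p) })
  ⟦⟧-ren1 (∃² φ)   e = (λ h → h >>= λ { (a , p) → pure (a , proj₁ (⟦⟧-ren1 φ e) p) })
                     , (λ h → h >>= λ { (a , p) → pure (a , proj₂ (⟦⟧-ren1 φ e) p) })

  ⟦⟧-ren2 : ∀ φ {π ρ σ σ'} → σ ∘ π ≗ σ' → ⟦ ren2 π φ ⟧ ρ σ ⇔ ⟦ φ ⟧ ρ σ'
  ⟦⟧-ren2 (x ≐ y)  e = id , id
  ⟦⟧-ren2 (x ≤' y) e = id , id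
  ⟦⟧-ren2 (S x y)  e = id , id
  ⟦⟧-ren2 (Zero x) e = id , id
  ⟦⟧-ren2 (x ∈' X) {ρ = ρ} e = subst (mem (ρ x)) (e X) , subst (mem (ρ x)) (sym (e X))
  ⟦⟧-ren2 ⊤'       e = id , id
  ⟦⟧-ren2 ⊥'       e = id , id
  ⟦⟧-ren2 (φ ∧' ψ) e with ⟦⟧-ren2 φ e | ⟦⟧-ren2 ψ e
  ... | f , g | f' , g' = (λ { (p , q) → f p , f' q }) , (λ { (p , q) → g p , g' q })
  ⟦⟧-ren2 (¬' φ)   e = (λ h → h ∘ proj₂ (⟦⟧-ren2 φ e)) , (λ h → h ∘ proj₁ (⟦⟧-ren2 φ e))
  ⟦⟧-ren2 (∃¹ φ)   e = (λ h → h >>= λ { (a , p) → pure (a , proj₁ (⟦⟧-ren2 φ e) p) })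
                     , (λ h → h >>= λ { (a , p) → pure (a , proj₂ (⟦⟧-ren2 φ e) p) })
  ⟦⟧-ren2 (∃² φ)   e = (λ h → h >>= λ { (a , p) → pure (a , proj₁ (⟦⟧-ren2 φ (∷ᵉ-lift e)) p) })
                     , (λ h → h >>= λ { (a , p) → pure (a , proj₂ (⟦⟧-ren2 φ (∷ᵉ-lift e)) p) })

  -- Formulae with the full set of connectives, read directly as types.

  infixr 6 _∧⁺_
  infixr 5 _∨⁺_
  infixr 4 _⇒⁺_
  data Fm⁺ : Set₁ where
    at   : Fm → Fm⁺
    leaf : (F : Fm) (P : (ℕ → D¹) → (ℕ → D²) → Set) → (∀ ρ σ → ⟦ F ⟧ ρ σ ⇔ P ρ σ) → Fm⁺
    ¬⁺_  : Fm⁺ → Fm⁺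
    _∧⁺_ _∨⁺_ _⇒⁺_ : Fm⁺ → Fm⁺ → Fm⁺
    ∃¹⁺ ∃²⁺ ∀¹⁺ ∀²⁺ : Fm⁺ → Fm⁺
    ⋁⁺   : ∀ n → (Fin n → Fm⁺) → Fm⁺

  ⟦_⟧⁺ : Fm⁺ → (ℕ → D¹) → (ℕ → D²) → Set
  ⟦ at F ⟧⁺       ρ σ = ⟦ F ⟧ ρ σ
  ⟦ leaf F P e ⟧⁺ ρ σ = P ρ σ
  ⟦ ¬⁺ φ ⟧⁺       ρ σ = ⟦ φ ⟧⁺ ρ σ → R
  ⟦ φ ∧⁺ ψ ⟧⁺     ρ σ = ⟦ φ ⟧⁺ ρ σ × ⟦ ψ ⟧⁺ ρ σ
  ⟦ φ ∨⁺ ψ ⟧⁺     ρ σ = K (⟦ φ ⟧⁺ ρ σ ⊎ ⟦ ψ ⟧⁺ ρ σ)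
  ⟦ φ ⇒⁺ ψ ⟧⁺     ρ σ = ⟦ φ ⟧⁺ ρ σ → ⟦ ψ ⟧⁺ ρ σ
  ⟦ ∃¹⁺ φ ⟧⁺      ρ σ = K (Σ D¹ λ a → ⟦ φ ⟧⁺ (a ∷ᵉ ρ) σ)
  ⟦ ∃²⁺ φ ⟧⁺      ρ σ = K (Σ D² λ A → ⟦ φ ⟧⁺ ρ (A ∷ᵉ σ))
  ⟦ ∀¹⁺ φ ⟧⁺      ρ σ = ∀ a → ⟦ φ ⟧⁺ (a ∷ᵉ ρ) σ
  ⟦ ∀²⁺ φ ⟧⁺      ρ σ = ∀ A → ⟦ φ ⟧⁺ ρ (A ∷ᵉ σ)
  ⟦ ⋁⁺ n f ⟧⁺     ρ σ = K (Σ (Fin n) λ i → ⟦ f i ⟧⁺ ρ σ)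

  ⌜_⌝ : Fm⁺ → Fm
  ⌜ at F ⌝       = F
  ⌜ leaf F P e ⌝ = F
  ⌜ ¬⁺ φ ⌝       = ¬' ⌜ φ ⌝
  ⌜ φ ∧⁺ ψ ⌝     = ⌜ φ ⌝ ∧' ⌜ ψ ⌝
  ⌜ φ ∨⁺ ψ ⌝     = ¬' (¬' ⌜ φ ⌝ ∧' ¬' ⌜ ψ ⌝)
  ⌜ φ ⇒⁺ ψ ⌝     = ⌜ φ ⌝ ⇒' ⌜ ψ ⌝
  ⌜ ∃¹⁺ φ ⌝      = ∃¹ ⌜ φ ⌝
  ⌜ ∃²⁺ φ ⌝      = ∃² ⌜ φ ⌝
  ⌜ ∀¹⁺ φ ⌝      = ∀¹ ⌜ φ ⌝
  ⌜ ∀²⁺ φ ⌝      = ∀² ⌜ φ ⌝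
  ⌜ ⋁⁺ n f ⌝     = ⋁' n λ i → ⌜ f i ⌝

  ⋁⇔ : ∀ n (f : Fin n → Fm) {P : Fin n → Set} {ρ σ} → (∀ i → ⟦ f i ⟧ ρ σ ⇔ P i) → ⟦ ⋁' n f ⟧ ρ σ ⇔ K (Σ (Fin n) P)
  ⋁⇔ zero    f e = (λ r _ → r) , (λ m → m λ { (() , _) })
  ⋁⇔ (suc n) f e =
      (λ h k → h ((λ p → k (zero , proj₁ (e zero) p)) ,
                  (λ q → proj₁ (⋁⇔ n (f ∘ suc) (e ∘ suc)) q λ { (i , p) → k (suc i , p) })))
    , (λ { m (n₀ , n₁) → m λ { (zero , p) → n₀ (proj₂ (e zero) p)
                             ; (suc i , p) → n₁ (proj₂ (⋁⇔ n (f ∘ suc) (e ∘ suc)) (pure (i , p))) } })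

  -- Mutual with stability: `⇒⁺` and the universal quantifiers are read directly, and coming back
  -- from their doubly negated translations takes stability of the subformula, which it inherits
  -- from its own translation.
  ⟦⟧⁺⇔ : ∀ φ {ρ σ} → ⟦ ⌜ φ ⌝ ⟧ ρ σ ⇔ ⟦ φ ⟧⁺ ρ σ
  ⟦⟧⁺-stable : ∀ φ {ρ σ} → Stable (⟦ φ ⟧⁺ ρ σ)
  ⟦⟧⁺-stable φ m = proj₁ (⟦⟧⁺⇔ φ) (⟦⟧-stable ⌜ φ ⌝ (m >>= λ p → pure (proj₂ (⟦⟧⁺⇔ φ) p)))

  ⟦⟧⁺⇔ (at F)       = id , id
  ⟦⟧⁺⇔ (leaf F P e) = e _ _
  ⟦⟧⁺⇔ (¬⁺ φ)       = (λ h → h ∘ proj₂ (⟦⟧⁺⇔ φ)) , (λ h → h ∘ proj₁ (⟦⟧⁺⇔ φ))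
  ⟦⟧⁺⇔ (φ ∧⁺ ψ)     = (λ { (p , q) → proj₁ (⟦⟧⁺⇔ φ) p , proj₁ (⟦⟧⁺⇔ ψ) q })
                    , (λ { (p , q) → proj₂ (⟦⟧⁺⇔ φ) p , proj₂ (⟦⟧⁺⇔ ψ) q })
  ⟦⟧⁺⇔ (φ ∨⁺ ψ)     =
      (λ h k → h ((λ p → k (inj₁ (proj₁ (⟦⟧⁺⇔ φ) p))) , (λ q → k (inj₂ (proj₁ (⟦⟧⁺⇔ ψ) q)))))
    , (λ { h (n , n') → h λ { (inj₁ p) → n (proj₂ (⟦⟧⁺⇔ φ) p) ; (inj₂ q) → n' (proj₂ (⟦⟧⁺⇔ ψ) q) } })
  ⟦⟧⁺⇔ (φ ⇒⁺ ψ)     =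
      (λ h p → ⟦⟧⁺-stable ψ λ k → h (proj₂ (⟦⟧⁺⇔ φ) p , λ q → k (proj₁ (⟦⟧⁺⇔ ψ) q)))
    , (λ { h (p , n) → n (proj₂ (⟦⟧⁺⇔ ψ) (h (proj₁ (⟦⟧⁺⇔ φ) p))) })
  ⟦⟧⁺⇔ (∃¹⁺ φ)      = (λ h → h >>= λ { (a , p) → pure (a , proj₁ (⟦⟧⁺⇔ φ) p) })
                    , (λ h → h >>= λ { (a , p) → pure (a , proj₂ (⟦⟧⁺⇔ φ) p) })
  ⟦⟧⁺⇔ (∃²⁺ φ)      = (λ h → h >>= λ { (a , p) → pure (a , proj₁ (⟦⟧⁺⇔ φ) p) })
                    , (λ h → h >>= λ { (a , p) → pure (a , proj₂ (⟦⟧⁺⇔ φ) p) })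
  ⟦⟧⁺⇔ (∀¹⁺ φ)      = (λ h a → ⟦⟧⁺-stable φ λ k → h (pure (a , λ p → k (proj₁ (⟦⟧⁺⇔ φ) p))))
                    , (λ h m → m λ { (a , n) → n (proj₂ (⟦⟧⁺⇔ φ) (h a)) })
  ⟦⟧⁺⇔ (∀²⁺ φ)      = (λ h a → ⟦⟧⁺-stable φ λ k → h (pure (a , λ p → k (proj₁ (⟦⟧⁺⇔ φ) p))))
                    , (λ h m → m λ { (a , n) → n (proj₂ (⟦⟧⁺⇔ φ) (h a)) })
  ⟦⟧⁺⇔ (⋁⁺ n f)     = ⋁⇔ n _ λ i → ⟦⟧⁺⇔ (f i)

  comprehend : ∀ χ ρ σ → K (Σ D² λ X → ∀ y → mem y X ⇔ ⟦ χ ⟧⁺ (y ∷ᵉ ρ) σ)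
  comprehend χ ρ σ = do
    (X , h) ← mem-comp ⌜ χ ⌝ ρ σ
    pure (X , λ y → ⇔-trans (h y) (⟦⟧⁺⇔ χ))

  -- `mem-ind` speaks of sets only. Comprehension supplies the set defined by χ, and stability of
  -- the conclusion absorbs the `K` that this costs.
  induction : ∀ χ ρ σ → (∀ {z} → ze z → ⟦ χ ⟧⁺ (z ∷ᵉ ρ) σ) →
              (∀ {y z} → su y z → ⟦ χ ⟧⁺ (y ∷ᵉ ρ) σ → ⟦ χ ⟧⁺ (z ∷ᵉ ρ) σ) → ∀ x → ⟦ χ ⟧⁺ (x ∷ᵉ ρ) σ
  induction χ ρ σ b s x = ⟦⟧⁺-stable χ do
    (X , h) ← comprehend χ ρ σ
    pure (proj₁ (h x) (mem-ind X (λ p → proj₂ (h _) (b p)) (λ p q → proj₂ (h _) (s p (proj₁ (h _) q))) x))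

  -- Order

  lt : D¹ → D¹ → Set
  lt x y = le x y × (eq x y → R)

  _<⁺_ : ℕ → ℕ → Fm⁺
  x <⁺ y = at (x ≤' y) ∧⁺ ¬⁺ at (x ≐ y)

  ρ∅ : ℕ → D¹
  ρ∅ _ = default¹

  σ∅ : ℕ → D²
  σ∅ _ = default²

  eq-le : ∀ {x y} → eq x y → le x y
  eq-le {x} e = eq-subst (1 ≤' 0) (x ∷ᵉ ρ∅) σ∅ e le-refl

  eq-sym : ∀ {x y} → eq x y → eq y x
  eq-sym {x} e = eq-subst (0 ≐ 1) (x ∷ᵉ ρ∅) σ∅ e eq-refl

  eq-ge : ∀ {x y} → eq x y → le y x
  eq-ge e = eq-le (eq-sym e)

  eq-mem : ∀ {x y X} → eq x y → mem x X → mem y X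
  eq-mem {X = X} = eq-subst (0 ∈' 0) ρ∅ (X ∷ᵉ σ∅)

  lt-stable : ∀ {x y} → Stable (lt x y)
  lt-stable = ×-stable le-stable (→-stable R-stable)

  lt⇒≱ : ∀ {x y} → lt x y → le y x → R
  lt⇒≱ (l , n) l' = n (le-antisym l l')

  lt-le-trans : ∀ {x y z} → lt x y → le y z → lt x z
  lt-le-trans (l , n) l' = le-trans l l' , λ e → n (le-antisym l (le-trans l' (eq-ge e)))

  le-lt-trans : ∀ {x y z} → le x y → lt y z → lt x z
  le-lt-trans l (l' , n) = le-trans l l' , λ e → n (le-antisym l' (le-trans (eq-ge e) l))

  lt-trans : ∀ {x y z} → lt x y → lt y z → lt x z
  lt-trans l l' = lt-le-trans l (proj₁ l')

  su≢ : ∀ x → su x x → R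
  su≢ x = induction (¬⁺ at (S 0 0)) ρ∅ σ∅ (λ z s → su-ze s z)
    (λ {y} {z} s h s' → h (eq-subst (S 1 0) (y ∷ᵉ ρ∅) σ∅ (eq-sym (su-inj s s')) s)) x

  su-lt : ∀ {x y} → su x y → lt x y
  su-lt {x} s = su-le s , λ e → su≢ x (eq-subst (S 1 0) (x ∷ᵉ ρ∅) σ∅ (eq-sym e) s)

  lt-su : ∀ {x y z} → su x y → lt z y → le z x
  lt-su s (l , n) = su-le-pred s l n

  le-su : ∀ {x y z} → su x y → le z x → lt z y
  le-su s l = le-lt-trans l (su-lt s)

  ze-le : ∀ {z} → ze z → ∀ x → le z x
  ze-le {z} p = induction (at (1 ≤' 0)) (z ∷ᵉ ρ∅) σ∅ (λ q → eq-le (ze-uniq p q)) (λ s l → le-trans l (su-le s))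

  su-min : ∀ {a a'} → su a a' → ∀ {b} → lt a b → le a' b
  su-min {a} {a'} s {b} = induction ((1 <⁺ 0) ⇒⁺ at (2 ≤' 0)) (a ∷ᵉ a' ∷ᵉ ρ∅) σ∅
    (λ z l → le-stable (absurd (lt⇒≱ l (ze-le z a))))
    (λ {c} {c'} s' h l → le-stable do
      inj₁ e ← em (eq a c)
        where inj₂ n → pure (le-trans (h (lt-su s' l , n)) (su-le s'))
      pure (eq-le (su-fun s (eq-subst (S 0 1) (c' ∷ᵉ ρ∅) σ∅ (eq-sym e) s')))) b

  le-or-lt : ∀ a b → K (le a b ⊎ lt b a)
  le-or-lt a b = induction (at (0 ≤' 1) ∨⁺ (1 <⁺ 0)) (b ∷ᵉ ρ∅) σ∅
    (λ z → pure (inj₁ (ze-le z b)))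
    (λ {c} {c'} s h → h >>= λ
      { (inj₂ l) → pure (inj₂ (lt-trans l (su-lt s)))
      ; (inj₁ l) → em (eq c b) >>= λ
         { (inj₁ e) → pure (inj₂ (le-lt-trans (eq-ge e) (su-lt s)))
         ; (inj₂ n) → pure (inj₁ (su-min s (l , n))) } }) a

  above₂ : ∀ a b → K (Σ D¹ λ c → lt a c × lt b c)
  above₂ a b = do
    (a' , s) ← su-ex a
    (b' , t) ← su-ex b
    inj₁ l ← le-or-lt a' b'
      where inj₂ l → pure (a' , su-lt s , lt-trans (su-lt t) l)
    pure (b' , lt-le-trans (su-lt s) l , su-lt t)

  aboveᶠ : ∀ n (f : Fin n → D¹) → K (Σ D¹ λ c → ∀ i → lt (f i) c)
  aboveᶠ zero    f = pure (default¹ , λ ())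
  aboveᶠ (suc n) f = do
    (c , h) ← aboveᶠ n (f ∘ suc)
    (d , l , l') ← above₂ (f zero) c
    pure (d , λ { zero → l ; (suc i) → lt-trans (h i) l' })

  -- By induction on z: either z itself is in X, or the maximum up to its predecessor serves. Later
  -- arguments use it to step back to the preceding element of a set.
  maximum : ∀ X {a} z → mem a X → le a z → K (Σ D¹ λ m → mem m X × le m z × (∀ x → mem x X → le x z → le x m))
  maximum X {a} z m l = induction
    ((at (1 ∈' 0) ∧⁺ at (1 ≤' 0)) ⇒⁺ ∃¹⁺ (at (0 ∈' 0) ∧⁺ at (0 ≤' 1) ∧⁺ ∀¹⁺ (at (0 ∈' 0) ⇒⁺ at (0 ≤' 2) ⇒⁺ at (0 ≤' 1))))
    (a ∷ᵉ ρ∅) (X ∷ᵉ σ∅)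
    (λ p (m , l) → pure (a , m , l , λ x _ l' → le-trans l' (ze-le p a)))
    (λ {y} {z} s h (m , l) → do
      inj₂ n ← em (mem z X)
        where inj₁ m' → pure (z , m' , le-refl , λ x _ l' → l')
      (b , m' , l' , g) ← h (m , lt-su s (l , λ e → n (eq-mem e m)))
      pure (b , m' , le-trans l' (su-le s) , λ x mx lx → g x mx (lt-su s (lx , λ e → n (eq-mem e mx)))))
    z (m , l)

  -- Course-of-values recursion

  module Recursion (g : Fm⁺) (ρ : ℕ → D¹) (σ : ℕ → D²)
    (local : ∀ y W W' → (∀ x → lt x y → mem x W ⇔ mem x W') → ⟦ g ⟧⁺ (y ∷ᵉ ρ) (W ∷ᵉ σ) → ⟦ g ⟧⁺ (y ∷ᵉ ρ) (W' ∷ᵉ σ)) where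

    G : D¹ → D² → Set
    G y W = ⟦ g ⟧⁺ (y ∷ᵉ ρ) (W ∷ᵉ σ)

    Approx : D¹ → D² → Set
    Approx b W = ∀ y → le y b → mem y W ⇔ G y W

    approx : Fm⁺
    approx = ∀¹⁺ (at (0 ≤' 1) ⇒⁺ ((at (0 ∈' 0) ⇒⁺ at (ren1 (lift suc) ⌜ g ⌝)) ∧⁺ (at (ren1 (lift suc) ⌜ g ⌝) ⇒⁺ at (0 ∈' 0))))

    g⇔ : ∀ {y b W} → ⟦ ren1 (lift suc) ⌜ g ⌝ ⟧ (y ∷ᵉ b ∷ᵉ ρ) (W ∷ᵉ σ) ⇔ G y W
    g⇔ = ⇔-trans (⟦⟧-ren1 ⌜ g ⌝ λ { zero → refl ; (suc _) → refl }) (⟦⟧⁺⇔ g)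

    approx⇔ : ∀ {b W} → ⟦ approx ⟧⁺ (b ∷ᵉ ρ) (W ∷ᵉ σ) ⇔ Approx b W
    approx⇔ = (λ h y l → proj₁ g⇔ ∘ proj₁ (h y l) , proj₂ (h y l) ∘ proj₂ g⇔)
            , (λ h y l → proj₂ g⇔ ∘ proj₁ (h y l) , proj₂ (h y l) ∘ proj₁ g⇔)

    -- One comprehension gains one point: by locality the equation at y involves the set only below
    -- y, where the old and the new set agree.
    improve : ∀ {b} W → (∀ y → lt y b → mem y W ⇔ G y W) → K (Σ D² (Approx b))
    improve W h = do
      (W' , c) ← comprehend g ρ (W ∷ᵉ σ)
      let same x l = ⇔-trans (c x) (⇔-sym (h x l))
      pure (W' , λ y l → ⇔-trans (c y)
        ( local y W W' (λ x l' → ⇔-sym (same x (lt-le-trans l' l)))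
        , local y W' W (λ x l' → same x (lt-le-trans l' l))))

    approximations : ∀ b → K (Σ D² (Approx b))
    approximations b = do
      (W , h) ← induction (∃²⁺ approx) ρ σ
        -- Nothing lies below zero, so that any set is correct there.
        (λ p → improve default² (λ y l → mem-impossible (lt⇒≱ l (ze-le p y))) >>= λ { (W , h) → pure (W , proj₂ approx⇔ h) })
        (λ s h → h >>= λ { (W , h') →
          improve W (λ y l → proj₁ approx⇔ h' y (lt-su s l)) >>= λ { (W , h) → pure (W , proj₂ approx⇔ h) } })
        b
      pure (W , proj₁ approx⇔ h)
      where
      mem-impossible : ∀ {y W} → R → mem y W ⇔ G y W
      mem-impossible r = (λ _ → ⟦⟧⁺-stable g (absurd r)) , (λ _ → mem-stable (absurd r))

    unique : ∀ {b W W'} → Approx b W → Approx b W' → ∀ x → le x b → mem x W ⇔ mem x W'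
    unique {b} {W} {W'} h h' x l = induction
      (∀¹⁺ (at (0 ≤' 1) ⇒⁺ at (0 ≤' 2) ⇒⁺ ((at (0 ∈' 0) ⇒⁺ at (0 ∈' 1)) ∧⁺ (at (0 ∈' 1) ⇒⁺ at (0 ∈' 0)))))
      (b ∷ᵉ ρ∅) (W ∷ᵉ W' ∷ᵉ σ∅)
      (λ p x l lb → at-x x lb (λ y l' → (λ _ → mem-stable (absurd (lt⇒≱ (lt-le-trans l' l) (ze-le p y))))
                                      , (λ _ → mem-stable (absurd (lt⇒≱ (lt-le-trans l' l) (ze-le p y))))))
      (λ s ih x l lb → at-x x lb λ y l' → ih y (lt-su s (lt-le-trans l' l)) (le-trans (proj₁ l') lb))
      x x le-refl l
      where
      at-x : ∀ x → le x b → (∀ y → lt y x → mem y W ⇔ mem y W') → mem x W ⇔ mem x W'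
      at-x x lb e = ⇔-trans (h x lb) (⇔-trans
        (local x W W' e , local x W' W (λ y l → ⇔-sym (e y l))) (⇔-sym (h' x lb)))

    -- Dedekind's argument: D collects the points y that belong to some approximation up to y. By
    -- uniqueness, D agrees with each approximation as far as that one reaches.
    recursion : K (Σ D² λ D → ∀ y → mem y D ⇔ G y D)
    recursion = do
      (D , d) ← comprehend (∃²⁺ (approx ∧⁺ at (0 ∈' 0))) ρ σ
      let agree : ∀ {b W} → Approx b W → ∀ x → le x b → mem x D ⇔ mem x W
          agree {b} {W} h x l =
            (λ m → mem-stable do
              (W' , a , m') ← proj₁ (d x) m
              pure (proj₁ (unique (proj₁ approx⇔ a) (λ y l' → h y (le-trans l' l)) x le-refl) m')) ,
            (λ m → proj₂ (d x) (pure (W , proj₂ approx⇔ (λ y l' → h y (le-trans l' l)) , m)))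
      pure (D , λ y →
        (λ m → ⟦⟧⁺-stable g do
          (W , h) ← approximations y
          pure (local y W D (λ x l → ⇔-sym (agree h x (proj₁ l))) (proj₁ (h y le-refl) (proj₁ (agree h y le-refl) m)))) ,
        (λ p → mem-stable do
          (W , h) ← approximations y
          pure (proj₂ (agree h y le-refl) (proj₂ (h y le-refl) (local y D W (λ x l → agree h x (proj₁ l)) p)))))

-- One-sorted formulae, with individuals replaced by singletons:
-- meet i j says that Xᵢ ∩ Xⱼ is inhabited, before i j that some element of Xᵢ
-- is smaller than some element of Xⱼ.

data MF : Set where
  meet before : ℕ → ℕ → MF
  and : MF → MF → MF
  neg ex : MF → MF

On : Fin 2 → Set
On b = b ≡ suc zero

on? : ∀ b → Dec (On b)
on? b = b ≟ suc zero

bit : ∀ {A : Set} → Dec A → Fin 2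
bit (yes _) = suc zero
bit (no _)  = zero

bit-on : ∀ {A : Set} (d : Dec A) → A → On (bit d)
bit-on (yes _) a = refl
bit-on (no n)  a = ⊥-elim (n a)

on-bit : ∀ {A : Set} (d : Dec A) → On (bit d) → A
on-bit (yes a) _ = a

-- `before` has three bits, because a pair split by a cut is detected from Xᵢ being inhabited on the
-- left and Xⱼ on the right. A type of `ex φ` is a set of types of φ, namely those realised by some
-- choice of the quantified set. Negation leaves types alone and acts in `accept`.
card : MF → ℕ
card (meet i j)   = 2
card (before i j) = 2 ^ 3
card (and φ ψ)    = card φ * card ψ
card (neg φ)      = card φ
card (ex φ)       = 2 ^ card φ

Tp : MF → Set
Tp φ = Fin (card φ)

abstract
  get : ∀ n → Fin (2 ^ n) → Fin n → Fin 2
  get n = finToFun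

  put : ∀ n → (Fin n → Fin 2) → Fin (2 ^ n)
  put n = funToFin

  get-put : ∀ n f i → get n (put n f) i ≡ f i
  get-put n = finToFun-funToFin

  get-injective : ∀ n s t → (∀ i → get n s i ≡ get n t i) → s ≡ t
  get-injective n s t e = trans (sym (funToFin-finToFin {n} {2} s))
    (trans (funToFin-cong e) (funToFin-finToFin {n} {2} t))
    where
    funToFin-cong : ∀ {m n} {f g : Fin m → Fin n} → (∀ i → f i ≡ g i) → funToFin f ≡ funToFin g
    funToFin-cong {zero}  e = refl
    funToFin-cong {suc m} e = cong₂ combine (e zero) (funToFin-cong (e ∘ suc))

  join : ∀ φ ψ → Tp φ → Tp ψ → Tp (and φ ψ)
  join φ ψ = combine

  fstᵗ : ∀ φ ψ → Tp (and φ ψ) → Tp φ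
  fstᵗ φ ψ = quotient (card ψ)

  sndᵗ : ∀ φ ψ → Tp (and φ ψ) → Tp ψ
  sndᵗ φ ψ = remainder {card φ} (card ψ)

  fst-join : ∀ φ ψ s t → fstᵗ φ ψ (join φ ψ s t) ≡ s
  fst-join φ ψ s t = cong proj₁ (remQuot-combine s t)

  snd-join : ∀ φ ψ s t → sndᵗ φ ψ (join φ ψ s t) ≡ t
  snd-join φ ψ s t = cong proj₂ (remQuot-combine {card φ} s t)

  join-fst-snd : ∀ φ ψ s → join φ ψ (fstᵗ φ ψ s) (sndᵗ φ ψ s) ≡ s
  join-fst-snd φ ψ = combine-remQuot {card φ} (card ψ)

pattern 0F = zero
pattern 1F = suc zero
pattern 2F = suc (suc zero)

bitsBefore : Fin 2 → Fin 2 → Fin 2 → Tp (before 0 0)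
bitsBefore a b c = put 3 λ { 0F → a ; 1F → b ; 2F → c }

-- For `ex` this is the power algebra of the types of φ: the quantified set can be chosen
-- independently on the two sides of a cut.
mul : ∀ φ → Tp φ → Tp φ → Tp φ
mul (meet i j)   a b = bit (on? a ⊎-dec on? b)
mul (before i j) s t = bitsBefore
  (bit (on? (get 3 s 0F) ⊎-dec on? (get 3 t 0F)))
  (bit (on? (get 3 s 1F) ⊎-dec on? (get 3 t 1F)))
  (bit ((on? (get 3 s 2F) ⊎-dec on? (get 3 t 2F)) ⊎-dec (on? (get 3 s 0F) ×-dec on? (get 3 t 1F))))
mul (and φ ψ)    s t = join φ ψ (mul φ (fstᵗ φ ψ s) (fstᵗ φ ψ t)) (mul ψ (sndᵗ φ ψ s) (sndᵗ φ ψ t))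
mul (neg φ)      s t = mul φ s t
mul (ex φ)       s t = put (card φ) λ r → bit (any? λ s' → any? λ t' →
  on? (get (card φ) s s') ×-dec (on? (get (card φ) t t') ×-dec (mul φ s' t' ≟ r)))

-- The type of an ω-sequence of intervals any two of which, taken together with
-- everything in between, form an interval of the given type.
omega : ∀ φ → Tp φ → Tp φ
omega (meet i j)   a = a
omega (before i j) s = bitsBefore (get 3 s 0F) (get 3 s 1F)
  (bit (on? (get 3 s 2F) ⊎-dec (on? (get 3 s 0F) ×-dec on? (get 3 s 1F))))
omega (and φ ψ)    s = join φ ψ (omega φ (fstᵗ φ ψ s)) (omega ψ (sndᵗ φ ψ s))
omega (neg φ)      s = omega φ s
omega (ex φ)       s = put (card φ) λ r → bit (any? λ s' → any? λ t' →
  on? (get (card φ) s s') ×-dec (on? (get (card φ) s t') ×-dec ((mul φ t' t' ≟ t') ×-dec (mul φ s' (omega φ t') ≟ r))))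

accept : ∀ φ → Tp φ → Fin 2
accept (meet i j)   a = a
accept (before i j) s = get 3 s 2F
accept (and φ ψ)    s = bit (on? (accept φ (fstᵗ φ ψ s)) ×-dec on? (accept ψ (sndᵗ φ ψ s)))
accept (neg φ)      s = bit (¬? (on? (accept φ s)))
accept (ex φ)       s = bit (any? λ t → on? (get (card φ) s t) ×-dec on? (accept φ t))

-- The type of a single point with membership vector l. The third bit of `before` is off because a
-- point does not precede itself.
letter : ∀ φ → (ℕ → Fin 2) → Tp φ
letter (meet i j)   l = bit (on? (l i) ×-dec on? (l j))
letter (before i j) l = bitsBefore (l i) (l j) zero
letter (and φ ψ)    l = join φ ψ (letter φ l) (letter ψ l)
letter (neg φ)      l = letter φ l
letter (ex φ)       l = put (card φ) λ r → bit (any? λ b → letter φ (b ∷ᵉ l) ≟ r)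

-- Formulae that describe types

data Dom : Set where
  all  : Dom
  upto : ℕ → Dom
  seg  : ℕ → ℕ → Dom

↑_ : Dom → Dom
↑ all     = all
↑ upto i  = upto (suc i)
↑ seg i j = seg (suc i) (suc j)

∃[_]_ : Dom → Fm → Fm
∃[ all ] φ     = ∃¹ φ
∃[ upto i ] φ  = ∃¹ ((zero ≤' suc i) ∧' φ)
∃[ seg i j ] φ = ∃¹ (((suc i ≤' zero) ∧' ((zero ≤' suc j) ∧' ¬' (zero ≐ suc j))) ∧' φ)

bitF : Fin 2 → Fm → Fm
bitF zero    φ = ¬' φ
bitF (suc _) φ = φ

⋀' : ∀ n → (Fin n → Fm) → Fm
⋀' zero    f = ⊤'
⋀' (suc n) f = f zero ∧' ⋀' n (λ i → f (suc i))

-- One scheme for three domains: `seg` for the intervals of the combinatorial part, `upto` for the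
-- bounded formula, and `all` for the formula whose relativization the latter is.
realF : ∀ φ → (ℕ → ℕ) → Dom → Tp φ → Fm
realF (meet i j)   π d a = bitF a (∃[ d ] ((0 ∈' π i) ∧' (0 ∈' π j)))
realF (before i j) π d s =
  bitF (get 3 s 0F) (∃[ d ] (0 ∈' π i)) ∧'
  bitF (get 3 s 1F) (∃[ d ] (0 ∈' π j)) ∧'
  bitF (get 3 s 2F) (∃[ d ] ((0 ∈' π i) ∧' (∃[ ↑ d ] ((0 ∈' π j) ∧' ((1 ≤' 0) ∧' ¬' (1 ≐ 0))))))
realF (and φ ψ)    π d s = realF φ π d (fstᵗ φ ψ s) ∧' realF ψ π d (sndᵗ φ ψ s)
realF (neg φ)      π d s = realF φ π d s
realF (ex φ)       π d s = ⋀' (card φ) λ t → bitF (get (card φ) s t) (∃² (realF φ (lift π) d t))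

-- Types realised in a model and their composition

module Types (M : Model) where
  open InModel M public

  -- For an off bit the second half amounts to P → R, since `K` of an empty type is equivalent to
  -- `R`.
  Bit : Fin 2 → Set → Set
  Bit b P = (On b → P) × (P → K (On b))

  Bit-stable : ∀ {b P} → Stable P → Stable (Bit b P)
  Bit-stable s = ×-stable (→-stable s) (→-stable K-stable)

  Bit-map : ∀ {b P Q} → P ⇔ Q → Bit b P → Bit b Q
  Bit-map (f , g) (h , h') = f ∘ h , h' ∘ g

  Bit-exists : ∀ P → K (Σ (Fin 2) λ b → Bit b P)
  Bit-exists P = em P >>= λ
    { (inj₁ p) → pure (suc zero , (λ _ → p) , λ _ → pure refl)
    ; (inj₂ n) → pure (zero , (λ ()) , λ p → absurd (n p)) }

  -- Uniqueness holds only under `K`: once `R` is inhabited, both bits are correct for every stable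
  -- P.
  Bit-unique : ∀ {P b b'} → Bit b P → Bit b' P → K (b ≡ b')
  Bit-unique {b = zero}     {zero}     h h' = pure refl
  Bit-unique {b = zero}     {suc zero} h h' = proj₂ h (proj₁ h' refl)
  Bit-unique {b = suc zero} {zero}     h h' = proj₂ h' (proj₁ h refl) >>= λ ()
  Bit-unique {b = suc zero} {suc zero} h h' = pure refl

  Bit-dec : ∀ {A P : Set} (d : Dec A) → (A → P) → (P → K A) → Bit (bit d) P
  Bit-dec d f g = (λ o → f (on-bit d o)) , (λ p → g p >>= λ a → pure (bit-on d a))

  bitF⇔ : ∀ b {φ ρ σ P} → ⟦ φ ⟧ ρ σ ⇔ P → ⟦ bitF b φ ⟧ ρ σ ⇔ Bit b P
  bitF⇔ zero       (f , g) = (λ n → (λ ()) , λ p → absurd (n (g p))) , (λ { (_ , h) q → h (f q) λ () })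
  bitF⇔ (suc zero) (f , g) = (λ q → (λ _ → f q) , λ _ → pure refl) , (λ { (h , _) → g (h refl) })

  ⋀⇔ : ∀ n f {ρ σ} {P : Fin n → Set} → (∀ i → ⟦ f i ⟧ ρ σ ⇔ P i) → ⟦ ⋀' n f ⟧ ρ σ ⇔ (∀ i → P i)
  ⋀⇔ zero    f e = (λ _ ()) , (λ _ → tt)
  ⋀⇔ (suc n) f e =
    (λ { (p , ps) → λ { zero → proj₁ (e zero) p ; (suc i) → proj₁ (⋀⇔ n (f ∘ suc) (e ∘ suc)) ps i } })
    , (λ h → proj₂ (e zero) (h zero) , proj₂ (⋀⇔ n (f ∘ suc) (e ∘ suc)) (h ∘ suc))

  Real : ∀ φ → (ℕ → D²) → (D¹ → Set) → Tp φ → Set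
  Real (meet i j)   τ J a = Bit a (K (Σ D¹ λ p → J p × (mem p (τ i) × mem p (τ j))))
  Real (before i j) τ J s =
    Bit (get 3 s 0F) (K (Σ D¹ λ p → J p × mem p (τ i))) ×
    Bit (get 3 s 1F) (K (Σ D¹ λ p → J p × mem p (τ j))) ×
    Bit (get 3 s 2F) (K (Σ D¹ λ p → J p × (mem p (τ i) × K (Σ D¹ λ q → J q × (mem q (τ j) × lt p q)))))
  Real (and φ ψ)    τ J s = Real φ τ J (fstᵗ φ ψ s) × Real ψ τ J (sndᵗ φ ψ s)
  Real (neg φ)      τ J s = Real φ τ J s
  Real (ex φ)       τ J s = ∀ t → Bit (get (card φ) s t) (K (Σ D² λ Y → Real φ (Y ∷ᵉ τ) J t))

  Real-stable : ∀ φ {τ J s} → Stable (Real φ τ J s)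
  Real-stable (meet i j)   = Bit-stable K-stable
  Real-stable (before i j) = ×-stable (Bit-stable K-stable) (×-stable (Bit-stable K-stable) (Bit-stable K-stable))
  Real-stable (and φ ψ)    = ×-stable (Real-stable φ) (Real-stable ψ)
  Real-stable (neg φ)      = Real-stable φ
  Real-stable (ex φ)       = ∀-stable λ _ → Bit-stable K-stable

  ⟪_⟫ : Dom → (ℕ → D¹) → D¹ → Set
  ⟪ all ⟫     ρ p = ⊤
  ⟪ upto i ⟫  ρ p = le p (ρ i)
  ⟪ seg i j ⟫ ρ p = le (ρ i) p × lt p (ρ j)

  KΣ-⇔ : ∀ {A : Set} {P Q : A → Set} → (∀ a → P a ⇔ Q a) → K (Σ A P) ⇔ K (Σ A Q)
  KΣ-⇔ e = (λ m → m >>= λ { (a , p) → pure (a , proj₁ (e a) p) })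
         , (λ m → m >>= λ { (a , p) → pure (a , proj₂ (e a) p) })

  ×-⇔ : ∀ {A A' B B' : Set} → A ⇔ A' → B ⇔ B' → (A × B) ⇔ (A' × B')
  ×-⇔ (f , g) (f' , g') = (λ { (a , b) → f a , f' b }) , (λ { (a , b) → g a , g' b })

  ∃[]⇔ : ∀ d {φ ρ σ} {P : D¹ → Set} → (∀ p → ⟦ φ ⟧ (p ∷ᵉ ρ) σ ⇔ P p) → ⟦ ∃[ d ] φ ⟧ ρ σ ⇔ K (Σ D¹ λ p → ⟪ d ⟫ ρ p × P p)
  ∃[]⇔ all       e = KΣ-⇔ λ p → (λ h → tt , proj₁ (e p) h) , (λ { (_ , h) → proj₂ (e p) h })
  ∃[]⇔ (upto i)  e = KΣ-⇔ λ p → ×-⇔ (id , id) (e p)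
  ∃[]⇔ (seg i j) e = KΣ-⇔ λ p → ×-⇔ (id , id) (e p)

  ⟪↑⟫ : ∀ d {ρ p q} → ⟪ ↑ d ⟫ (p ∷ᵉ ρ) q ⇔ ⟪ d ⟫ ρ q
  ⟪↑⟫ all       = id , id
  ⟪↑⟫ (upto i)  = id , id
  ⟪↑⟫ (seg i j) = id , id

  record Same (τ : ℕ → D²) (J : D¹ → Set) (τ' : ℕ → D²) (J' : D¹ → Set) : Set where
    constructor same
    field
      dom : ∀ p → J p ⇔ J' p
      set : ∀ i p → J p → mem p (τ i) ⇔ mem p (τ' i)
  open Same

  Same-sym : ∀ {τ J τ' J'} → Same τ J τ' J' → Same τ' J' τ J
  Same-sym (same d s) = same (λ p → ⇔-sym (d p)) (λ i p j → ⇔-sym (s i p (proj₂ (d p) j)))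

  Same-∷ : ∀ {τ J τ' J' Y} → Same τ J τ' J' → Same (Y ∷ᵉ τ) J (Y ∷ᵉ τ') J'
  Same-∷ (same d s) = same d λ { zero p j → id , id ; (suc i) p j → s i p j }

  ×-⇔ʳ : ∀ {A A' B B' : Set} → A ⇔ A' → (A → B ⇔ B') → (A × B) ⇔ (A' × B')
  ×-⇔ʳ (f , g) e = (λ { (a , b) → f a , proj₁ (e a) b }) , (λ { (a , b) → g a , proj₂ (e (g a)) b })

  Real-local : ∀ φ {τ J τ' J' s} → Same τ J τ' J' → Real φ τ J s → Real φ τ' J' s
  Real-local (meet i j)   e = Bit-map (KΣ-⇔ λ p → ×-⇔ʳ (dom e p) λ j' → ×-⇔ (set e i p j') (set e j p j'))
  Real-local (before i j) e (h₀ , h₁ , h₂) =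
    Bit-map (KΣ-⇔ λ p → ×-⇔ʳ (dom e p) (set e i p)) h₀ ,
    Bit-map (KΣ-⇔ λ p → ×-⇔ʳ (dom e p) (set e j p)) h₁ ,
    Bit-map (KΣ-⇔ λ p → ×-⇔ʳ (dom e p) λ j' → ×-⇔ (set e i p j')
      (KΣ-⇔ λ q → ×-⇔ʳ (dom e q) λ j'' → ×-⇔ (set e j q j'') (id , id))) h₂
  Real-local (and φ ψ)    e (h , h') = Real-local φ e h , Real-local ψ e h'
  Real-local (neg φ)      e h = Real-local φ e h
  Real-local (ex φ)       e h t = Bit-map
    (KΣ-⇔ λ Y → Real-local φ (Same-∷ e) , Real-local φ (Same-∷ (Same-sym e))) (h t)

  realF⇔ : ∀ φ {π d s ρ σ} → ⟦ realF φ π d s ⟧ ρ σ ⇔ Real φ (σ ∘ π) (⟪ d ⟫ ρ) s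
  realF⇔ (meet i j)   {d = d} {s} = bitF⇔ s (∃[]⇔ d λ p → id , id)
  realF⇔ (before i j) {d = d} {s} = ×-⇔ (bitF⇔ (get 3 s 0F) (∃[]⇔ d λ p → id , id))
    (×-⇔ (bitF⇔ (get 3 s 1F) (∃[]⇔ d λ p → id , id))
         (bitF⇔ (get 3 s 2F) (∃[]⇔ d λ p → ×-⇔ (id , id)
           (⇔-trans (∃[]⇔ (↑ d) λ q → id , id) (KΣ-⇔ λ q → ×-⇔ (⟪↑⟫ d) (id , id))))))
  realF⇔ (and φ ψ)    = ×-⇔ (realF⇔ φ) (realF⇔ ψ)
  realF⇔ (neg φ)      = realF⇔ φ
  realF⇔ (ex φ) {π} {d} {s} {ρ} {σ} = ⋀⇔ (card φ) _ λ t → bitF⇔ (get (card φ) s t) (KΣ-⇔ λ Y →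
    ⇔-trans (realF⇔ φ) (Real-local φ (shifted Y) , Real-local φ (Same-sym (shifted Y))))
    where
    shifted : ∀ Y → Same ((Y ∷ᵉ σ) ∘ lift π) (⟪ d ⟫ ρ) (Y ∷ᵉ (σ ∘ π)) (⟪ d ⟫ ρ)
    shifted Y = same (λ p → id , id) λ { zero p _ → id , id ; (suc i) p _ → id , id }

  Bit-put : ∀ n {f P} i → Bit (f i) P → Bit (get n (put n f) i) P
  Bit-put n {f} {P} i = subst (λ b → Bit b P) (sym (get-put n f i))

  Real-and : ∀ φ ψ {τ J s t} → Real φ τ J s → Real ψ τ J t → Real (and φ ψ) τ J (join φ ψ s t)
  Real-and φ ψ {τ} {J} {s} {t} h h' =
    subst (Real φ τ J) (sym (fst-join φ ψ s t)) h , subst (Real ψ τ J) (sym (snd-join φ ψ s t)) h'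

  Real-exists : ∀ φ τ J → K (Σ (Tp φ) (Real φ τ J))
  Real-exists (meet i j)   τ J = Bit-exists _
  Real-exists (before i j) τ J = do
    (a , h) ← Bit-exists _
    (b , h') ← Bit-exists _
    (c , h'') ← Bit-exists _
    pure (bitsBefore a b c , Bit-put 3 0F h , Bit-put 3 1F h' , Bit-put 3 2F h'')
  Real-exists (and φ ψ)    τ J = do
    (s , h) ← Real-exists φ τ J
    (t , h') ← Real-exists ψ τ J
    pure (join φ ψ s t , Real-and φ ψ h h')
  Real-exists (neg φ)      τ J = Real-exists φ τ J
  Real-exists (ex φ)       τ J = do
    h ← fin-choice (card φ) λ t → Bit-exists (K (Σ D² λ Y → Real φ (Y ∷ᵉ τ) J t))
    pure (put (card φ) (proj₁ ∘ h) , λ t → Bit-put (card φ) t (proj₂ (h t)))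

  Real-unique : ∀ φ {τ J s t} → Real φ τ J s → Real φ τ J t → K (s ≡ t)
  Real-unique (meet i j)   h h' = Bit-unique h h'
  Real-unique (before i j) {s = s} {t} (h₀ , h₁ , h₂) (k₀ , k₁ , k₂) = do
    e₀ ← Bit-unique h₀ k₀
    e₁ ← Bit-unique h₁ k₁
    e₂ ← Bit-unique h₂ k₂
    pure (get-injective 3 s t λ { 0F → e₀ ; 1F → e₁ ; 2F → e₂ })
  Real-unique (and φ ψ) {s = s} {t} (h , h') (k , k') = do
    e ← Real-unique φ h k
    e' ← Real-unique ψ h' k'
    pure (trans (sym (join-fst-snd φ ψ s)) (trans (cong₂ (join φ ψ) e e') (join-fst-snd φ ψ t)))
  Real-unique (neg φ)      h h' = Real-unique φ h h'
  Real-unique (ex φ) {s = s} {t} h h' = do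
    e ← fin-choice (card φ) λ r → Bit-unique (h r) (h' r)
    pure (get-injective (card φ) s t e)

  glue : ∀ c Y Z → K (Σ D² λ W → ∀ p → (lt p c → mem p W ⇔ mem p Y) × (le c p → mem p W ⇔ mem p Z))
  glue c Y Z = do
    (W , h) ← comprehend (((0 <⁺ 1) ∧⁺ at (0 ∈' 0)) ∨⁺ (at (1 ≤' 0) ∧⁺ at (0 ∈' 1))) (c ∷ᵉ ρ∅) (Y ∷ᵉ Z ∷ᵉ σ∅)
    pure (W , λ p →
      (λ l → (λ m → mem-stable (proj₁ (h p) m >>= λ { (inj₁ (_ , m')) → pure m' ; (inj₂ (l' , _)) → absurd (lt⇒≱ l l') }))
           , (λ m → proj₂ (h p) (pure (inj₁ (l , m))))) ,
      (λ l → (λ m → mem-stable (proj₁ (h p) m >>= λ { (inj₁ (l' , _)) → absurd (lt⇒≱ l' l) ; (inj₂ (_ , m')) → pure m' }))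
           , (λ m → proj₂ (h p) (pure (inj₂ (l , m))))))

  record Cut (J₁ J₂ J : D¹ → Set) : Set where
    field
      point : D¹
      left  : ∀ {p} → J₁ p → lt p point
      right : ∀ {p} → J₂ p → le point p
      in₁   : ∀ {p} → J₁ p → J p
      in₂   : ∀ {p} → J₂ p → J p
      out   : ∀ {p} → J p → K (J₁ p ⊎ J₂ p)

  -- The composition theorem. For `ex`, one direction glues the two chosen sets at the cut point;
  -- the other looks at one set on both sides and compares types by `Real-unique`.
  Real-mul : ∀ φ {τ J₁ J₂ J s t} → Cut J₁ J₂ J → Real φ τ J₁ s → Real φ τ J₂ t → Real φ τ J (mul φ s t)
  Real-mul (meet i j) {τ} {s = s} {t} c h h' = Bit-dec (on? s ⊎-dec on? t)
    (λ { (inj₁ o) → proj₁ h o >>= λ { (p , j , m) → pure (p , in₁ j , m) }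
       ; (inj₂ o) → proj₁ h' o >>= λ { (p , j , m) → pure (p , in₂ j , m) } })
    (λ m → m >>= λ { (p , j , m') → out j >>= λ
       { (inj₁ j') → proj₂ h (pure (p , j' , m')) >>= λ o → pure (inj₁ o)
       ; (inj₂ j') → proj₂ h' (pure (p , j' , m')) >>= λ o → pure (inj₂ o) } })
    where open Cut c
  Real-mul (before i j) {τ} {J₁} {J₂} {J} {s} {t} c (h₀ , h₁ , h₂) (k₀ , k₁ , k₂) =
    Bit-put 3 0F (union i h₀ k₀) , Bit-put 3 1F (union j h₁ k₁) , Bit-put 3 2F (Bit-dec _
      (λ { (inj₁ (inj₁ o)) → proj₁ h₂ o >>= λ { (p , j , m , n) → pure (p , in₁ j , m ,
                               (n >>= λ { (q , j' , m') → pure (q , in₁ j' , m') })) }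
         ; (inj₁ (inj₂ o)) → proj₁ k₂ o >>= λ { (p , j , m , n) → pure (p , in₂ j , m ,
                               (n >>= λ { (q , j' , m') → pure (q , in₂ j' , m') })) }
         ; (inj₂ (o , o')) → proj₁ h₀ o >>= λ { (p , j , m) → proj₁ k₁ o' >>= λ { (q , j' , m') →
                               pure (p , in₁ j , m , pure (q , in₂ j' , m' , lt-le-trans (left j) (right j'))) } } })
      (λ m → do
        (p , jp , mp , n) ← m
        (q , jq , mq , l) ← n
        inj₁ jp' ← out jp
          where inj₂ jp' → out jq >>= λ
                  { (inj₁ jq') → absurd (lt⇒≱ (lt-trans l (left jq')) (right jp'))
                  ; (inj₂ jq') → proj₂ k₂ (pure (p , jp' , mp , pure (q , jq' , mq , l))) >>= λ o → pure (inj₁ (inj₂ o)) }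
        inj₁ jq' ← out jq
          where inj₂ jq' → proj₂ h₀ (pure (p , jp' , mp)) >>= λ o → proj₂ k₁ (pure (q , jq' , mq)) >>= λ o' → pure (inj₂ (o , o'))
        o ← proj₂ h₂ (pure (p , jp' , mp , pure (q , jq' , mq , l)))
        pure (inj₁ (inj₁ o))))
    where
    open Cut c
    union : ∀ {a b} i → Bit a (K (Σ D¹ λ p → J₁ p × mem p (τ i))) → Bit b (K (Σ D¹ λ p → J₂ p × mem p (τ i))) →
            Bit (bit (on? a ⊎-dec on? b)) (K (Σ D¹ λ p → J p × mem p (τ i)))
    union {a} {b} i h k = Bit-dec (on? a ⊎-dec on? b)
      (λ { (inj₁ o) → proj₁ h o >>= λ { (p , j , m) → pure (p , in₁ j , m) }
         ; (inj₂ o) → proj₁ k o >>= λ { (p , j , m) → pure (p , in₂ j , m) } })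
      (λ m → m >>= λ { (p , j , m') → out j >>= λ
         { (inj₁ j') → proj₂ h (pure (p , j' , m')) >>= λ o → pure (inj₁ o)
         ; (inj₂ j') → proj₂ k (pure (p , j' , m')) >>= λ o → pure (inj₂ o) } })
  Real-mul (and φ ψ) c (h , h') (k , k') = Real-and φ ψ (Real-mul φ c h k) (Real-mul ψ c h' k')
  Real-mul (neg φ)   c h k = Real-mul φ c h k
  Real-mul (ex φ) {τ} {J₁} {J₂} {J} {s} {t} c h k r = Bit-put (card φ) r (Bit-dec _
    (λ { (s' , t' , o , o' , refl) → do
      (Y , y) ← proj₁ (h s') o
      (Z , z) ← proj₁ (k t') o'
      (W , w) ← glue point Y Z
      pure (W , Real-mul φ c
        (Real-local φ (same (λ _ → id , id) λ { zero p j → ⇔-sym (proj₁ (w p) (left j)) ; (suc i) p j → id , id }) y)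
        (Real-local φ (same (λ _ → id , id) λ { zero p j → ⇔-sym (proj₂ (w p) (right j)) ; (suc i) p j → id , id }) z)) })
    (λ m → do
      (Y , y) ← m
      (s' , y₁) ← Real-exists φ (Y ∷ᵉ τ) J₁
      (t' , y₂) ← Real-exists φ (Y ∷ᵉ τ) J₂
      o ← proj₂ (h s') (pure (Y , y₁))
      o' ← proj₂ (k t') (pure (Y , y₂))
      e ← Real-unique φ (Real-mul φ c y₁ y₂) y
      pure (s' , t' , o , o' , e)))
    where open Cut c

module Ramsey (M : Model) where
  open Types M public

  -- Intervals

  [_,_⟩ : D¹ → D¹ → D¹ → Set
  [ a , b ⟩ p = le a p × lt p b

  [_,∞⟩ : D¹ → D¹ → Set
  [ a ,∞⟩ p = le a p

  cut-interval : ∀ {a b c} → le a b → le b c → Cut [ a , b ⟩ [ b , c ⟩ [ a , c ⟩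
  cut-interval {a} {b} {c} ab bc = record
    { point = b ; left = proj₂ ; right = proj₁
    ; in₁ = λ { (l , l') → l , lt-le-trans l' bc }
    ; in₂ = λ { (l , l') → le-trans ab l , l' }
    ; out = λ { {p} (l , l') → le-or-lt b p >>= λ { (inj₁ m) → pure (inj₂ (m , l')) ; (inj₂ m) → pure (inj₁ (l , m)) } } }

  cut-tail : ∀ {a b} → le a b → Cut [ a , b ⟩ [ b ,∞⟩ [ a ,∞⟩
  cut-tail {a} {b} ab = record
    { point = b ; left = proj₂ ; right = id ; in₁ = proj₁ ; in₂ = le-trans ab
    ; out = λ { {p} l → le-or-lt b p >>= λ { (inj₁ m) → pure (inj₂ m) ; (inj₂ m) → pure (inj₁ (l , m)) } } }

  interval-eq : ∀ φ {τ a a' b b' s} → eq a a' → eq b b' → Real φ τ [ a , b ⟩ s → Real φ τ [ a' , b' ⟩ s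
  interval-eq φ e e' = Real-local φ (same
    (λ p → (λ { (l , l') → le-trans (eq-ge e) l , lt-le-trans l' (eq-le e') })
         , (λ { (l , l') → le-trans (eq-le e) l , lt-le-trans l' (eq-ge e') }))
    (λ _ _ _ → id , id))

  -- Being a `leaf`, it reads as the statement about types itself, so that comprehension and
  -- induction apply to such statements directly.
  real⁺ : ∀ φ → ℕ → ℕ → ℕ → Tp φ → Fm⁺
  real⁺ φ k i j s = leaf (realF φ (k +_) (seg i j) s)
    (λ ρ σ → Real φ (λ X → σ (k + X)) [ ρ i , ρ j ⟩ s) (λ ρ σ → realF⇔ φ)

  -- Set 0 is a candidate for the quantified set and becomes the first track; the sets strictly
  -- between 0 and k are auxiliary and are skipped.
  real₀⁺ : ∀ φ → ℕ → ℕ → ℕ → Tp φ → Fm⁺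
  real₀⁺ φ k i j s = leaf (realF φ (0 ∷ᵉ (k +_)) (seg i j) s)
    (λ ρ σ → Real φ (σ 0 ∷ᵉ λ X → σ (k + X)) [ ρ i , ρ j ⟩ s)
    (λ ρ σ → ⇔-trans (realF⇔ φ)
      ( Real-local φ (same (λ _ → id , id) λ { zero _ _ → id , id ; (suc _) _ _ → id , id })
      , Real-local φ (same (λ _ → id , id) λ { zero _ _ → id , id ; (suc _) _ _ → id , id })))

  Inf : (D¹ → Set) → Set
  Inf P = ∀ a → K (Σ D¹ λ y → lt a y × P y)

  ¬Inf : ∀ {P} → (Inf P → R) → K (Σ D¹ λ b → ∀ y → lt b y → P y → R)
  ¬Inf h k = h λ a k' → k (a , λ y l p → k' (y , l , p))

  Homogeneous : ∀ φ → (ℕ → D²) → D² → Tp φ → Set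
  Homogeneous φ τ D s = ∀ d d' → mem d D → mem d' D → lt d d' → Real φ τ [ d , d' ⟩ s

  -- Homogeneous by definition. That it is infinite is argued at each use, by showing that a bounded
  -- greedy set would have to admit one more point.
  greedy : ∀ φ τ B s → K (Σ D² λ D → ∀ y → mem y D ⇔ (mem y B × (∀ x → mem x D → lt x y → Real φ τ [ x , y ⟩ s)))
  greedy φ τ B s = Recursion.recursion
    (at (0 ∈' 1) ∧⁺ ∀¹⁺ (at (0 ∈' 0) ⇒⁺ (0 <⁺ 1) ⇒⁺ real⁺ φ 2 0 1 s)) ρ∅ (B ∷ᵉ τ)
    (λ y W W' e → λ { (m , h) → m , λ x m' l → h x (proj₂ (e x l) m') l })

  -- Additive Ramsey theorem: call x and y equivalent when the intervals [x,z⟩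
  -- and [y,z⟩ have the same type for some z, hence for all larger z.  There are
  -- finitely many classes, and inside an infinite one the greedy set is infinite.

  module _ (φ : MF) (τ : ℕ → D²) (D : D²) (infD : Inf λ y → mem y D) where

    Equiv : D¹ → D¹ → Set
    Equiv x y = K (Σ D¹ λ z → lt x z × lt y z × K (Σ (Tp φ) λ s → Real φ τ [ x , z ⟩ s × Real φ τ [ y , z ⟩ s))

    equiv⁺ : ℕ → ℕ → Fm⁺
    equiv⁺ x y = ∃¹⁺ ((suc x <⁺ 0) ∧⁺ (suc y <⁺ 0) ∧⁺ ⋁⁺ (card φ) λ s → real⁺ φ 1 (suc x) 0 s ∧⁺ real⁺ φ 1 (suc y) 0 s)

    Class : D¹ → D¹ → Set
    Class x y = mem y D × Equiv y x

    -- Were every class bounded, a point of D beyond the bounds of the classes chosen so far would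
    -- be inequivalent to all of them. The count n is an Agda number, so that `pigeonhole` will
    -- apply.
    inequivalent : ((Σ D¹ λ x → mem x D × Inf (Class x)) → R) → ∀ n →
      K (Σ (Fin n → D¹) λ f → (∀ i → mem (f i) D) × (∀ i j → i Fin.< j → Equiv (f i) (f j) → R))
    inequivalent h zero    = pure ((λ ()) , (λ ()) , λ ())
    inequivalent h (suc n) = do
      (f , m , ne) ← inequivalent h n
      b ← fin-choice n λ i → ¬Inf (λ inf → h (f i , m i , inf))
      (c , above) ← aboveᶠ n (proj₁ ∘ b)
      (y , l , my) ← infD c
      pure ((λ { zero → y ; (suc i) → f i }) , (λ { zero → my ; (suc i) → m i })
        , λ { zero (suc j) _ e → proj₂ (b j) y (lt-trans (above j) l) (my , e)
            ; (suc i) (suc j) (s≤s i<j) e → ne i j i<j e })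

    infinite-class : K (Σ D¹ λ x → mem x D × Inf (Class x))
    infinite-class k = R-stable do
      (f , m , ne) ← inequivalent k (suc (card φ))
      (z , above) ← aboveᶠ (suc (card φ)) f
      s ← fin-choice (suc (card φ)) λ i → Real-exists φ τ [ f i , z ⟩
      let (i , j , i<j , e) = pigeonhole (ℕₚ.n<1+n (card φ)) (proj₁ ∘ s)
      pure (ne i j i<j (pure (z , above i , above j ,
        pure (proj₁ (s j) , subst (Real φ τ [ f i , z ⟩) e (proj₂ (s i)) , proj₂ (s j)))))

    infinite-colour : ∀ x → Inf (Class x) → K (Σ (Tp φ) λ s → Inf λ y → Class x y × lt x y × Real φ τ [ x , y ⟩ s)
    infinite-colour x inf k = R-stable do
      b ← fin-choice (card φ) λ s → ¬Inf (λ inf' → k (s , inf'))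
      (c , above) ← aboveᶠ (card φ) (proj₁ ∘ b)
      (c' , l₁ , l₂) ← above₂ c x
      (y , l , cl) ← inf c'
      (s , r) ← Real-exists φ τ [ x , y ⟩
      pure (proj₂ (b s) y (lt-trans (above s) (lt-trans l₁ l)) (cl , lt-trans l₂ l , r))

    ramsey : K (Σ D² λ D' → Σ (Tp φ) λ s → (∀ y → mem y D' → mem y D) × Inf (λ y → mem y D') × Homogeneous φ τ D' s)
    ramsey = do
      (x₀ , mx₀ , infC) ← infinite-class
      (f , infF) ← infinite-colour x₀ infC
      (B , b) ← comprehend ((at (0 ∈' 0) ∧⁺ equiv⁺ 0 1) ∧⁺ (1 <⁺ 0) ∧⁺ real⁺ φ 1 1 0 f) (x₀ ∷ᵉ ρ∅) (D ∷ᵉ τ)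
      (D' , d) ← greedy φ τ B f
      let
        -- Beyond a point z at which the intervals from x and from x₀ have the same type, the type
        -- of [x,y⟩ is that of [x₀,y⟩, which is f for y in B.
        eventually : ∀ x → mem x B → K (Σ D¹ λ z → ∀ y → lt z y → mem y B → Real φ τ [ x , y ⟩ f)
        eventually x mx = do
          (z , xz , x₀z , w) ← proj₂ (proj₁ (proj₁ (b x) mx))
          (s , r , r₀) ← w
          pure (z , λ y zy my → Real-stable φ do
            (t , r') ← Real-exists φ τ [ z , y ⟩
            e ← Real-unique φ (Real-mul φ (cut-interval (proj₁ x₀z) (proj₁ zy)) r₀ r') (proj₂ (proj₂ (proj₁ (b y) my)))
            pure (subst (Real φ τ [ x , y ⟩) e (Real-mul φ (cut-interval (proj₁ xz) (proj₁ zy)) r r')))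
        Uniform : D¹ → Set
        Uniform c = K (Σ D¹ λ z → ∀ x → le x c → mem x B → ∀ y → lt z y → mem y B → Real φ τ [ x , y ⟩ f)
        next : ∀ c z → (∀ x → lt x c → mem x B → ∀ y → lt z y → mem y B → Real φ τ [ x , y ⟩ f) → Uniform c
        next c z h = do
          inj₁ mc ← em (mem c B)
            where inj₂ n → pure (z , λ x l m → h x (l , λ e → n (eq-mem e m)) m)
          (z' , h') ← eventually c mc
          (z'' , l₁ , l₂) ← above₂ z z'
          pure (z'' , λ x l m y l' my → Real-stable φ (em (eq x c) >>= λ
            { (inj₁ e) → pure (interval-eq φ (eq-sym e) eq-refl (h' y (lt-trans l₂ l') my))
            ; (inj₂ n) → pure (h x (l , n) m y (lt-trans l₁ l') my) }))
        -- A collection principle: one z serves all x up to c. The induction is internal because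
        -- these x need not form an Agda-finite list.
        uniform : ∀ c → Uniform c
        uniform = induction
          (∃¹⁺ (∀¹⁺ (at (0 ≤' 2) ⇒⁺ at (0 ∈' 0) ⇒⁺ ∀¹⁺ ((2 <⁺ 0) ⇒⁺ at (0 ∈' 0) ⇒⁺ real⁺ φ 1 1 0 f))))
          ρ∅ (B ∷ᵉ τ)
          (λ {c} p → next c c λ x l → λ _ _ _ _ → Real-stable φ (absurd (lt⇒≱ l (ze-le p x))))
          (λ {c} {c'} s h → h >>= λ { (z , h') → next c' z λ x l → h' x (lt-su s l) })
        -- If no element of D' exceeded a, then y, taken beyond the uniform bound for a, would
        -- satisfy the defining condition of D'.
        infD' : Inf λ y → mem y D'
        infD' a k = R-stable do
          (z , h) ← uniform a
          (c , ac , zc) ← above₂ a z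
          (y , l , (my , ey) , xy , ry) ← infF c
          let myB = proj₂ (b y) ((my , ey) , xy , ry)
          pure (k (y , lt-trans ac l , proj₂ (d y) (myB , λ x mx l' → Real-stable φ (le-or-lt x a >>= λ
            { (inj₁ xa) → pure (h x xa (proj₁ (proj₁ (d x) mx)) y (lt-trans zc l) myB)
            ; (inj₂ l'') → absurd (k (x , l'' , mx)) }))))
      pure (D' , f , (λ y m → proj₁ (proj₁ (proj₁ (b y) (proj₁ (proj₁ (d y) m))))) , infD'
           , λ x y mx my l → proj₂ (proj₁ (d y) my) x mx l)

  -- Simultaneous choice: on each interval between consecutive elements of D, the
  -- set is built from left to right, avoiding a point whenever some set of the
  -- required type that agrees with the choices made so far avoids it.

  Consecutive : D² → D¹ → D¹ → Set
  Consecutive D d d' = mem d D × mem d' D × lt d d' × (∀ x → mem x D → lt d x → lt x d' → R)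

  consecutive-unique : ∀ {D y d₁ d₁' d₂ d₂'} → Consecutive D d₁ d₁' → Consecutive D d₂ d₂' →
    le d₁ y → lt y d₁' → le d₂ y → lt y d₂' → eq d₁ d₂ × eq d₁' d₂'
  consecutive-unique {D} {y} c₁@(m₁ , m₁' , _ , n₁) c₂@(m₂ , m₂' , _ , n₂) l₁ l₁' l₂ l₂' =
      le-antisym (lower c₂ m₁ l₁ l₂') (lower c₁ m₂ l₂ l₁')
    , le-antisym (upper c₁ m₂' l₁ l₂') (upper c₂ m₁' l₂ l₁')
    where
    lower : ∀ {d d' x} → Consecutive D d d' → mem x D → le x y → lt y d' → le x d
    lower {d} {d'} {x} (_ , _ , _ , n) m l l' = le-stable (le-or-lt x d >>= λ
      { (inj₁ h) → pure h ; (inj₂ h) → absurd (n x m h (le-lt-trans l l')) })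
    upper : ∀ {d d' x} → Consecutive D d d' → mem x D → le d y → lt y x → le d' x
    upper {d} {d'} {x} (_ , _ , _ , n) m l l' = le-stable (le-or-lt d' x >>= λ
      { (inj₁ h) → pure h ; (inj₂ h) → absurd (n x m (le-lt-trans l l') h) })

  consecutive⁺ : ℕ → ℕ → ℕ → Fm⁺
  consecutive⁺ D d d' = at (d ∈' D) ∧⁺ at (d' ∈' D) ∧⁺ (d <⁺ d') ∧⁺
    ∀¹⁺ (at (0 ∈' D) ⇒⁺ (suc d <⁺ 0) ⇒⁺ (0 <⁺ suc d') ⇒⁺ at ⊥')

  agree⁺ : ℕ → ℕ → Fm⁺
  agree⁺ d y = ∀¹⁺ (at (suc d ≤' 0) ⇒⁺ (0 <⁺ suc y) ⇒⁺ ((at (0 ∈' 0) ⇒⁺ at (0 ∈' 1)) ∧⁺ (at (0 ∈' 1) ⇒⁺ at (0 ∈' 0))))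

  Agree : D¹ → D¹ → D² → D² → Set
  Agree d y Y W = ∀ x → le d x → lt x y → mem x Y ⇔ mem x W

  choice : ∀ φ τ D s → (∀ d d' → Consecutive D d d' → K (Σ D² λ Y → Real φ (Y ∷ᵉ τ) [ d , d' ⟩ s)) →
           K (Σ D² λ Y → ∀ d d' → Consecutive D d d' → Real φ (Y ∷ᵉ τ) [ d , d' ⟩ s)
  choice φ τ D s h = do
    (Y* , y*) ← Recursion.recursion
      (¬⁺ ∃¹⁺ (∃¹⁺ (consecutive⁺ 1 1 0 ∧⁺ at (1 ≤' 2) ∧⁺ (2 <⁺ 0) ∧⁺
        ∃²⁺ (agree⁺ 1 2 ∧⁺ ¬⁺ at (2 ∈' 0) ∧⁺ real₀⁺ φ 3 1 0 s))))
      ρ∅ (D ∷ᵉ τ)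
      (λ y W W' e g m → g (m >>= λ { (d , m') → pure (d , (m' >>= λ { (d' , c , l , l' , m'') →
        pure (d' , c , l , l' , (m'' >>= λ { (Y , a , n , r) →
          pure (Y , (λ x dx xy → ⇔-trans (a x dx xy) (⇔-sym (e x xy))) , n , r) })) })) }))
    let
      -- The invariant: what has been fixed before y still extends to a set of type s on the whole
      -- interval. At y = d' everything is fixed.
      Partial : D¹ → D¹ → D¹ → Set
      Partial d d' y = K (Σ D² λ Y → Agree d y Y Y* × Real φ (Y ∷ᵉ τ) [ d , d' ⟩ s)
      start : ∀ {d d' y} → Consecutive D d d' → le y d → Partial d d' y
      start c l = h _ _ c >>= λ { (Y , r) → pure (Y ,
        (λ x dx xy → (λ _ → mem-stable (absurd (lt⇒≱ xy (le-trans l dx))))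
                   , (λ _ → mem-stable (absurd (lt⇒≱ xy (le-trans l dx))))) , r) }
      extend : ∀ {d d' y y' Y} → su y y' → Agree d y Y Y* → (mem y Y ⇔ mem y Y*) → Agree d y' Y Y*
      extend {y = y} {Y = Y} su a e x dx xy' =
        (λ m → mem-stable (em (eq x y) >>= λ
          { (inj₁ q) → pure (eq-mem (eq-sym q) (proj₁ e (eq-mem q m))) ; (inj₂ n) → pure (proj₁ (a x dx (lt-su su xy' , n)) m) })) ,
        (λ m → mem-stable (em (eq x y) >>= λ
          { (inj₁ q) → pure (eq-mem (eq-sym q) (proj₂ e (eq-mem q m))) ; (inj₂ n) → pure (proj₂ (a x dx (lt-su su xy' , n)) m) }))
      partial-step : ∀ {d d' y y'} → Consecutive D d d' → su y y' → (le d y → le y d' → Partial d d' y) →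
                     le d y' → le y' d' → Partial d d' y'
      partial-step {d} {d'} {y} {y'} c su ih dy' y'd' = do
        inj₁ dy ← le-or-lt d y
          where inj₂ yd → start c (su-min su yd)
        (Y , a , r) ← ih dy (le-trans (su-le su) y'd')
        -- If y is in `Y*`, the set at hand contains y too, as it would otherwise have been a reason
        -- to leave y out. If y is not in `Y*`, the reason for leaving it out is a set that
        -- continues the invariant.
        inj₂ n ← em (mem y Y*)
          where inj₁ m → pure (Y , extend {d} {d'} su a ((λ _ → m) , λ _ → mem-stable λ k →
                  proj₁ (y* y) m (pure (d , pure (d' , c , dy , lt-le-trans (su-lt su) y'd' , pure (Y , a , k , r))))) , r)
        (d₁ , w) ← λ k → n (proj₂ (y* y) (λ m → m k))
        (d₁' , c₁ , l₁ , l₁' , w') ← w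
        (Y₁ , a₁ , n₁ , r₁) ← w'
        -- That reason comes with its own pair of consecutive elements around y, which equals the
        -- given pair only in the sense of `eq`.
        let (e , e') = consecutive-unique c₁ c l₁ l₁' dy (lt-le-trans (su-lt su) y'd')
        pure (Y₁ , extend {d} {d'} su (λ x dx → a₁ x (le-trans (eq-le e) dx))
                     ((λ m → mem-stable (absurd (n₁ m))) , (λ m → mem-stable (absurd (n m))))
                 , interval-eq φ e e' r₁)
      partial : ∀ {d d'} → Consecutive D d d' → ∀ y → le d y → le y d' → Partial d d' y
      partial {d} {d'} c = induction
        (at (1 ≤' 0) ⇒⁺ at (0 ≤' 2) ⇒⁺ ∃²⁺ (agree⁺ 1 0 ∧⁺ real₀⁺ φ 2 1 2 s)) (d ∷ᵉ d' ∷ᵉ ρ∅) (Y* ∷ᵉ τ)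
        (λ p dy yd' → start c (ze-le p d))
        (λ su ih → partial-step c su ih)
    pure (Y* , λ d d' c → Real-stable φ do
      (Y , a , r) ← partial c d' (proj₁ (proj₁ (proj₂ (proj₂ c)))) le-refl
      pure (Real-local φ (same (λ _ → id , id)
        λ { zero p (l , l') → a p l l' ; (suc i) p _ → id , id }) r))

  -- The type of a homogeneous tail

  homogeneous : ∀ φ {τ D s} → mul φ s s ≡ s → (∀ d d' → Consecutive D d d' → Real φ τ [ d , d' ⟩ s) → Homogeneous φ τ D s
  homogeneous φ {τ} {D} {s} idem h d d' md md' l = induction
    (∀¹⁺ (at (0 ≤' 1) ⇒⁺ at (0 ∈' 0) ⇒⁺ (2 <⁺ 0) ⇒⁺ real⁺ φ 1 2 0 s)) (d ∷ᵉ ρ∅) (D ∷ᵉ τ)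
    (λ p x l m l' → Real-stable φ (absurd (lt⇒≱ (lt-le-trans l' l) (ze-le p d))))
    (λ {z} {z'} su ih x xz' mx dx → Real-stable φ do
      inj₂ zx ← le-or-lt x z
        where inj₁ xz → pure (ih x xz mx dx)
      -- The last element m of D before x splits off a consecutive interval [m,x⟩; the rest is
      -- covered by the induction hypothesis and idempotence, or is empty.
      (m , mm , mz , max) ← maximum D z md (lt-su su (lt-le-trans dx xz'))
      let r = h m x (mm , mx , le-lt-trans mz zx , λ w mw mw' wx → lt⇒≱ mw' (max w mw (lt-su su (lt-le-trans wx xz'))))
          dm = max d md (lt-su su (lt-le-trans dx xz'))
      inj₂ n ← em (eq d m)
        where inj₁ e → pure (interval-eq φ (eq-sym e) eq-refl r)
      pure (subst (Real φ τ [ d , x ⟩) idem (Real-mul φ (cut-interval dm (le-trans mz (proj₁ zx))) (ih m mz mm (dm , n)) r)))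
    d' d' le-refl md' l

  Real-omega : ∀ φ {τ D s} → Inf (λ y → mem y D) → Homogeneous φ τ D s → ∀ d → mem d D → Real φ τ [ d ,∞⟩ (omega φ s)
  Real-omega (meet i j) {τ} {D} {s} inf h d m =
    (λ o → do
      (d' , l , m') ← inf d
      (p , (j , _) , w) ← proj₁ (h d d' m m' l) o
      pure (p , j , w)) ,
    (λ k → do
      (p , l , w) ← k
      (d' , l' , m') ← inf p
      proj₂ (h d d' m m' (le-lt-trans l l')) (pure (p , (l , l') , w)))
  Real-omega (before i j) {τ} {D} {s} inf h d m =
    Bit-put 3 0F (has i λ r → proj₁ r) , Bit-put 3 1F (has j λ r → proj₁ (proj₂ r)) , Bit-put 3 2F (Bit-dec _
      (λ { (inj₁ o) → do
             (d' , l , m') ← inf d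
             (p , (lp , _) , mp , w) ← proj₁ (proj₂ (proj₂ (h d d' m m' l))) o
             pure (p , lp , mp , (w >>= λ { (q , (lq , _) , w') → pure (q , lq , w') }))
         -- The pair need not occur within one block: Xᵢ is met in the first block and Xⱼ in the
         -- second.
         ; (inj₂ (o , o')) → do
             (d₁ , l₁ , m₁) ← inf d
             (d₂ , l₂ , m₂) ← inf d₁
             (p , (lp , lp') , mp) ← proj₁ (proj₁ (h d d₁ m m₁ l₁)) o
             (q , (lq , _) , mq) ← proj₁ (proj₁ (proj₂ (h d₁ d₂ m₁ m₂ l₂))) o'
             pure (p , lp , mp , pure (q , le-trans (proj₁ l₁) lq , mq , lt-le-trans lp' lq)) })
      (λ k → do
        (p , lp , mp , w) ← k
        (q , lq , mq , pq) ← w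
        (d' , l' , m') ← inf q
        o ← proj₂ (proj₂ (proj₂ (h d d' m m' (le-lt-trans lq l'))))
              (pure (p , (lp , lt-trans pq l') , mp , pure (q , (lq , l') , mq , pq)))
        pure (inj₁ o)))
    where
    has : ∀ {b} i → (∀ {d'} → Real (before _ _) τ [ d , d' ⟩ s → Bit b (K (Σ D¹ λ p → [ d , d' ⟩ p × mem p (τ i)))) →
          Bit b (K (Σ D¹ λ p → [ d ,∞⟩ p × mem p (τ i)))
    has i f =
      (λ o → do
        (d' , l , m') ← inf d
        (p , (lp , _) , w) ← proj₁ (f (h d d' m m' l)) o
        pure (p , lp , w)) ,
      (λ k → do
        (p , l , w) ← k
        (d' , l' , m') ← inf p
        proj₂ (f (h d d' m m' (le-lt-trans l l'))) (pure (p , (l , l') , w)))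
  Real-omega (and φ ψ) inf h d m = Real-and φ ψ
    (Real-omega φ inf (λ d d' m m' l → proj₁ (h d d' m m' l)) d m)
    (Real-omega ψ inf (λ d d' m m' l → proj₂ (h d d' m m' l)) d m)
  Real-omega (neg φ) inf h d m = Real-omega φ inf h d m
  Real-omega (ex φ) {τ} {D} {s} inf h d m r = Bit-put (card φ) r (Bit-dec _
    (λ { (s' , t' , o , o' , idem , refl) → do
      -- Y is used on the first block only and Z on all later ones; idempotence of t' makes D
      -- homogeneous for Z.
      (d₁ , l , m₁) ← inf d
      (Y , y) ← proj₁ (h d d₁ m m₁ l s') o
      (Z , z) ← choice φ τ D t' (λ { d d' (md , md' , l , _) → proj₁ (h d d' md md' l t') o' })
      (W , w) ← glue d₁ Y Z
      pure (W , Real-mul φ (cut-tail (proj₁ l))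
        (Real-local φ (same (λ _ → id , id) λ { zero p j → ⇔-sym (proj₁ (w p) (proj₂ j)) ; (suc i) p j → id , id }) y)
        (Real-local φ (same (λ _ → id , id) λ { zero p j → ⇔-sym (proj₂ (w p) j) ; (suc i) p j → id , id })
          (Real-omega φ inf (homogeneous φ idem z) d₁ m₁))) })
    (λ k → do
      (Y , y) ← k
      -- Homogeneity for `ex φ` does not fix the type of this particular Y on the intervals of D,
      -- hence the passage to D'. Three points of D' show that f is idempotent, and the piece from d
      -- to d₁ provides s'.
      (D' , f , sub , inf' , h') ← ramsey φ (Y ∷ᵉ τ) D inf
      (d₁ , l₁ , m₁) ← inf' d
      (d₂ , l₂ , m₂) ← inf' d₁
      (d₃ , l₃ , m₃) ← inf' d₂
      (s' , r₁) ← Real-exists φ (Y ∷ᵉ τ) [ d , d₁ ⟩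
      o ← proj₂ (h d d₁ m (sub d₁ m₁) l₁ s') (pure (Y , r₁))
      o' ← proj₂ (h d₁ d₂ (sub d₁ m₁) (sub d₂ m₂) l₂ f) (pure (Y , h' d₁ d₂ m₁ m₂ l₂))
      e ← Real-unique φ (Real-mul φ (cut-interval (proj₁ l₂) (proj₁ l₃)) (h' d₁ d₂ m₁ m₂ l₂) (h' d₂ d₃ m₂ m₃ l₃))
                        (h' d₁ d₃ m₁ m₃ (lt-trans l₂ l₃))
      e' ← Real-unique φ (Real-mul φ (cut-tail (proj₁ l₁)) r₁ (Real-omega φ inf' h' d₁ m₁)) y
      pure (s' , f , o , o' , e , e')))

-- Types of the empty word

-- The type of a block of k + 1 empty letters.
power : ∀ φ → ℕ → Tp φ
power φ zero    = letter φ λ _ → zero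
power φ (suc k) = mul φ (power φ k) (power φ zero)

-- Types of empty blocks are eventually periodic in the length. The identity says that doubling the
-- length preserves the type; it becomes idempotence for `mul` in `e-idempotent`, where both sides
-- are types of one block of a model.
idempotent-exponent : ∀ φ → Σ ℕ λ k → power φ (suc (k + k)) ≡ power φ k
idempotent-exponent φ with pigeonhole (ℕₚ.n<1+n (card φ)) (λ i → power φ (toℕ i))
... | i , j , i<j , e with ℕₚ.m≤n⇒∃[o]m+o≡n i<j
... | p , q = k , trans (cong (power φ) (sym (ℕₚ.+-suc k k))) (periods (suc m) k i≤k)
  where
  m k : ℕ
  m = toℕ i
  -- The length suc k equals suc m * suc p, a multiple of the period suc p, and k is at least m,
  -- where periodicity sets in.
  k = p + m * suc p
  i≤k : m ≤ k
  i≤k = ℕₚ.≤-trans (ℕₚ.m≤m*n m (suc p)) (ℕₚ.m≤n+m _ p)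
  period : ∀ c → power φ (c + (m + suc p)) ≡ power φ (c + m)
  period zero    = trans (cong (power φ) (trans (ℕₚ.+-suc m p) q)) (sym e)
  period (suc c) = cong (λ s → mul φ s (power φ zero)) (period c)
  period' : ∀ k → m ≤ k → power φ (k + suc p) ≡ power φ k
  period' k l with ℕₚ.m≤n⇒∃[o]m+o≡n l
  ... | c , refl = trans (cong (power φ) (trans (cong (_+ suc p) (ℕₚ.+-comm m c)) (ℕₚ.+-assoc c m (suc p))))
                         (trans (period c) (cong (power φ) (ℕₚ.+-comm c m)))
  periods : ∀ n k → m ≤ k → power φ (k + n * suc p) ≡ power φ k
  periods zero    k l = cong (power φ) (ℕₚ.+-identityʳ k)
  periods (suc n) k l = trans (cong (power φ) (sym (ℕₚ.+-assoc k (suc p) (n * suc p))))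
    (trans (periods n (k + suc p) (ℕₚ.≤-trans l (ℕₚ.m≤m+n k (suc p)))) (period' k l))

emptyTail : ∀ φ → Tp φ
emptyTail φ = omega φ (power φ (proj₁ (idempotent-exponent φ)))

-- Translation into one-sorted formulae

sing : ℕ → MF
sing i = and (meet i i) (neg (before i i))

-- r₁ and r₂ give the tracks of individual and predicate variables. Linearity of the order lets
-- `before` express the rest: y is the successor of x if it comes later and no singleton lies
-- strictly between.
tr : (ℕ → ℕ) → (ℕ → ℕ) → Fm → MF
tr r₁ r₂ (x ≐ y)  = meet (r₁ x) (r₁ y)
tr r₁ r₂ (x ≤' y) = neg (before (r₁ y) (r₁ x))
tr r₁ r₂ (S x y)  = and (before (r₁ x) (r₁ y))
  (neg (ex (and (sing 0) (and (before (suc (r₁ x)) 0) (before 0 (suc (r₁ y)))))))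
tr r₁ r₂ (Zero x) = neg (ex (before 0 (suc (r₁ x))))
tr r₁ r₂ (x ∈' X) = meet (r₁ x) (r₂ X)
tr r₁ r₂ ⊤'       = neg (and (meet 0 0) (neg (meet 0 0)))
tr r₁ r₂ ⊥'       = and (meet 0 0) (neg (meet 0 0))
tr r₁ r₂ (φ ∧' ψ) = and (tr r₁ r₂ φ) (tr r₁ r₂ ψ)
tr r₁ r₂ (¬' φ)   = neg (tr r₁ r₂ φ)
tr r₁ r₂ (∃¹ φ)   = ex (and (sing 0) (tr (0 ∷ᵉ (suc ∘ r₁)) (suc ∘ r₂) φ))
tr r₁ r₂ (∃² φ)   = ex (tr (suc ∘ r₁) (0 ∷ᵉ (suc ∘ r₂)) φ)

-- The bounded formula

append : ∀ {A : Set} q → (Fin q → A) → (ℕ → A) → ℕ → A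
append zero    h σ = σ
append (suc q) h σ = h zero ∷ᵉ append q (h ∘ suc) σ

append-+ : ∀ {A : Set} q (h : Fin q → A) σ i → append q h σ (q + i) ≡ σ i
append-+ zero    h σ i = refl
append-+ (suc q) h σ i = append-+ q (h ∘ suc) σ i

append-< : ∀ {A : Set} q (h : Fin q → A) σ {i} (l : i < q) → append q h σ i ≡ h (fromℕ< l)
append-< (suc q) h σ {zero}  l       = refl
append-< (suc q) h σ {suc i} (s≤s l) = append-< q (h ∘ suc) σ l

append-rel : ∀ {A B : Set} (P : A → B → Set) q h h' {σ σ'} → (∀ i → P (h i) (h' i)) → (∀ i → P (σ i) (σ' i)) →
             ∀ i → P (append q h σ i) (append q h' σ' i)
append-rel P zero    h h' a b i       = b i
append-rel P (suc q) h h' a b zero    = a zero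
append-rel P (suc q) h h' a b (suc i) = append-rel P q (h ∘ suc) (h' ∘ suc) (a ∘ suc) b i

-- Predicate variables of ψ beyond X₁,…,X_q do not occur and are sent to {x}.
tracks : ℕ → ℕ → ℕ
tracks q = 0 ∷ᵉ append q (suc ∘ toℕ) (λ _ → 0)

ifOn : Fin 2 → Fm → Fm
ifOn zero    φ = ⊥'
ifOn (suc _) φ = φ

-- The quantified set stands for {x}. It is pinned down only within the domain, which suffices
-- because types are local (`Real-local`).
body : Dom → ℕ → MF → Fm
body d q φ = ∃² ((¬' (∃[ d ] (¬' ((0 ∈' 0) ⇔' (0 ≐ 1))))) ∧'
  ⋁' (card φ) λ t → ifOn (accept φ (mul φ t (emptyTail φ))) (realF φ (tracks q) d t))

bounded : ℕ → Fm → Fm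
bounded q ψ = body (upto 0) q (tr (λ _ → 0) suc ψ)

-- Relativization and free variables of the bounded formula

rel-bitF : ∀ b {i φ ψ} → rel i φ ≡ ψ → rel i (bitF b φ) ≡ bitF b ψ
rel-bitF zero    e = cong ¬'_ e
rel-bitF (suc b) e = e

rel-⋀ : ∀ n {i} {f g : Fin n → Fm} → (∀ t → rel i (f t) ≡ g t) → rel i (⋀' n f) ≡ ⋀' n g
rel-⋀ zero    e = refl
rel-⋀ (suc n) e = cong₂ _∧'_ (e zero) (rel-⋀ n (e ∘ suc))

rel-⋁ : ∀ n {i} {f g : Fin n → Fm} → (∀ t → rel i (f t) ≡ g t) → rel i (⋁' n f) ≡ ⋁' n g
rel-⋁ zero    e = refl
rel-⋁ (suc n) e = cong₂ (λ φ ψ → ¬' (¬' φ ∧' ¬' ψ)) (e zero) (rel-⋁ n (e ∘ suc))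

rel-ifOn : ∀ b {i φ ψ} → rel i φ ≡ ψ → rel i (ifOn b φ) ≡ ifOn b ψ
rel-ifOn zero    e = refl
rel-ifOn (suc b) e = e

rel-realF : ∀ φ {i π s} → rel i (realF φ π all s) ≡ realF φ π (upto i) s
rel-realF (meet j k)   {s = s} = rel-bitF s refl
rel-realF (before j k) {s = s} = cong₂ _∧'_ (rel-bitF (get 3 s 0F) refl)
  (cong₂ _∧'_ (rel-bitF (get 3 s 1F) refl) (rel-bitF (get 3 s 2F) refl))
rel-realF (and φ ψ)    = cong₂ _∧'_ (rel-realF φ) (rel-realF ψ)
rel-realF (neg φ)      = rel-realF φ
rel-realF (ex φ) {s = s} = rel-⋀ (card φ) λ t → rel-bitF (get (card φ) s t) (cong ∃² (rel-realF φ))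

rel-body : ∀ q φ → rel 0 (body all q φ) ≡ body (upto 0) q φ
rel-body q φ = cong (λ θ → ∃² (_ ∧' θ)) (rel-⋁ (card φ) λ t → rel-ifOn _ (rel-realF φ))

module Scope (In : Fm → Set) (⊤-in : In ⊤') (⊥-in : In ⊥') (¬-in : ∀ {φ} → In φ → In (¬' φ))
             (∧-in : ∀ {φ ψ} → In φ → In ψ → In (φ ∧' ψ)) where
  bitF-in : ∀ b {φ} → In φ → In (bitF b φ)
  bitF-in zero    p = ¬-in p
  bitF-in (suc b) p = p

  ifOn-in : ∀ b {φ} → In φ → In (ifOn b φ)
  ifOn-in zero    p = ⊥-in
  ifOn-in (suc b) p = p

  ⋀-in : ∀ n {f : Fin n → Fm} → (∀ t → In (f t)) → In (⋀' n f)
  ⋀-in zero    p = ⊤-in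
  ⋀-in (suc n) p = ∧-in (p zero) (⋀-in n (p ∘ suc))

  ⋁-in : ∀ n {f : Fin n → Fm} → (∀ t → In (f t)) → In (⋁' n f)
  ⋁-in zero    p = ⊥-in
  ⋁-in (suc n) p = ¬-in (∧-in (¬-in (p zero)) (¬-in (⋁-in n (p ∘ suc))))

module IndScope (n : ℕ) = Scope (IndAmong n) tt tt (λ p → p) _,_
module PredScope (n : ℕ) = Scope (PredAmong n) tt tt (λ p → p) _,_

IndAmong-realF : ∀ φ {π s} → IndAmong 1 (realF φ π (upto 0) s)
IndAmong-realF (meet i j)   {s = s} = IndScope.bitF-in 1 s ((s≤s z≤n , s≤s (s≤s z≤n)) , s≤s z≤n , s≤s z≤n)
IndAmong-realF (before i j) {s = s} =
  IndScope.bitF-in 1 (get 3 s 0F) ((s≤s z≤n , s≤s (s≤s z≤n)) , s≤s z≤n) ,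
  IndScope.bitF-in 1 (get 3 s 1F) ((s≤s z≤n , s≤s (s≤s z≤n)) , s≤s z≤n) ,
  IndScope.bitF-in 1 (get 3 s 2F) ((s≤s z≤n , s≤s (s≤s z≤n)) , s≤s z≤n ,
    (s≤s z≤n , s≤s (s≤s (s≤s z≤n))) , s≤s z≤n , (s≤s (s≤s z≤n) , s≤s z≤n) , s≤s (s≤s z≤n) , s≤s z≤n)
IndAmong-realF (and φ ψ) = IndAmong-realF φ , IndAmong-realF ψ
IndAmong-realF (neg φ)   = IndAmong-realF φ
IndAmong-realF (ex φ) {s = s} = IndScope.⋀-in 1 (card φ) λ t → IndScope.bitF-in 1 (get (card φ) s t) (IndAmong-realF φ)

PredAmong-realF : ∀ φ {π i s m} → (∀ k → π k < m) → PredAmong m (realF φ π (upto i) s)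
PredAmong-realF (meet i j)   {s = s} l = PredScope.bitF-in _ s (tt , l i , l j)
PredAmong-realF (before i j) {s = s} l =
  PredScope.bitF-in _ (get 3 s 0F) (tt , l i) ,
  PredScope.bitF-in _ (get 3 s 1F) (tt , l j) ,
  PredScope.bitF-in _ (get 3 s 2F) (tt , l i , tt , l j , tt , tt)
PredAmong-realF (and φ ψ) l = PredAmong-realF φ l , PredAmong-realF ψ l
PredAmong-realF (neg φ)   l = PredAmong-realF φ l
PredAmong-realF (ex φ) {s = s} l = PredScope.⋀-in _ (card φ) λ t → PredScope.bitF-in _ (get (card φ) s t)
  (PredAmong-realF φ λ { zero → s≤s z≤n ; (suc k) → s≤s (l k) })

IndAmong-bounded : ∀ q ψ → IndAmong 1 (bounded q ψ)
IndAmong-bounded q ψ = ((s≤s z≤n , s≤s (s≤s z≤n)) ,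
    (s≤s z≤n , s≤s z≤n , s≤s (s≤s z≤n)) , ((s≤s z≤n , s≤s (s≤s z≤n)) , s≤s z≤n)) ,
  IndScope.⋁-in 1 (card φ) λ t → IndScope.ifOn-in 1 (accept φ (mul φ t (emptyTail φ))) (IndAmong-realF φ)
  where φ = tr (λ _ → 0) suc ψ

PredAmong-bounded : ∀ q ψ → PredAmong q (bounded q ψ)
PredAmong-bounded q ψ = (tt , (s≤s z≤n , tt) , (tt , s≤s z≤n)) ,
  PredScope.⋁-in _ (card φ) λ t → PredScope.ifOn-in _ (accept φ (mul φ t (emptyTail φ))) (PredAmong-realF φ tracks<)
  where
  φ = tr (λ _ → 0) suc ψ
  tracks< : ∀ k → tracks q k < suc q
  tracks< zero    = s≤s z≤n
  tracks< (suc k) = append-rel (λ a _ → a < suc q) q (suc ∘ toℕ) (λ _ → tt) {σ' = λ _ → tt} (λ i → s≤s (toℕ<n i)) (λ _ → s≤s z≤n) k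

-- Satisfaction, empty tails and the translation in a model

module Main (M : Model) where
  open Ramsey M

  Sat : MF → (ℕ → D²) → (D¹ → Set) → Set
  Sat (meet i j)   τ J = K (Σ D¹ λ p → J p × (mem p (τ i) × mem p (τ j)))
  Sat (before i j) τ J = K (Σ D¹ λ p → J p × (mem p (τ i) × K (Σ D¹ λ q → J q × (mem q (τ j) × lt p q))))
  Sat (and φ ψ)    τ J = Sat φ τ J × Sat ψ τ J
  Sat (neg φ)      τ J = Sat φ τ J → R
  Sat (ex φ)       τ J = K (Σ D² λ Y → Sat φ (Y ∷ᵉ τ) J)

  accept-Sat : ∀ φ {τ J s} → Real φ τ J s → Bit (accept φ s) (Sat φ τ J)
  accept-Sat (meet i j)   h = h
  accept-Sat (before i j) (_ , _ , h) = h
  accept-Sat (and φ ψ) (h , h') = Bit-dec _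
    (λ { (o , o') → proj₁ (accept-Sat φ h) o , proj₁ (accept-Sat ψ h') o' })
    (λ { (p , p') → proj₂ (accept-Sat φ h) p >>= λ o → proj₂ (accept-Sat ψ h') p' >>= λ o' → pure (o , o') })
  accept-Sat (neg φ) {s = s} h = Bit-dec _
    (λ n p → proj₂ (accept-Sat φ h) p λ o → ⊥-elim (n o))
    (λ n → case on? (accept φ s) of λ { (yes o) → absurd (n (proj₁ (accept-Sat φ h) o)) ; (no n') → pure n' })
  accept-Sat (ex φ) {τ} {J} h = Bit-dec _
    (λ { (t , o , o') → proj₁ (h t) o >>= λ { (Y , y) → pure (Y , proj₁ (accept-Sat φ y) o') } })
    (λ m → do
      (Y , p) ← m
      (t , y) ← Real-exists φ (Y ∷ᵉ τ) J
      o ← proj₂ (h t) (pure (Y , y))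
      o' ← proj₂ (accept-Sat φ y) p
      pure (t , o , o'))

  Real-letter : ∀ φ {τ J p} l → (∀ q → J q ⇔ eq q p) → (∀ i → Bit (l i) (mem p (τ i))) → Real φ τ J (letter φ l)
  Real-letter (meet i j) {p = p} l e b = Bit-dec _
    (λ { (o , o') → pure (p , proj₂ (e p) eq-refl , proj₁ (b i) o , proj₁ (b j) o') })
    (λ m → do
      (q , jq , m₁ , m₂) ← m
      o ← proj₂ (b i) (eq-mem (proj₁ (e q) jq) m₁)
      o' ← proj₂ (b j) (eq-mem (proj₁ (e q) jq) m₂)
      pure (o , o'))
  Real-letter (before i j) {τ} {J} {p} l e b = Bit-put 3 0F (has i) , Bit-put 3 1F (has j) , Bit-put 3 2F
    ((λ ()) , λ m → do
      (q , jq , _ , w) ← m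
      (q' , jq' , _ , lq) ← w
      absurd (lt⇒≱ lq (le-trans (eq-le (proj₁ (e q') jq')) (eq-ge (proj₁ (e q) jq)))))
    where
    has : ∀ i → Bit (l i) (K (Σ D¹ λ q → J q × mem q (τ i)))
    has i = Bit-map ((λ m → pure (p , proj₂ (e p) eq-refl , m))
                    , λ m → mem-stable (m >>= λ { (q , jq , m') → pure (eq-mem (proj₁ (e q) jq) m') })) (b i)
  Real-letter (and φ ψ) l e b = Real-and φ ψ (Real-letter φ l e b) (Real-letter ψ l e b)
  Real-letter (neg φ)   l e b = Real-letter φ l e b
  Real-letter (ex φ) {τ} {J} {p} l e b r = Bit-put (card φ) r (Bit-dec _
    (λ { (zero , refl) → do
           (Y , y) ← comprehend (at ⊥') ρ∅ σ∅
           pure (Y , Real-letter φ (zero ∷ᵉ l) e λ { zero → (λ ()) , (λ m → absurd (proj₁ (y p) m)) ; (suc i) → b i })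
       ; (suc zero , refl) → do
           (Y , y) ← comprehend (at ⊤') ρ∅ σ∅
           pure (Y , Real-letter φ (suc zero ∷ᵉ l) e λ { zero → (λ _ → proj₂ (y p) tt) , (λ _ → pure refl) ; (suc i) → b i }) })
    (λ m → do
      (Y , y) ← m
      (c , h) ← Bit-exists (mem p Y)
      e' ← Real-unique φ (Real-letter φ (c ∷ᵉ l) e λ { zero → h ; (suc i) → b i }) y
      pure (c , e')))

  -- Steps k a b says that b = a + k + 1.
  Steps : ℕ → D¹ → D¹ → Set
  Steps zero    a c = su a c
  Steps (suc k) a c = Σ D¹ λ b → Steps k a b × su b c

  Steps-exists : ∀ k a → K (Σ D¹ (Steps k a))
  Steps-exists zero    a = su-ex a
  Steps-exists (suc k) a = do
    (b , h) ← Steps-exists k a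
    (c , s) ← su-ex b
    pure (c , b , h , s)

  Steps-lt : ∀ k {a b} → Steps k a b → lt a b
  Steps-lt zero    s           = su-lt s
  Steps-lt (suc k) (b , h , s) = lt-trans (Steps-lt k h) (su-lt s)

  Steps-+ : ∀ i j {a b c} → Steps i a b → Steps j b c → Steps (suc (j + i)) a c
  Steps-+ i zero    h s             = _ , h , s
  Steps-+ i (suc j) h (b' , h' , s) = b' , Steps-+ i j h h' , s

  module Empty (φ : MF) (τ : ℕ → D²) (a : D¹) (empty : ∀ i p → le a p → mem p (τ i) → R) where

    Real-point : ∀ {b c} → le a b → su b c → Real φ τ [ b , c ⟩ (power φ zero)
    Real-point {b} ab s = Real-letter φ (λ _ → zero)
      (λ q → (λ { (l , l') → le-antisym (lt-su s l') l }) , (λ e → eq-ge e , le-su s (eq-le e)))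
      (λ i → (λ ()) , λ m → absurd (empty i b ab m))

    Real-power : ∀ k {b c} → le a b → Steps k b c → Real φ τ [ b , c ⟩ (power φ k)
    Real-power zero    ab s           = Real-point ab s
    Real-power (suc k) ab (d , h , s) = Real-mul φ (cut-interval (proj₁ (Steps-lt k h)) (su-le s))
      (Real-power k ab h) (Real-point (le-trans ab (proj₁ (Steps-lt k h))) s)

    k : ℕ
    k = proj₁ (idempotent-exponent φ)

    e : Tp φ
    e = power φ k

    -- The block of 2 (k + 1) letters has type `mul φ e e` by composition and type e by the choice
    -- of k.
    e-idempotent : K (mul φ e e ≡ e)
    e-idempotent = do
      (b , h) ← Steps-exists k a
      (c , h') ← Steps-exists k b
      let ab = Steps-lt k h
      q ← Real-unique φ
        (Real-mul φ (cut-interval (proj₁ ab) (proj₁ (Steps-lt k h'))) (Real-power k le-refl h) (Real-power k (proj₁ ab) h'))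
        (Real-power (suc (k + k)) le-refl (Steps-+ k k h h'))
      pure (trans q (proj₂ (idempotent-exponent φ)))

    Real-emptyTail : Real φ τ [ a ,∞⟩ (emptyTail φ)
    Real-emptyTail = Real-stable φ do
      (B , b) ← comprehend (at (1 ≤' 0)) (a ∷ᵉ ρ∅) σ∅
      (D , d) ← greedy φ τ B e
      idem ← e-idempotent
      let
        above-a : ∀ {x} → mem x D → le a x
        above-a {x} m = proj₁ (b x) (proj₁ (proj₁ (d x) m))
        ma : mem a D
        ma = proj₂ (d a) (proj₂ (b a) le-refl , λ x m l → Real-stable φ (absurd (lt⇒≱ l (above-a m))))
        hom : Homogeneous φ τ D e
        hom x y mx my l = proj₂ (proj₁ (d y) my) x mx l
        inf : Inf λ y → mem y D
        inf c none = R-stable do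
          (z , az , cz) ← above₂ a c
          (m , mm , mz , max) ← maximum D z ma (proj₁ az)
          (y , st) ← Steps-exists k m
          let
            below-m : ∀ x → mem x D → K (le x m)
            below-m x mx = le-or-lt x c >>= λ
              { (inj₁ l) → pure (max x mx (le-trans l (proj₁ cz))) ; (inj₂ l) → absurd (none (x , l , mx)) }
            my = Steps-lt k st
            r = Real-power k (above-a mm) st
            yD : mem y D
            yD = proj₂ (d y) (proj₂ (b y) (le-trans (above-a mm) (proj₁ my)) , λ x mx _ → Real-stable φ do
              xm ← below-m x mx
              inj₂ n ← em (eq x m)
                where inj₁ q → pure (interval-eq φ (eq-sym q) eq-refl r)
              pure (subst (Real φ τ [ x , y ⟩) idem
                (Real-mul φ (cut-interval xm (proj₁ my)) (hom x m mx mm (xm , n)) r)))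
          l ← below-m y yD
          pure (lt⇒≱ my l)
      pure (Real-omega φ inf hom a ma)

  Everything : D¹ → Set
  Everything _ = ⊤

  Singleton : D² → D¹ → Set
  Singleton Y a = ∀ p → mem p Y ⇔ eq p a

  singleton : ∀ a → K (Σ D² λ Y → Singleton Y a)
  singleton a = comprehend (at (0 ≐ 1)) (a ∷ᵉ ρ∅) σ∅

  sing⇔ : ∀ {τ} i → Sat (sing i) τ Everything ⇔ K (Σ D¹ (Singleton (τ i)))
  sing⇔ i =
    (λ { (h , n) → h >>= λ { (a , _ , m , _) → pure (a , λ p →
      (λ m' → eq-stable do
        inj₁ l ← le-or-lt p a
          where inj₂ l → absurd (n (pure (a , tt , m , pure (p , tt , m' , l))))
        inj₁ l' ← le-or-lt a p
          where inj₂ l' → absurd (n (pure (p , tt , m' , pure (a , tt , m , l'))))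
        pure (le-antisym l l')) ,
      (λ e → eq-mem (eq-sym e) m)) } }) ,
    (λ h → (h >>= λ { (a , s) → pure (a , tt , proj₂ (s a) eq-refl , proj₂ (s a) eq-refl) }) ,
      λ w → R-stable do
        (a , s) ← h
        (p , _ , m , w') ← w
        (q , _ , m' , l) ← w'
        pure (lt⇒≱ l (le-trans (eq-le (proj₁ (s q) m')) (eq-ge (proj₁ (s p) m)))))

  lt-eq : ∀ {x x' y y'} → eq x x' → eq y y' → lt x y → lt x' y'
  lt-eq e e' l = lt-le-trans (le-lt-trans (eq-ge e) l) (eq-le e')

  before⇔ : ∀ τ i j {a b} → Singleton (τ i) a → Singleton (τ j) b → Sat (before i j) τ Everything ⇔ lt a b
  before⇔ τ i j {a} {b} s t =
    (λ h → lt-stable do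
      (p , _ , m , w) ← h
      (q , _ , m' , l) ← w
      pure (lt-eq (proj₁ (s p) m) (proj₁ (t q) m') l)) ,
    (λ l → pure (a , tt , proj₂ (s a) eq-refl , pure (b , tt , proj₂ (t b) eq-refl , l)))

  tr⇔ : ∀ φ {r₁ r₂ ρ σ τ} → (∀ x → Singleton (τ (r₁ x)) (ρ x)) → (∀ X p → mem p (τ (r₂ X)) ⇔ mem p (σ X)) →
        Sat (tr r₁ r₂ φ) τ Everything ⇔ ⟦ φ ⟧ ρ σ
  tr⇔ (x ≐ y) {ρ = ρ} s t =
    (λ h → eq-stable (h >>= λ { (p , _ , m , m') →
      pure (le-antisym (le-trans (eq-ge (proj₁ (s x p) m)) (eq-le (proj₁ (s y p) m')))
                       (le-trans (eq-ge (proj₁ (s y p) m')) (eq-le (proj₁ (s x p) m)))) })) ,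
    (λ e → pure (ρ x , tt , proj₂ (s x (ρ x)) eq-refl , proj₂ (s y (ρ x)) e))
  tr⇔ (x ≤' y) {r₁} {ρ = ρ} {τ = τ} s t =
    (λ n → le-stable (le-or-lt (ρ x) (ρ y) >>= λ
      { (inj₁ l) → pure l ; (inj₂ l) → absurd (n (proj₂ (before⇔ τ (r₁ y) (r₁ x) (s y) (s x)) l)) })) ,
    (λ l h → lt⇒≱ (proj₁ (before⇔ τ (r₁ y) (r₁ x) (s y) (s x)) h) l)
  tr⇔ (S x y) {r₁} {ρ = ρ} {τ = τ} s t =
    (λ { (h , n) → su-stable do
      (c , sc) ← su-ex (ρ x)
      let l = su-min sc (proj₁ (before⇔ τ (r₁ x) (r₁ y) (s x) (s y)) h)
      inj₂ ne ← em (eq c (ρ y))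
        where inj₁ e → pure (eq-subst (S 1 0) (ρ x ∷ᵉ ρ∅) σ∅ e sc)
      (Z , z) ← singleton c
      absurd (n (pure (Z , proj₂ (sing⇔ {Z ∷ᵉ τ} 0) (pure (c , z)) ,
        proj₂ (before⇔ (Z ∷ᵉ τ) (suc (r₁ x)) 0 (s x) z) (su-lt sc) ,
        proj₂ (before⇔ (Z ∷ᵉ τ) 0 (suc (r₁ y)) z (s y)) (l , ne)))) }) ,
    (λ sxy → proj₂ (before⇔ τ (r₁ x) (r₁ y) (s x) (s y)) (su-lt sxy) , λ m → R-stable do
      (Z , zs , b₁ , b₂) ← m
      (c , z) ← proj₁ (sing⇔ {Z ∷ᵉ τ} 0) zs
      pure (lt⇒≱ (proj₁ (before⇔ (Z ∷ᵉ τ) (suc (r₁ x)) 0 (s x) z) b₁)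
                 (lt-su sxy (proj₁ (before⇔ (Z ∷ᵉ τ) 0 (suc (r₁ y)) z (s y)) b₂))))
  tr⇔ (Zero x) {r₁} {ρ = ρ} {τ = τ} s t =
    (λ n → ze-stable do
      (z , p) ← ze-ex
      inj₂ ne ← em (eq z (ρ x))
        where inj₁ e → pure (eq-subst (Zero 0) ρ∅ σ∅ e p)
      (Z , zz) ← singleton z
      absurd (n (pure (Z , proj₂ (before⇔ (Z ∷ᵉ τ) 0 (suc (r₁ x)) zz (s x)) (ze-le p (ρ x) , ne))))) ,
    (λ p m → R-stable do
      (Z , w) ← m
      (q , _ , _ , w') ← w
      (q' , _ , m' , l) ← w'
      pure (lt⇒≱ (lt-le-trans l (eq-le (proj₁ (s x q') m'))) (ze-le p q)))
  tr⇔ (x ∈' X) {ρ = ρ} s t =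
    (λ h → mem-stable (h >>= λ { (p , _ , m , m') → pure (eq-mem (proj₁ (s x p) m) (proj₁ (t X p) m')) })) ,
    (λ m → pure (ρ x , tt , proj₂ (s x (ρ x)) eq-refl , proj₂ (t X (ρ x)) m))
  tr⇔ ⊤' s t = (λ _ → tt) , (λ _ → λ { (h , n) → n h })
  tr⇔ ⊥' s t = (λ { (h , n) → n h }) , (λ r → absurd r , λ _ → r)
  tr⇔ (φ ∧' ψ) s t = ×-⇔ (tr⇔ φ s t) (tr⇔ ψ s t)
  tr⇔ (¬' φ) s t = (λ n → n ∘ proj₂ (tr⇔ φ s t)) , (λ n → n ∘ proj₁ (tr⇔ φ s t))
  tr⇔ (∃¹ φ) {τ = τ} s t =
    (λ m → do
      (Z , zs , h) ← m
      (a , z) ← proj₁ (sing⇔ {Z ∷ᵉ τ} 0) zs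
      pure (a , proj₁ (tr⇔ φ (λ { zero → z ; (suc x) → s x }) t) h)) ,
    (λ m → do
      (a , h) ← m
      (Z , z) ← singleton a
      pure (Z , proj₂ (sing⇔ {Z ∷ᵉ τ} 0) (pure (a , z)) , proj₂ (tr⇔ φ (λ { zero → z ; (suc x) → s x }) t) h))
  tr⇔ (∃² φ) s t = KΣ-⇔ λ Y → tr⇔ φ s (λ { zero p → id , id ; (suc X) p → t X p })

  -- The hypothesis and the final equivalence

  ∀²^-intro : ∀ k {φ ρ σ} → (∀ κ → ⟦ φ ⟧ ρ κ) → ⟦ ∀²^ k φ ⟧ ρ σ
  ∀²^-intro zero    h = h _
  ∀²^-intro (suc k) {φ} h m = m λ { (Y , n) → n (∀²^-intro k {φ} h) }

  -- The outermost of suc k quantifiers binds index k, hence the instance `κ k`. Environments agree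
  -- only pointwise, so that the base case goes through a bound on the free variables.
  ∀²^-elim : ∀ k {φ ρ σ} → ⟦ ∀²^ k φ ⟧ ρ σ → ∀ κ → (∀ i → κ (k + i) ≡ σ i) → ⟦ φ ⟧ ρ κ
  ∀²^-elim zero    {φ} {ρ} h κ e = let (n , p , q) = bound φ in ⟦⟧-agree φ p q (λ _ → refl) (λ {i} _ → sym (e i)) h
  ∀²^-elim (suc k) {φ} h κ e = ∀²^-elim k {φ} (proj₁ (⟦⟧⁺⇔ (∀²⁺ (at (∀²^ k φ)))) h (κ k)) κ
    λ { zero → cong κ (ℕₚ.+-identityʳ k) ; (suc i) → trans (cong κ (ℕₚ.+-suc k i)) (e i) }

  ⋀-intro : ∀ q {f ρ σ} → (∀ i → i < q → ⟦ f i ⟧ ρ σ) → ⟦ ⋀ q f ⟧ ρ σ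
  ⋀-intro zero    h = tt
  ⋀-intro (suc q) h = ⋀-intro q (λ i l → h i (ℕₚ.m≤n⇒m≤1+n l)) , h q (ℕₚ.n<1+n q)

  ⇔'-⇔ : ∀ φ ψ {ρ σ} → ⟦ φ ⇔' ψ ⟧ ρ σ ⇔ (⟦ φ ⟧ ρ σ ⇔ ⟦ ψ ⟧ ρ σ)
  ⇔'-⇔ φ ψ = ⟦⟧⁺⇔ ((at φ ⇒⁺ at ψ) ∧⁺ (at ψ ⇒⁺ at φ))

  ifOn⇔ : ∀ b {φ ρ σ P} → ⟦ φ ⟧ ρ σ ⇔ P → ⟦ ifOn b φ ⟧ ρ σ ⇔ K (On b × P)
  ifOn⇔ zero       e = absurd , λ m → m λ { (() , _) }
  ifOn⇔ (suc zero) {φ} (f , g) = (λ h → pure (refl , f h)) , λ m → ⟦⟧-stable φ (m >>= λ { (_ , p) → pure (g p) })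

  module _ (q : ℕ) (ψ : Fm) (among : FreeAmong q ψ) (ρ₀ : ℕ → D¹) (σ₀ : ℕ → D²) (hB : ⟦ B q ψ ⟧ ρ₀ σ₀)
           (x : D¹) (κ : ℕ → D²) where

    φ : MF
    φ = tr (λ _ → 0) suc ψ

    Below : D¹ → Set
    Below p = le p x

    cut-at : (Z : D²) (h : Fin q → D²) → ℕ → D²
    cut-at Z h = append q h λ _ → Z

    -- This is where `hB` enters: it is applied to κ and to the sets h, which coincide with κ up to
    -- x and are empty beyond.
    restriction : (h : Fin q → D²) → (∀ i p → mem p (h i) ⇔ (le p x × mem p (κ (toℕ i)))) →
                  ∀ Z → ⟦ ψ ⟧ (λ _ → x) (cut-at Z h) ⇔ ⟦ ψ ⟧ (x ∷ᵉ ρ₀) κ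
    restriction h e Z = ⇔-trans (⇔-trans to-κ' middle) from-κ'
      where
      -- The layout of `B`: positions below q hold the Z'ᵢ, here κ, and the next q positions the Zᵢ,
      -- here h. From q + q on, `∀²^-elim` demands σ₀.
      κ' : ℕ → D²
      κ' = append q (κ ∘ toℕ) (append q h σ₀)
      κ'-κ : ∀ {i} → i < q → κ' i ≡ κ i
      κ'-κ l = trans (append-< q (κ ∘ toℕ) (append q h σ₀) l) (cong κ (toℕ-fromℕ< l))
      κ'-h : ∀ {i} (l : i < q) → κ' (q + i) ≡ h (fromℕ< l)
      κ'-h {i} l = trans (append-+ q (κ ∘ toℕ) (append q h σ₀) i) (append-< q h σ₀ l)
      only-x : ∀ {i} → i < 1 → x ≡ (x ∷ᵉ ρ₀) i
      only-x {zero} _ = refl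
      only-x {suc _} (s≤s ())
      from-κ' : ⟦ ψ ⟧ (x ∷ᵉ ρ₀) κ' ⇔ ⟦ ψ ⟧ (x ∷ᵉ ρ₀) κ
      from-κ' = ⟦⟧-agree ψ (proj₁ among) (proj₂ among) (λ _ → refl) κ'-κ
              , ⟦⟧-agree ψ (proj₁ among) (proj₂ among) (λ _ → refl) (λ l → sym (κ'-κ l))
      to-κ' : ⟦ ψ ⟧ (λ _ → x) (cut-at Z h) ⇔ ⟦ ren2 (q +_) ψ ⟧ (x ∷ᵉ ρ₀) κ'
      to-κ' = ⇔-trans
        ( ⟦⟧-agree ψ (proj₁ among) (proj₂ among) only-x (λ l → trans (append-< q h (λ _ → Z) l) (sym (κ'-h l)))
        , ⟦⟧-agree ψ (proj₁ among) (proj₂ among) (λ l → sym (only-x l)) (λ l → trans (κ'-h l) (sym (append-< q h (λ _ → Z) l))))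
        (⇔-sym (⟦⟧-ren2 ψ λ _ → refl))
      agreeF : ℕ → Fm
      agreeF i = ∀¹ ((zero ≤' 1) ⇒' ((zero ∈' (q + i)) ⇔' (zero ∈' i)))
      matrix : Fm
      matrix = ⋀ q agreeF ⇒' (ren2 (q +_) ψ ⇔' ψ)
      κ'-fin : ∀ {i} (l : i < q) → κ' i ≡ κ (toℕ (fromℕ< l))
      κ'-fin l = append-< q (κ ∘ toℕ) (append q h σ₀) l
      agreement : ∀ i → i < q → ⟦ agreeF i ⟧ (x ∷ᵉ ρ₀) κ'
      agreement i l = proj₂ (⟦⟧⁺⇔ (∀¹⁺ (at (0 ≤' 1) ⇒⁺ ((at (0 ∈' (q + i)) ⇒⁺ at (0 ∈' i)) ∧⁺ (at (0 ∈' i) ⇒⁺ at (0 ∈' (q + i)))))) {x ∷ᵉ ρ₀} {κ'})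
        λ y yx → (λ m → subst (mem y) (sym (κ'-fin l)) (proj₂ (proj₁ (e _ y) (subst (mem y) (κ'-h l) m))))
               , (λ m → subst (mem y) (sym (κ'-h l)) (proj₂ (e _ y) (yx , subst (mem y) (κ'-fin l) m)))
      middle : ⟦ ren2 (q +_) ψ ⟧ (x ∷ᵉ ρ₀) κ' ⇔ ⟦ ψ ⟧ (x ∷ᵉ ρ₀) κ'
      middle = proj₁ (⇔'-⇔ (ren2 (q +_) ψ) ψ) (proj₁ (⟦⟧⁺⇔ (at (⋀ q agreeF) ⇒⁺ at (ren2 (q +_) ψ ⇔' ψ)))
        (∀²^-elim (q + q) {matrix} (proj₁ (⟦⟧⁺⇔ (∀¹⁺ (at (∀²^ (q + q) matrix)))) hB x) κ'
          λ i → trans (cong κ' (ℕₚ.+-assoc q q i))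
            (trans (append-+ q (κ ∘ toℕ) (append q h σ₀) (q + i)) (append-+ q h σ₀ i)))
        (⋀-intro q {agreeF} agreement))

    Singletonˣ : D² → Set
    Singletonˣ Z = ∀ p → le p x → mem p Z ⇔ eq p x

    bounded⇔ : ⟦ bounded q ψ ⟧ (x ∷ᵉ ρ₀) κ ⇔
      K (Σ D² λ Z → Singletonˣ Z × Σ (Tp φ) λ t → On (accept φ (mul φ t (emptyTail φ))) × Real φ ((Z ∷ᵉ κ) ∘ tracks q) Below t)
    bounded⇔ = ⇔-trans (KΣ-⇔ λ Z → ×-⇔ (first Z) (⋁⇔ (card φ) _ λ t → ifOn⇔ _ (realF⇔ φ)))
      ( (λ m → m >>= λ { (Z , s , m') → m' >>= λ { (t , m'') → m'' >>= λ { (o , r) → pure (Z , s , t , o , r) } } })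
      , (λ m → m >>= λ { (Z , s , t , o , r) → pure (Z , s , pure (t , pure (o , r))) }))
      where
      first : ∀ Z → ⟦ ¬' (∃[ upto 0 ] (¬' ((0 ∈' 0) ⇔' (0 ≐ 1)))) ⟧ (x ∷ᵉ ρ₀) (Z ∷ᵉ κ) ⇔ Singletonˣ Z
      first Z =
        (λ n p l → proj₁ (⇔'-⇔ (0 ∈' 0) (0 ≐ 1) {p ∷ᵉ x ∷ᵉ ρ₀} {Z ∷ᵉ κ})
          (⟦⟧-stable ((0 ∈' 0) ⇔' (0 ≐ 1)) {p ∷ᵉ x ∷ᵉ ρ₀} {Z ∷ᵉ κ} λ k → n (pure (p , l , k)))) ,
        (λ s m → m λ { (p , l , n) → n (proj₂ (⇔'-⇔ (0 ∈' 0) (0 ≐ 1) {p ∷ᵉ x ∷ᵉ ρ₀} {Z ∷ᵉ κ}) (s p l)) })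

    correct : K (⟦ ψ ⟧ (x ∷ᵉ ρ₀) κ ⇔ ⟦ bounded q ψ ⟧ (x ∷ᵉ ρ₀) κ)
    correct = do
      (x' , sx) ← su-ex x
      (Z , z) ← singleton x
      h ← fin-choice q λ i → comprehend (at (0 ≤' 1) ∧⁺ at (0 ∈' 0)) (x ∷ᵉ ρ∅) (κ (toℕ i) ∷ᵉ σ∅)
      let
        -- Positions from q on are filled with Z = {x}: it is empty after x, and `tracks` finds it
        -- on track 0, so that the formula acquires no further free variable.
        X̂ : ℕ → D²
        X̂ = cut-at Z (proj₁ ∘ h)
        τ : ℕ → D²
        τ = Z ∷ᵉ X̂
        below : ∀ i p → mem p (X̂ i) → le p x
        below = append-rel (λ A _ → ∀ p → mem p A → le p x) q (proj₁ ∘ h) (λ _ → tt) {σ' = λ _ → tt}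
          (λ i p m → proj₁ (proj₁ (proj₂ (h i) p) m)) (λ _ p m → eq-le (proj₁ (z p) m))
        empty : ∀ i p → le x' p → mem p (τ i) → R
        empty = λ { zero    p l m → lt⇒≱ (lt-le-trans (su-lt sx) l) (eq-le (proj₁ (z p) m))
                  ; (suc i) p l m → lt⇒≱ (lt-le-trans (su-lt sx) l) (below i p m) }
        cutₓ : Cut Below [ x' ,∞⟩ Everything
        cutₓ = record { point = x' ; left = le-su sx ; right = id ; in₁ = λ _ → tt ; in₂ = λ _ → tt
          ; out = λ { {p} _ → le-or-lt p x >>= λ { (inj₁ l) → pure (inj₁ l) ; (inj₂ l) → pure (inj₂ (su-min sx l)) } } }
        track : ∀ Z' → Singletonˣ Z' → Same τ Below ((Z' ∷ᵉ κ) ∘ tracks q) Below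
        track Z' s = same (λ _ → id , id) λ
          { zero p l → ⇔-trans (z p) (⇔-sym (s p l))
          ; (suc i) → append-rel (λ A k → ∀ p → le p x → mem p A ⇔ mem p ((Z' ∷ᵉ κ) k)) q (proj₁ ∘ h) (suc ∘ toℕ)
              (λ i p l → (λ m → proj₂ (proj₁ (proj₂ (h i) p) m)) , (λ m → proj₂ (proj₂ (h i) p) (l , m)))
              (λ _ p l → ⇔-trans (z p) (⇔-sym (s p l))) i }
        meaning = ⇔-trans (tr⇔ ψ {λ _ → 0} {suc} {τ = τ} (λ _ → z) (λ X p → id , id))
                          (restriction (proj₁ ∘ h) (λ i → proj₂ (h i)) Z)
      (t , r) ← Real-exists φ τ Below
      let acc = Bit-map meaning (accept-Sat φ (Real-mul φ cutₓ r (Empty.Real-emptyTail φ τ x' empty)))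
      pure (
        (λ p → ⟦⟧-stable (bounded q ψ) do
          o ← proj₂ acc p
          pure (proj₂ bounded⇔ (pure (Z , (λ p _ → z p) , t , o , Real-local φ (track Z λ p _ → z p) r)))) ,
        (λ b → ⟦⟧-stable ψ do
          (Z' , s , t' , o , r') ← proj₁ bounded⇔ b
          -- The formula may use another set Z' than Z, but both are {x} up to x, so that the type
          -- it asserts is the actual type t of [0,x].
          e ← Real-unique φ (Real-local φ (Same-sym (track Z' s)) r') r
          pure (proj₁ acc (subst (λ t → On (accept φ (mul φ t (emptyTail φ)))) e o))))

  bounded-correct : ∀ q ψ → FreeAmong q ψ → ∀ ρ σ → ⟦ B q ψ ⟧ ρ σ → ⟦ ∀²^ q (∀¹ (ψ ⇔' bounded q ψ)) ⟧ ρ σ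
  bounded-correct q ψ among ρ σ hB = ∀²^-intro q {∀¹ (ψ ⇔' bounded q ψ)} λ κ →
    proj₂ (⟦⟧⁺⇔ (∀¹⁺ (at (ψ ⇔' bounded q ψ)))) λ x → ⟦⟧-stable (ψ ⇔' bounded q ψ)
      (correct q ψ among ρ σ hB x κ >>= λ e → pure (proj₂ (⇔'-⇔ ψ (bounded q ψ)) e))

theorem4p11 : Σ (ℕ → Fm → Fm) (λ f → (q : ℕ) (ψ : Fm) → FreeAmong q ψ → MSO⊢ (B q ψ) → UniformlyBounded (f q ψ) × PredAmong q (f q ψ) × MSO⊢ (∀²^ q (∀¹ (ψ ⇔' f q ψ))))
theorem4p11 = bounded , λ q ψ among d →
  ((body all q (tr (λ _ → 0) suc ψ) , sym (rel-body q (tr (λ _ → 0) suc ψ))) , IndAmong-bounded q ψ) ,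
  PredAmong-bounded q ψ ,
  completeness _ _ (λ M → Main.bounded-correct M q ψ among) d
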